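{- Let $r\geq 3$ be a rational number and let $p\geq 3$ be the integer with $\binom{p}{2}\leq r<\binom{p+1}{2}$. Then there exist infinitely many $n$ such that $k=\frac1r\binom{n}{2}$ is an integer and $M(k,n)$ is attained by an edge decomposition of $K_n$ into exactly $k$ subgraphs each of which is (apart from isolated vertices) a copy of $K_p$ or of $K_{p+1}$.
   Context: For a finite graph $G$, $\mathrm{Mad}(G)=\max\{2e(H)/|V(H)| : H\subseteq G,\ |V(H)|\geq 1\}$. $M(k,n)$ is the maximum of $\sum_{i=1}^k\mathrm{Mad}(G_i)$ over all partitions of $E(K_n)$ into $k$ spanning subgraphs $G_1,\dots,G_k$. -}

module Defs where

open import Data.Bool using (Bool; true; false; _∧_; if_then_else_)
open import Data.Nat as ℕ using (ℕ; zero; suc; _+_; _*_; _≤_)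
open import Data.Fin using (Fin; toℕ; _<_; _≟_)
open import Data.Fin.Subset using (Subset; _∈_; ∣_∣)
open import Data.List using (List; allFin; map; foldr)
open import Data.Nat.ListAction using (sum)
open import Data.Integer using (+_)
open import Data.Rational as ℚ using (ℚ; _/_; 0ℚ)
open import Data.Product using (Σ; _×_)
open import Data.Sum using (_⊎_)
open import Function.Bundles using (_⇔_)
open import Relation.Nullary.Decidable using (⌊_⌋)
open import Relation.Binary.PropositionalEquality using (_≡_)

toℚ : ℕ → ℚ
toℚ m = + m / 1

-- A graph on the vertex set Fin n, given by its edge indicator.
-- Only the values G i j with toℕ i < toℕ j are meaningful: the edge {i,j}
-- (i < j) is present iff G i j ≡ true.  Values with i ≥ j are ignored.
Graph : ℕ → Set
Graph n = Fin n → Fin n → Bool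

ltᵇ : ∀ {n} → Fin n → Fin n → Bool
ltᵇ i j = ⌊ toℕ i ℕ.<? toℕ j ⌋

countEdges : ∀ {n} → Graph n → ℕ
countEdges {n} G =
  sum (map (λ i → sum (map (λ j → if ltᵇ i j ∧ G i j then 1 else 0) (allFin n))) (allFin n))

record Subgraph {n : ℕ} (G : Graph n) : Set where
  field
    V        : Subset n
    E        : Graph n
    nonempty : 1 ≤ ∣ V ∣
    sub      : ∀ i j → i < j → E i j ≡ true → (G i j ≡ true × i ∈ V × j ∈ V)

-- a / b as a rational (b = 0 never used below)
ratio : ℕ → ℕ → ℚ
ratio a zero    = 0ℚ
ratio a (suc b) = + a / suc b

density : ∀ {n} {G : Graph n} → Subgraph G → ℚ
density H = ratio (2 * countEdges (Subgraph.E H)) ∣ Subgraph.V H ∣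

IsMad : ∀ {n} → Graph n → ℚ → Set
IsMad G m = Σ (Subgraph G) (λ H → density H ≡ m) × (∀ (H : Subgraph G) → density H ℚ.≤ m)

-- A partition of E(K_n) into k spanning subgraphs G_0,…,G_{k-1}:
-- c i j (for i < j) is the index of the part containing edge {i,j}.
Decomposition : ℕ → ℕ → Set
Decomposition n k = Fin n → Fin n → Fin k

part : ∀ {n k} → Decomposition n k → Fin k → Graph n
part c a i j = ⌊ c i j ≟ a ⌋

sumℚ : ∀ {k} → (Fin k → ℚ) → ℚ
sumℚ {k} f = foldr (λ a s → f a ℚ.+ s) 0ℚ (allFin k)

AttainsM : ∀ {n k} → Decomposition n k → Set
AttainsM {n} {k} c =
  ∀ (m : Fin k → ℚ) → (∀ a → IsMad (part c a) (m a)) →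
  ∀ (c' : Decomposition n k) (q : Fin k → ℚ) → (∀ a → IsMad (part c' a) (q a)) →
  sumℚ q ℚ.≤ sumℚ m

CliqueParts : ∀ {n k} → ℕ → Decomposition n k → Set
CliqueParts {n} {k} p c =
  ∀ (a : Fin k) → Σ (Subset n) λ T →
    (∣ T ∣ ≡ p ⊎ ∣ T ∣ ≡ suc p) ×
    (∀ i j → i < j → (c i j ≡ a ⇔ (i ∈ T × j ∈ T)))

{-# OPTIONS --safe #-}

-- Mad is at most a fixed linear function of the number of edges, namely the chord of E(K_h) ↦ h - 1
-- between h = p and h = p + 1, so decompositions into copies of K_p and K_(p+1) maximise the sum.
--
-- For existence, fix a family F of cliques K_p and K_(p+1) with the right proportions and e edges in total.
-- Following Wilson, take a large prime q ≡ 1 (mod 2e) and embed each clique of F in ℤ/q so that the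
-- differences along the e edges of F lie in distinct cosets of the subgroup H of index e. As -1 ∈ H, the
-- copies s F + t, with t ∈ ℤ/q and s in H / {1, -1}, decompose K_q. The embedding exists by a second-moment
-- argument: x ↦ (a - x) / (b - x) is injective for a ≢ b, so a and b lie in the same coset relative to x
-- for about q / e choices of x.
--
-- Primes q ≡ 1 (mod m): for N divisible by m let D be the gcd of the numbers (N^m - 1) / (N^(m/l) - 1) over
-- the primes l ∣ m. Then N^m - 1 divides D ∏ (N^(m/l) - 1), and D = 1 is impossible because ∏ (X^(m/l) - 1)
-- is a nonzero element of ℤ[X]/(X^m - 1) with small coefficients. A prime q ∣ D makes N of order m modulo q.
module Submission where

open import Defs
open import Algebra.Bundles using (CommutativeRing)
import Algebra.Properties.CommutativeMonoid.Sum
import Algebra.Properties.CommutativeSemiring.Exp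
import Algebra.Solver.Ring
open import Algebra.Solver.Ring.AlmostCommutativeRing using (AlmostCommutativeRing; fromCommutativeRing; _-Raw-AlmostCommutative⟶_)
open import Data.Bool using (Bool; true; false; _∧_; not; if_then_else_)
open import Data.Empty using (⊥-elim)
open import Data.Fin as Fin using (Fin; zero; suc; toℕ; fromℕ<)
import Data.Fin.Permutation as Perm
import Data.Fin.Properties as Finₚ
open import Data.Fin.Subset as Subset using (Subset; _∈_)
open import Data.Integer as ℤ using (ℤ; +_; -[1+_]; 0ℤ; 1ℤ; ∣_∣)
import Data.Integer.DivMod as ℤ
open import Data.Integer.Divisibility.Signed as ℤ∣ using (divides; ∣⇒∣ᵤ; ∣ᵤ⇒∣) renaming (_∣_ to _∣ℤ_)
import Data.Integer.Properties as ℤ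
open import Data.Integer.Solver using () renaming (module +-*-Solver to ℤSolver)
open import Data.List using ([]; _∷_; allFin; map; foldr; tabulate)
open import Data.List.Properties using (map-tabulate)
open import Data.List.Relation.Unary.All using (_∷_)
open import Data.Maybe using (Maybe; just; nothing)
open import Data.Nat using (ℕ; zero; suc; _+_; _*_; _∸_; _^_; _⊓_; _!; _≤_; _<_; _≤?_; _<?_; z≤n; s≤s; s≤s⁻¹; NonZero; ≢-nonZero; >-nonZero; >-nonZero⁻¹; ≢-nonZero⁻¹; nonTrivial⇒n>1)
open import Data.Nat.Combinatorics using (_C_; nCk+nC[k+1]≡[n+1]C[k+1]; nC1≡n)
open import Data.Nat.Coprimality using (Coprime; prime⇒coprime; coprime-Bézout)
import Data.Nat.Divisibility as ℕ
import Data.Nat.DivMod as ℕ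
import Data.Nat.GCD as GCD
import Data.Nat.ListAction as List
open import Data.Nat.Primality using (Prime; prime?; prime⇒nonZero; prime⇒nonTrivial; euclidsLemma)
open import Data.Nat.Primality.Factorisation using (factorise)
open import Data.Nat.Properties
open import Data.Nat.Solver using () renaming (module +-*-Solver to ℕSolver)
open import Data.Product using (Σ; ∃; ∃-syntax; _×_; _,_; proj₁; proj₂)
open import Data.Rational as ℚ using (ℚ; mkℚ; 0ℚ; _/_) renaming (_≤_ to _≤ℚ_; _<_ to _<ℚ_; _*_ to _*ℚ_)
import Data.Rational.Properties as ℚ
open import Data.Rational.Unnormalised as ℚᵘ using (mkℚᵘ; *≤*; *<*; *≡*)
import Data.Rational.Unnormalised.Properties as ℚᵘ
open import Data.Sum using (_⊎_; inj₁; inj₂; [_,_]′; map₁)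
open import Data.Vec using ([]; _∷_)
import Data.Vec as Vec
import Data.Vec.Properties as Vec
open import Function using (_∘_; mk⇔; Equivalence)
open import Level using (0ℓ)
open import Relation.Binary.Definitions using (tri<; tri≈; tri>)
open import Relation.Binary.PropositionalEquality hiding ([_])
open import Relation.Nullary using (¬_; Dec; yes; no; contradiction)
open import Relation.Nullary.Decidable using (⌊_⌋)

open import Algebra.Properties.Semiring.Sum +-*-semiring using (sum; sum-cong-≗; ∑-distrib-+; ∑-comm; *-distribˡ-sum; *-distribʳ-sum)

-- Finite sums and counting

-- The arithmetic modulo q rests on Fermat's theorem and on the bound for the number of roots of a
-- polynomial. The root bound serves twice: x ^ e = 1 has at most e solutions, so the powers x ^ H
-- take at most e values and can serve as e colours; and x ^ H = 1 has at most H solutions, so two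
-- points share their colour relative to x for at most H choices of x. Although one-sided, this
-- second bound is enough. At every x the e colour classes of a set A have sizes that add up to
-- nearly |A|, so by convexity many undersized classes would push the sum of squares above what the
-- bound permits. The price is a lower threshold for q, depending on e and on the clique size. So
-- the primes must come from beyond any given bound B, which is why N is made divisible by B ! as
-- well as by the modulus.

private variable
  n m : ℕ

∑-mono : {f g : Fin n → ℕ} → (∀ i → f i ≤ g i) → sum f ≤ sum g
∑-mono {zero}  f≤g = z≤n
∑-mono {suc n} f≤g = +-mono-≤ (f≤g zero) (∑-mono (f≤g ∘ suc))

∑-const : ∀ n c → sum {n} (λ _ → c) ≡ n * c
∑-const zero    c = refl
∑-const (suc n) c = cong (λ z → c + z) (∑-const n c)

𝟙 : Bool → ℕ
𝟙 true  = 1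
𝟙 false = 0

𝟙≤1 : ∀ b → 𝟙 b ≤ 1
𝟙≤1 true  = ≤-refl
𝟙≤1 false = z≤n

𝟙-∧ : ∀ a b → 𝟙 (a ∧ b) ≡ 𝟙 a * 𝟙 b
𝟙-∧ true  b = sym (+-identityʳ _)
𝟙-∧ false b = refl

δ : Fin n → Fin n → ℕ
δ i j = 𝟙 ⌊ i Fin.≟ j ⌋

δ-refl : (i : Fin n) → δ i i ≡ 1
δ-refl i with i Fin.≟ i
... | yes _ = refl
... | no ne = contradiction refl ne

δ-≢ : {i j : Fin n} → i ≢ j → δ i j ≡ 0
δ-≢ {i = i} {j} ne with i Fin.≟ j
... | yes eq = contradiction eq ne
... | no _ = refl

δ-sym : (i j : Fin n) → δ i j ≡ δ j i
δ-sym i j with i Fin.≟ j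
... | yes refl = sym (δ-refl i)
... | no ne = sym (δ-≢ (ne ∘ sym))

δ-suc : (i j : Fin n) → δ (suc i) (suc j) ≡ δ i j
δ-suc i j with i Fin.≟ j
... | yes _ = refl
... | no _ = refl

∑-zero : {f : Fin n → ℕ} → (∀ i → f i ≡ 0) → sum f ≡ 0
∑-zero {n} f≡0 = trans (sum-cong-≗ f≡0) (trans (∑-const n 0) (*-zeroʳ n))

∑-δ : (i : Fin n) (f : Fin n → ℕ) → sum (λ j → δ i j * f j) ≡ f i
∑-δ {suc n} zero f = trans (cong₂ _+_ (+-identityʳ (f zero)) (∑-zero {n} λ _ → refl)) (+-identityʳ _)
∑-δ (suc i) f = trans (sum-cong-≗ (λ j → cong (_* f (suc j)) (δ-suc i j))) (∑-δ i (f ∘ suc))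

∑-δ1 : (i : Fin n) → sum (δ i) ≡ 1
∑-δ1 i = trans (sum-cong-≗ (λ j → sym (*-identityʳ (δ i j)))) (∑-δ i (λ _ → 1))

count : (Fin n → Bool) → ℕ
count P = sum (𝟙 ∘ P)

count≤ : (P : Fin n → Bool) → count P ≤ n
count≤ {n} P = ≤-trans (∑-mono (𝟙≤1 ∘ P)) (≤-reflexive (trans (∑-const n 1) (*-identityʳ n)))

∑-≥ : (f : Fin n → ℕ) (i : Fin n) → f i ≤ sum f
∑-≥ f zero    = m≤m+n _ _
∑-≥ f (suc i) = ≤-trans (∑-≥ (f ∘ suc) i) (m≤n+m _ _)

-- Averaging principle. In the embedding, f counts bad events and g is the indicator of a candidate
-- set, so the point found is a candidate at which nothing bad happens.
∑-<⇒∃ : (f g : Fin n → ℕ) → sum f < sum g → ∃ λ i → f i < g i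
∑-<⇒∃ {suc n} f g lt with f zero <? g zero
... | yes f<g = zero , f<g
... | no  f≮g with ∑-<⇒∃ (f ∘ suc) (g ∘ suc) (≰⇒> λ h → <⇒≱ lt (+-mono-≤ (≮⇒≥ f≮g) h))
...   | i , p = suc i , p

∑∑-* : (f : Fin n → ℕ) (g : Fin m → ℕ) → sum f * sum g ≡ sum (λ i → sum (λ j → f i * g j))
∑∑-* f g = trans (*-distribʳ-sum (sum g) f) (sum-cong-≗ (λ i → *-distribˡ-sum (f i) g))

∑-combine : ∀ {m n} (f : Fin (m * n) → ℕ) →
  sum f ≡ sum (λ i → sum (λ j → f (Fin.combine {m} {n} i j)))
∑-combine {zero}  f = refl
∑-combine {suc m} {n} f = trans (∑-++ n f) (cong (λ z → sum (λ i → f (i Fin.↑ˡ (m * n))) + z) (∑-combine {m} (f ∘ (n Fin.↑ʳ_))))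
  where
  ∑-++ : ∀ a {b} (f : Fin (a + b) → ℕ) →
    sum f ≡ sum (λ i → f (i Fin.↑ˡ b)) + sum (λ j → f (a Fin.↑ʳ j))
  ∑-++ zero    f = refl
  ∑-++ (suc a) f = trans (cong (λ z → f zero + z) (∑-++ a (f ∘ suc))) (sym (+-assoc (f zero) _ _))

-- Double counting of the pairs (i, x) with f i = x: every i has one image, and every x satisfying P
-- has one preimage.
count-image : (f : Fin m → Fin n) → (∀ {i j} → f i ≡ f j → i ≡ j) →
  (P : Fin n → Bool) → (∀ i → P (f i) ≡ true) → (∀ x → P x ≡ true → ∃ λ i → f i ≡ x) →
  count P ≡ m
count-image {m} {n} f inj P P-f f-P = begin
  count P                           ≡⟨ sum-cong-≗ fibre ⟩
  sum (λ x → sum (λ i → δ (f i) x)) ≡⟨ ∑-comm (λ x i → δ (f i) x) ⟩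
  sum (λ i → sum (δ (f i)))         ≡⟨ sum-cong-≗ (∑-δ1 ∘ f) ⟩
  sum {m} (λ _ → 1)                 ≡⟨ trans (∑-const m 1) (*-identityʳ m) ⟩
  m                                 ∎
  where
  open ≡-Reasoning
  δ-inj : ∀ i j → δ (f i) (f j) ≡ δ i j
  δ-inj i j with i Fin.≟ j
  ... | yes refl = δ-refl (f i)
  ... | no ne = δ-≢ (ne ∘ inj)
  fibre : ∀ x → 𝟙 (P x) ≡ sum (λ i → δ (f i) x)
  fibre x with P x in eq
  ... | true with i , refl ← f-P x eq = sym (trans (sum-cong-≗ (λ j → trans (δ-inj j i) (δ-sym j i))) (∑-δ1 i))
  ... | false = sym (∑-zero {m} λ i → δ-≢ {i = f i} {x} λ { refl → contradiction (trans (sym eq) (P-f i)) λ () })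

record Enumeration (P : Fin n → Bool) (c : ℕ) : Set where
  field
    nth    : Fin c → Fin n
    nth-P  : ∀ i → P (nth i) ≡ true
    nth-inj : ∀ {i j} → nth i ≡ nth j → i ≡ j
    rank   : ∀ x → P x ≡ true → ∃ λ i → nth i ≡ x

enumerate : (P : Fin n → Bool) → Enumeration P (count P)
enumerate {zero} P = record { nth = λ () ; nth-P = λ () ; nth-inj = λ { {()} } ; rank = λ () }
enumerate {suc n} P with P zero in eq | enumerate (P ∘ suc)
... | false | E = record
  { nth = suc ∘ nth ; nth-P = nth-P ; nth-inj = nth-inj ∘ Finₚ.suc-injective
  ; rank = λ { zero h → contradiction (trans (sym eq) h) λ ()
             ; (suc x) h → let i , p = rank x h in i , cong suc p } }
  where open Enumeration E
... | true | E = record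
  { nth = λ { zero → zero ; (suc i) → suc (nth i) }
  ; nth-P = λ { zero → eq ; (suc i) → nth-P i }
  ; nth-inj = λ { {zero} {zero} _ → refl ; {suc i} {suc j} h → cong suc (nth-inj (Finₚ.suc-injective h)) }
  ; rank = λ { zero h → zero , refl ; (suc x) h → let i , p = rank x h in suc i , cong suc p } }
  where open Enumeration E

count-mono : {P Q : Fin n → Bool} → (∀ x → P x ≡ true → Q x ≡ true) → count P ≤ count Q
count-mono {P = P} {Q} P⇒Q = ∑-mono pointwise
  where
  pointwise : ∀ x → 𝟙 (P x) ≤ 𝟙 (Q x)
  pointwise x with P x in eq
  ... | false = z≤n
  ... | true rewrite P⇒Q x eq = ≤-refl

count-complement : (P : Fin n → Bool) → count P + count (not ∘ P) ≡ n
count-complement {n} P = begin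
  count P + count (not ∘ P)               ≡⟨ sym (∑-distrib-+ (𝟙 ∘ P) (𝟙 ∘ not ∘ P)) ⟩
  sum (λ x → 𝟙 (P x) + 𝟙 (not (P x)))     ≡⟨ sum-cong-≗ (λ x → one (P x)) ⟩
  sum {n} (λ _ → 1)                       ≡⟨ trans (∑-const n 1) (*-identityʳ n) ⟩
  n                                       ∎
  where
  open ≡-Reasoning
  one : ∀ b → 𝟙 b + 𝟙 (not b) ≡ 1
  one true  = refl
  one false = refl

count-injection : {P : Fin n → Bool} {Q : Fin m → Bool} (f : Fin n → Fin m) →
  (∀ x → P x ≡ true → Q (f x) ≡ true) →
  (∀ x y → P x ≡ true → P y ≡ true → f x ≡ f y → x ≡ y) → count P ≤ count Q
count-injection {P = P} {Q} f P⇒Q inj = Finₚ.injective⇒≤ {f = g} g-inj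
  where
  module EP = Enumeration (enumerate P)
  module EQ = Enumeration (enumerate Q)
  g : Fin (count P) → Fin (count Q)
  g i = proj₁ (EQ.rank (f (EP.nth i)) (P⇒Q _ (EP.nth-P i)))
  g-nth : ∀ i → EQ.nth (g i) ≡ f (EP.nth i)
  g-nth i = proj₂ (EQ.rank (f (EP.nth i)) (P⇒Q _ (EP.nth-P i)))
  g-inj : ∀ {i j} → g i ≡ g j → i ≡ j
  g-inj {i} {j} eq = EP.nth-inj (inj _ _ (EP.nth-P i) (EP.nth-P j)
    (trans (sym (g-nth i)) (trans (cong EQ.nth eq) (g-nth j))))

⌊⌋-true : ∀ {a} {A : Set a} (d : Dec A) → ⌊ d ⌋ ≡ true → A
⌊⌋-true (yes a) _ = a

true-⌊⌋ : ∀ {a} {A : Set a} (d : Dec A) → A → ⌊ d ⌋ ≡ true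
true-⌊⌋ (yes _) _ = refl
true-⌊⌋ (no ¬a) a = contradiction a ¬a

∧-true : ∀ a b → a ∧ b ≡ true → a ≡ true × b ≡ true
∧-true true true _ = refl , refl

not-⌊⌋ : ∀ {a} {A : Set a} (d : Dec A) → not ⌊ d ⌋ ≡ true → ¬ A
not-⌊⌋ (no ¬a) _ = ¬a

-- Residues modulo a prime

module Residues (q : ℕ) (q-prime : Prime q) where

  instance
    q≢0 : NonZero q
    q≢0 = prime⇒nonZero q-prime

  1<q : 1 < q
  1<q = nonTrivial⇒n>1 q {{prime⇒nonTrivial q-prime}}

  infixl 6 _⊕_ _⊝_
  infixl 7 _⊗_
  infix 8 ⊖_

  rep : Fin q → ℤ
  rep x = + toℕ x

  abstract
    -- Operations are computed on representatives in ℤ and then reduced. The block is abstract so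
    -- that later terms see a homomorphism from ℤ instead of division with remainder; the lemmas
    -- proved inside it are the whole interface.
    [_] : ℤ → Fin q
    [ a ] = fromℕ< (ℤ.n%ℕd<d a q)

    _⊕_ _⊗_ : Fin q → Fin q → Fin q
    x ⊕ y = [ rep x ℤ.+ rep y ]
    x ⊗ y = [ rep x ℤ.* rep y ]

    ⊖_ : Fin q → Fin q
    ⊖ x = [ ℤ.- rep x ]

    rep-[] : ∀ a → + q ∣ℤ (rep [ a ] ℤ.- a)
    rep-[] a = divides (ℤ.- (a ℤ./ℕ q)) (begin
      + toℕ [ a ] ℤ.- a                         ≡⟨ cong (λ n → + n ℤ.- a) (Finₚ.toℕ-fromℕ< (ℤ.n%ℕd<d a q)) ⟩
      + (a ℤ.%ℕ q) ℤ.- a                        ≡⟨ cong (λ z → + (a ℤ.%ℕ q) ℤ.- z) (ℤ.a≡a%ℕn+[a/ℕn]*n a q) ⟩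
      + (a ℤ.%ℕ q) ℤ.- (+ (a ℤ.%ℕ q) ℤ.+ (a ℤ./ℕ q) ℤ.* + q)
        ≡⟨ solve 3 (λ r d Q → r :- (r :+ d :* Q) := :- d :* Q) refl (+ (a ℤ.%ℕ q)) (a ℤ./ℕ q) (+ q) ⟩
      ℤ.- (a ℤ./ℕ q) ℤ.* + q                    ∎)
      where
      open ≡-Reasoning
      open ℤSolver

    []-rep : ∀ x → [ rep x ] ≡ x
    []-rep x = Finₚ.toℕ-injective (trans (Finₚ.toℕ-fromℕ< (ℤ.n%ℕd<d (rep x) q)) (ℕ.m<n⇒m%n≡m (Finₚ.toℕ<n x)))

    []-injective : ∀ {a b} → [ a ] ≡ [ b ] → + q ∣ℤ (a ℤ.- b)
    []-injective {a} {b} eq = subst (+ q ∣ℤ_) lemma (ℤ∣.∣m∣n⇒∣m-n (rep-[] b) (rep-[] a))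
      where
      open ℤSolver
      lemma : (rep [ b ] ℤ.- b) ℤ.- (rep [ a ] ℤ.- a) ≡ a ℤ.- b
      lemma rewrite eq = solve 3 (λ r a b → (r :- b) :- (r :- a) := a :- b) refl (rep [ b ]) a b

    -- Distinct residues in [0, q) differ by less than q in absolute value.
    rep-unique : ∀ {x y} → + q ∣ℤ (rep x ℤ.- rep y) → x ≡ y
    rep-unique {x} {y} q∣ = Finₚ.toℕ-injective (ℤ.+-injective (ℤ.i-j≡0⇒i≡j _ _ (ℤ.∣i∣≡0⇒i≡0 ∣x-y∣≡0)))
      where
      small : ∣ rep x ℤ.- rep y ∣ < q
      small rewrite ℤ.[+m]-[+n]≡m⊖n (toℕ x) (toℕ y) =
        ≤-<-trans (ℤ.∣m⊝n∣≤m⊔n (toℕ x) (toℕ y)) (⊔-lub (Finₚ.toℕ<n x) (Finₚ.toℕ<n y))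
      ∣x-y∣≡0 : ∣ rep x ℤ.- rep y ∣ ≡ 0
      ∣x-y∣≡0 with ∣ rep x ℤ.- rep y ∣ | small | ∣⇒∣ᵤ q∣
      ... | zero  | _  | _ = refl
      ... | suc k | lt | d = contradiction (ℕ.∣⇒≤ d) (<⇒≱ lt)

    []-cong : ∀ {a b} → + q ∣ℤ (a ℤ.- b) → [ a ] ≡ [ b ]
    []-cong {a} {b} q∣ = rep-unique (subst (+ q ∣ℤ_) lemma
        (ℤ∣.∣m∣n⇒∣m+n (ℤ∣.∣m∣n⇒∣m-n (rep-[] a) (rep-[] b)) q∣))
      where
      open ℤSolver
      lemma : ((rep [ a ] ℤ.- a) ℤ.- (rep [ b ] ℤ.- b)) ℤ.+ (a ℤ.- b) ≡ rep [ a ] ℤ.- rep [ b ]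
      lemma = solve 4 (λ r s a b → ((r :- a) :- (s :- b)) :+ (a :- b) := r :- s) refl (rep [ a ]) (rep [ b ]) a b

    []-+ : ∀ a b → [ a ℤ.+ b ] ≡ [ a ] ⊕ [ b ]
    []-+ a b = sym ([]-cong {rep [ a ] ℤ.+ rep [ b ]} {a ℤ.+ b} (subst (+ q ∣ℤ_) lemma (ℤ∣.∣m∣n⇒∣m+n (rep-[] a) (rep-[] b))))
      where
      open ℤSolver
      lemma : (rep [ a ] ℤ.- a) ℤ.+ (rep [ b ] ℤ.- b) ≡ (rep [ a ] ℤ.+ rep [ b ]) ℤ.- (a ℤ.+ b)
      lemma = solve 4 (λ r s a b → (r :- a) :+ (s :- b) := (r :+ s) :- (a :+ b)) refl (rep [ a ]) (rep [ b ]) a b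

    []-* : ∀ a b → [ a ℤ.* b ] ≡ [ a ] ⊗ [ b ]
    []-* a b = sym ([]-cong {rep [ a ] ℤ.* rep [ b ]} {a ℤ.* b} (subst (+ q ∣ℤ_) lemma
        (ℤ∣.∣m∣n⇒∣m+n (ℤ∣.∣m⇒∣m*n (rep [ b ]) (rep-[] a)) (ℤ∣.∣n⇒∣m*n a (rep-[] b)))))
      where
      open ℤSolver
      lemma : (rep [ a ] ℤ.- a) ℤ.* rep [ b ] ℤ.+ a ℤ.* (rep [ b ] ℤ.- b) ≡ (rep [ a ] ℤ.* rep [ b ]) ℤ.- (a ℤ.* b)
      lemma = solve 4 (λ r s a b → (r :- a) :* s :+ a :* (s :- b) := (r :* s) :- (a :* b)) refl (rep [ a ]) (rep [ b ]) a b

    []-neg : ∀ a → [ ℤ.- a ] ≡ ⊖ [ a ]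
    []-neg a = sym ([]-cong {ℤ.- rep [ a ]} {ℤ.- a} (subst (+ q ∣ℤ_) lemma (ℤ∣.∣m⇒∣-m (rep-[] a))))
      where
      open ℤSolver
      lemma : ℤ.- (rep [ a ] ℤ.- a) ≡ ℤ.- rep [ a ] ℤ.- (ℤ.- a)
      lemma = solve 2 (λ r a → :- (r :- a) := (:- r) :- (:- a)) refl (rep [ a ]) a

  _⊝_ : Fin q → Fin q → Fin q
  x ⊝ y = x ⊕ ⊖ y

  𝟘 𝟏 : Fin q
  𝟘 = [ 0ℤ ]
  𝟏 = [ 1ℤ ]

  private
    -- The operations are opaque from here on. Each ring law is transported from ℤ, because every
    -- residue has the form `[ rep x ]` and `[_]` respects the operations.
    ⊕-[] : ∀ x a → x ⊕ [ a ] ≡ [ rep x ℤ.+ a ]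
    ⊕-[] x a = trans (cong (_⊕ [ a ]) (sym ([]-rep x))) (sym ([]-+ (rep x) a))

    ⊗-[] : ∀ x a → x ⊗ [ a ] ≡ [ rep x ℤ.* a ]
    ⊗-[] x a = trans (cong (_⊗ [ a ]) (sym ([]-rep x))) (sym ([]-* (rep x) a))

    ⊕-rep : ∀ x y → x ⊕ y ≡ [ rep x ℤ.+ rep y ]
    ⊕-rep x y = trans (cong (x ⊕_) (sym ([]-rep y))) (⊕-[] x (rep y))

    ⊗-rep : ∀ x y → x ⊗ y ≡ [ rep x ℤ.* rep y ]
    ⊗-rep x y = trans (cong (x ⊗_) (sym ([]-rep y))) (⊗-[] x (rep y))

    ⊕-comm : ∀ x y → x ⊕ y ≡ y ⊕ x
    ⊕-comm x y = trans (⊕-rep x y) (trans (cong [_] (ℤ.+-comm (rep x) (rep y))) (sym (⊕-rep y x)))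

    ⊗-comm : ∀ x y → x ⊗ y ≡ y ⊗ x
    ⊗-comm x y = trans (⊗-rep x y) (trans (cong [_] (ℤ.*-comm (rep x) (rep y))) (sym (⊗-rep y x)))

    ⊕-assoc : ∀ x y z → (x ⊕ y) ⊕ z ≡ x ⊕ (y ⊕ z)
    ⊕-assoc x y z = begin
      (x ⊕ y) ⊕ z                        ≡⟨ ⊕-comm (x ⊕ y) z ⟩
      z ⊕ (x ⊕ y)                        ≡⟨ trans (cong (z ⊕_) (⊕-rep x y)) (⊕-[] z _) ⟩
      [ rep z ℤ.+ (rep x ℤ.+ rep y) ]    ≡⟨ cong [_] (solve 3 (λ x y z → z :+ (x :+ y) := x :+ (y :+ z)) refl (rep x) (rep y) (rep z)) ⟩
      [ rep x ℤ.+ (rep y ℤ.+ rep z) ]    ≡⟨ sym (trans (cong (x ⊕_) (⊕-rep y z)) (⊕-[] x _)) ⟩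
      x ⊕ (y ⊕ z)                        ∎
      where
      open ≡-Reasoning
      open ℤSolver

    ⊗-assoc : ∀ x y z → (x ⊗ y) ⊗ z ≡ x ⊗ (y ⊗ z)
    ⊗-assoc x y z = begin
      (x ⊗ y) ⊗ z                        ≡⟨ ⊗-comm (x ⊗ y) z ⟩
      z ⊗ (x ⊗ y)                        ≡⟨ trans (cong (z ⊗_) (⊗-rep x y)) (⊗-[] z _) ⟩
      [ rep z ℤ.* (rep x ℤ.* rep y) ]    ≡⟨ cong [_] (solve 3 (λ x y z → z :* (x :* y) := x :* (y :* z)) refl (rep x) (rep y) (rep z)) ⟩
      [ rep x ℤ.* (rep y ℤ.* rep z) ]    ≡⟨ sym (trans (cong (x ⊗_) (⊗-rep y z)) (⊗-[] x _)) ⟩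
      x ⊗ (y ⊗ z)                        ∎
      where
      open ≡-Reasoning
      open ℤSolver

    ⊗-distribˡ : ∀ x y z → x ⊗ (y ⊕ z) ≡ (x ⊗ y) ⊕ (x ⊗ z)
    ⊗-distribˡ x y z = begin
      x ⊗ (y ⊕ z)                                    ≡⟨ trans (cong (x ⊗_) (⊕-rep y z)) (⊗-[] x _) ⟩
      [ rep x ℤ.* (rep y ℤ.+ rep z) ]                ≡⟨ cong [_] (ℤ.*-distribˡ-+ (rep x) (rep y) (rep z)) ⟩
      [ rep x ℤ.* rep y ℤ.+ rep x ℤ.* rep z ]        ≡⟨ []-+ _ _ ⟩
      [ rep x ℤ.* rep y ] ⊕ [ rep x ℤ.* rep z ]      ≡⟨ sym (cong₂ _⊕_ (⊗-rep x y) (⊗-rep x z)) ⟩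
      (x ⊗ y) ⊕ (x ⊗ z)                              ∎
      where open ≡-Reasoning

    ⊕-identityʳ : ∀ x → x ⊕ 𝟘 ≡ x
    ⊕-identityʳ x = trans (⊕-[] x 0ℤ) (trans (cong [_] (ℤ.+-identityʳ (rep x))) ([]-rep x))

    ⊗-identityʳ : ∀ x → x ⊗ 𝟏 ≡ x
    ⊗-identityʳ x = trans (⊗-[] x 1ℤ) (trans (cong [_] (ℤ.*-identityʳ (rep x))) ([]-rep x))

    ⊖-inverseʳ : ∀ x → x ⊕ ⊖ x ≡ 𝟘
    ⊖-inverseʳ x = begin
      x ⊕ ⊖ x                    ≡⟨ cong (λ y → x ⊕ ⊖ y) (sym ([]-rep x)) ⟩
      x ⊕ ⊖ [ rep x ]            ≡⟨ cong (x ⊕_) (sym ([]-neg (rep x))) ⟩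
      x ⊕ [ ℤ.- rep x ]          ≡⟨ ⊕-[] x _ ⟩
      [ rep x ℤ.+ ℤ.- rep x ]    ≡⟨ cong [_] (ℤ.+-inverseʳ (rep x)) ⟩
      𝟘                          ∎
      where open ≡-Reasoning

  ring : CommutativeRing 0ℓ 0ℓ
  ring = record
    { Carrier = Fin q ; _≈_ = _≡_ ; _+_ = _⊕_ ; _*_ = _⊗_ ; -_ = ⊖_ ; 0# = 𝟘 ; 1# = 𝟏
    ; isCommutativeRing = record
      { isRing = record
        { +-isAbelianGroup = record
          { isGroup = record
            { isMonoid = record
              { isSemigroup = record
                { isMagma = record { isEquivalence = isEquivalence ; ∙-cong = cong₂ _⊕_ }
                ; assoc = ⊕-assoc }
              ; identity = (λ x → trans (⊕-comm 𝟘 x) (⊕-identityʳ x)) , ⊕-identityʳ }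
            ; inverse = (λ x → trans (⊕-comm (⊖ x) x) (⊖-inverseʳ x)) , ⊖-inverseʳ
            ; ⁻¹-cong = cong ⊖_ }
          ; comm = ⊕-comm }
        ; *-cong = cong₂ _⊗_
        ; *-assoc = ⊗-assoc
        ; *-identity = (λ x → trans (⊗-comm 𝟏 x) (⊗-identityʳ x)) , ⊗-identityʳ
        ; distrib = ⊗-distribˡ , λ x y z → trans (⊗-comm (y ⊕ z) x) (trans (⊗-distribˡ x y z) (cong₂ _⊕_ (⊗-comm x y) (⊗-comm x z))) }
      ; *-comm = ⊗-comm } }

  private
    almostRing : AlmostCommutativeRing 0ℓ 0ℓ
    almostRing = fromCommutativeRing ring

    ℤ→F : CommutativeRing.rawRing ℤ.+-*-commutativeRing -Raw-AlmostCommutative⟶ almostRing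
    ℤ→F = record { ⟦_⟧ = [_] ; +-homo = []-+ ; *-homo = []-* ; -‿homo = []-neg ; 0-homo = refl ; 1-homo = refl }

    _≟c_ : ∀ a b → Maybe ([ a ] ≡ [ b ])
    a ≟c b with a ℤ.≟ b
    ... | yes a≡b = just (cong [_] a≡b)
    ... | no _    = nothing

  module FSolver = Algebra.Solver.Ring (CommutativeRing.rawRing ℤ.+-*-commutativeRing) almostRing ℤ→F _≟c_
  open FSolver using (solve; _:=_; _:+_; _:*_; _:-_; :-_; con)

  open Algebra.Properties.CommutativeSemiring.Exp (CommutativeRing.commutativeSemiring ring) public
    using (^-homo-*; ^-assocʳ; ^-distrib-*) renaming (_^_ to _↑_)

  open CommutativeRing ring public using () renaming
    ( +-comm to ⊕-commutative; *-comm to ⊗-commutative; *-identityˡ to 𝟏⊗; *-identityʳ to ⊗𝟏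
    ; zeroˡ to 𝟘⊗; zeroʳ to ⊗𝟘 ; +-identityʳ to ⊕𝟘; +-identityˡ to 𝟘⊕ )

  infix 4 _≟F_
  _≟F_ : (x y : Fin q) → Dec (x ≡ y)
  _≟F_ = Fin._≟_

  []≡𝟘⇒∣ : ∀ {n} → [ + n ] ≡ 𝟘 → q ℕ.∣ n
  []≡𝟘⇒∣ {n} eq = subst (q ℕ.∣_) (cong ∣_∣ (ℤ.+-identityʳ (+ n))) (∣⇒∣ᵤ ([]-injective {+ n} {0ℤ} eq))

  ∣⇒[]≡𝟘 : ∀ {n} → q ℕ.∣ n → [ + n ] ≡ 𝟘
  ∣⇒[]≡𝟘 {n} q∣n = []-cong {+ n} {0ℤ} (subst (+ q ∣ℤ_) (sym (ℤ.+-identityʳ (+ n))) (∣ᵤ⇒∣ q∣n))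

  𝟏≢𝟘 : 𝟏 ≢ 𝟘
  𝟏≢𝟘 eq = <⇒≱ 1<q (ℕ.∣⇒≤ ([]≡𝟘⇒∣ {1} eq))

  no-zero-divisors : ∀ {x y} → x ⊗ y ≡ 𝟘 → x ≡ 𝟘 ⊎ y ≡ 𝟘
  no-zero-divisors {x} {y} xy≡0 with euclidsLemma (toℕ x) (toℕ y) q-prime
      ([]≡𝟘⇒∣ (trans (trans (cong [_] (ℤ.pos-* (toℕ x) (toℕ y))) (sym (⊗-rep x y))) xy≡0))
  ... | inj₁ q∣x = inj₁ (trans (sym ([]-rep x)) (∣⇒[]≡𝟘 q∣x))
  ... | inj₂ q∣y = inj₂ (trans (sym ([]-rep y)) (∣⇒[]≡𝟘 q∣y))

  ⊗-≢𝟘 : ∀ {x y} → x ≢ 𝟘 → y ≢ 𝟘 → x ⊗ y ≢ 𝟘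
  ⊗-≢𝟘 x≢0 y≢0 xy≡0 = [ x≢0 , y≢0 ]′ (no-zero-divisors xy≡0)

  ⊝≡𝟘⇒≡ : ∀ {x y} → x ⊝ y ≡ 𝟘 → x ≡ y
  ⊝≡𝟘⇒≡ {x} {y} eq = begin
    x               ≡⟨ solve 2 (λ x y → x := (x :- y) :+ y) refl x y ⟩
    (x ⊝ y) ⊕ y     ≡⟨ cong (_⊕ y) eq ⟩
    𝟘 ⊕ y           ≡⟨ 𝟘⊕ y ⟩
    y               ∎
    where open ≡-Reasoning

  ⊝-≢𝟘 : ∀ {x y} → x ≢ y → x ⊝ y ≢ 𝟘
  ⊝-≢𝟘 ne = ne ∘ ⊝≡𝟘⇒≡

  ⊗-distribˡ-⊝ : ∀ z x y → z ⊗ (x ⊝ y) ≡ z ⊗ x ⊝ z ⊗ y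
  ⊗-distribˡ-⊝ z x y = solve 3 (λ z x y → z :* (x :- y) := z :* x :- z :* y) refl z x y

  ⊗-cancelˡ : ∀ {z x y} → z ≢ 𝟘 → z ⊗ x ≡ z ⊗ y → x ≡ y
  ⊗-cancelˡ {z} {x} {y} z≢0 eq = [ (λ z≡0 → contradiction z≡0 z≢0) , ⊝≡𝟘⇒≡ ]′ (no-zero-divisors
    (trans (⊗-distribˡ-⊝ z x y) (trans (cong (_⊝ z ⊗ y) eq) (⊖-inverseʳ (z ⊗ y)))))

  -- Bézout for q and x: if 1 + v x = u q the inverse is -v, and if 1 + u q = v x it is v.
  inverse : ∀ x → x ≢ 𝟘 → ∃ λ y → x ⊗ y ≡ 𝟏
  inverse x x≢0 with coprime-Bézout (prime⇒coprime q-prime {{nz}} (Finₚ.toℕ<n x))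
    where
    nz : NonZero (toℕ x)
    nz = ≢-nonZero λ x≡0 → x≢0 (trans (sym ([]-rep x)) (cong (λ n → [ + n ]) x≡0))
  ... | GCD.Bézout.+- u v eq = ⊖ [ + v ] , (begin
      x ⊗ ⊖ [ + v ]            ≡⟨ cong (_⊗ ⊖ [ + v ]) (sym ([]-rep x)) ⟩
      [ rep x ] ⊗ ⊖ [ + v ]    ≡⟨ trans (cong ([ rep x ] ⊗_) (sym ([]-neg (+ v)))) (sym ([]-* _ _)) ⟩
      [ rep x ℤ.* ℤ.- + v ]    ≡⟨ []-cong (divides (ℤ.- + u) (begin
          rep x ℤ.* ℤ.- + v ℤ.- 1ℤ          ≡⟨ ℤSolver.solve 2 (λ x v → x ℤSolver.:* (ℤSolver.:- v) ℤSolver.:- ℤSolver.con 1ℤ ℤSolver.:= ℤSolver.:- (ℤSolver.con 1ℤ ℤSolver.:+ v ℤSolver.:* x)) refl (rep x) (+ v) ⟩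
          ℤ.- (1ℤ ℤ.+ + v ℤ.* rep x)        ≡⟨ cong (λ z → ℤ.- (1ℤ ℤ.+ z)) (sym (ℤ.pos-* v (toℕ x))) ⟩
          ℤ.- (1ℤ ℤ.+ + (v * toℕ x))        ≡⟨ cong (λ n → ℤ.- (+ n)) eq ⟩
          ℤ.- + (u * q)                     ≡⟨ cong ℤ.-_ (ℤ.pos-* u q) ⟩
          ℤ.- (+ u ℤ.* + q)                 ≡⟨ ℤ.neg-distribˡ-* (+ u) (+ q) ⟩
          ℤ.- + u ℤ.* + q                   ∎)) ⟩
      𝟏                        ∎)
    where open ≡-Reasoning
  ... | GCD.Bézout.-+ u v eq = [ + v ] , (begin
      x ⊗ [ + v ]              ≡⟨ ⊗-[] x (+ v) ⟩
      [ rep x ℤ.* + v ]        ≡⟨ []-cong (divides (+ u) (begin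
          rep x ℤ.* + v ℤ.- 1ℤ              ≡⟨ cong (ℤ._- 1ℤ) (trans (sym (ℤ.pos-* (toℕ x) v)) (cong +_ (trans (*-comm (toℕ x) v) (sym eq)))) ⟩
          1ℤ ℤ.+ + (u * q) ℤ.- 1ℤ           ≡⟨ ℤSolver.solve 1 (λ z → ℤSolver.con 1ℤ ℤSolver.:+ z ℤSolver.:- ℤSolver.con 1ℤ ℤSolver.:= z) refl (+ (u * q)) ⟩
          + (u * q)                         ≡⟨ ℤ.pos-* u q ⟩
          + u ℤ.* + q                       ∎)) ⟩
      𝟏                        ∎)
    where open ≡-Reasoning

  𝟏↑ : ∀ n → 𝟏 ↑ n ≡ 𝟏
  𝟏↑ zero    = refl
  𝟏↑ (suc n) = trans (𝟏⊗ (𝟏 ↑ n)) (𝟏↑ n)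

  []-^ : ∀ a n → [ + (a ^ n) ] ≡ [ + a ] ↑ n
  []-^ a zero    = refl
  []-^ a (suc n) = trans (cong [_] (ℤ.pos-* a (a ^ n))) (trans ([]-* (+ a) (+ (a ^ n))) (cong ([ + a ] ⊗_) ([]-^ a n)))

-- Fermat's theorem, roots of polynomials and cyclotomic classes

module FieldTheory (q : ℕ) (q-prime : Prime q) where

  open Residues q q-prime
  open FSolver using (solve; _:=_; _:+_; _:*_; _:-_; :-_; con)

  private
    module Π = Algebra.Properties.CommutativeMonoid.Sum (CommutativeRing.*-commutativeMonoid ring)

  nonzero : Fin q → Bool
  nonzero x = not ⌊ 𝟘 ≟F x ⌋

  count-nonzero : suc (count nonzero) ≡ q
  count-nonzero = trans (cong (_+ count nonzero) (sym (∑-δ1 𝟘))) (count-complement (λ x → ⌊ 𝟘 ≟F x ⌋))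

  Π-indicator : ∀ {n} (P : Fin n → Bool) a → Π.sum (λ x → if P x then a else 𝟏) ≡ a ↑ count P
  Π-indicator {zero}  P a = refl
  Π-indicator {suc n} P a with P zero
  ... | true  = cong (a ⊗_) (Π-indicator (P ∘ suc) a)
  ... | false = trans (𝟏⊗ _) (Π-indicator (P ∘ suc) a)

  Π-≢𝟘 : ∀ {n} (f : Fin n → Fin q) → (∀ i → f i ≢ 𝟘) → Π.sum f ≢ 𝟘
  Π-≢𝟘 {zero}  f f≢0 = 𝟏≢𝟘
  Π-≢𝟘 {suc n} f f≢0 = ⊗-≢𝟘 (f≢0 zero) (Π-≢𝟘 (f ∘ suc) (f≢0 ∘ suc))

  scale : ∀ {a} → a ≢ 𝟘 → Perm.Permutation q q
  scale {a} a≢0 with b , ab≡1 ← inverse a a≢0 =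
    Perm.permutation (a ⊗_) (b ⊗_) (undo ab≡1) (undo (trans (⊗-commutative b a) ab≡1))
    where
    undo : ∀ {a b} → a ⊗ b ≡ 𝟏 → ∀ x → a ⊗ (b ⊗ x) ≡ x
    undo {a} {b} eq x = trans (sym (CommutativeRing.*-assoc ring a b x)) (trans (cong (_⊗ x) eq) (𝟏⊗ x))

  -- Multiplication by a permutes the nonzero residues, so their product is unchanged by a factor a ↑ (q - 1).
  fermat : ∀ {a} → a ≢ 𝟘 → a ↑ count nonzero ≡ 𝟏
  fermat {a} a≢0 = ⊗-cancelˡ (Π-≢𝟘 f f≢𝟘) (begin
    Π.sum f ⊗ a ↑ count nonzero            ≡⟨ ⊗-commutative _ _ ⟩
    a ↑ count nonzero ⊗ Π.sum f            ≡⟨ cong (_⊗ Π.sum f) (sym (Π-indicator nonzero a)) ⟩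
    Π.sum g ⊗ Π.sum f                      ≡⟨ sym (Π.∑-distrib-+ g f) ⟩
    Π.sum (λ x → g x ⊗ f x)                ≡⟨ Π.sum-cong-≗ (sym ∘ f-scale) ⟩
    Π.sum (λ x → f (a ⊗ x))                ≡⟨ sym (Π.∑-permute f (scale a≢0)) ⟩
    Π.sum f                                ≡⟨ sym (⊗𝟏 _) ⟩
    Π.sum f ⊗ 𝟏                            ∎)
    where
    open ≡-Reasoning
    f g : Fin q → Fin q
    f x = if nonzero x then x else 𝟏
    g x = if nonzero x then a else 𝟏
    f≢𝟘 : ∀ x → f x ≢ 𝟘
    f≢𝟘 x with 𝟘 ≟F x
    ... | yes _   = 𝟏≢𝟘
    ... | no 0≢x  = 0≢x ∘ sym
    f-scale : ∀ x → f (a ⊗ x) ≡ g x ⊗ f x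
    f-scale x with 𝟘 ≟F x | 𝟘 ≟F a ⊗ x
    ... | yes _    | yes _   = sym (⊗𝟏 𝟏)
    ... | yes refl | no ne   = contradiction (sym (⊗𝟘 a)) ne
    ... | no ne    | yes eq  = contradiction (sym eq) (⊗-≢𝟘 a≢0 (ne ∘ sym))
    ... | no _     | no _    = refl

  -- Deg n a f: the function f is a polynomial of degree at most n whose coefficient of xⁿ is a.
  data Deg : ℕ → Fin q → (Fin q → Fin q) → Set where
    const : ∀ {a f} → (∀ x → f x ≡ a) → Deg 0 a f
    step  : ∀ {n a f} g c → Deg n a g → (∀ x → f x ≡ x ⊗ g x ⊕ c) → Deg (suc n) a f

  -- The degree bounds differ by one, so the leading coefficient of f survives. This is exactly the
  -- sum that arises in synthetic division.
  Deg-+ : ∀ {n a b f g} s → Deg (suc n) a f → Deg n b g → Deg (suc n) a (λ x → f x ⊕ s ⊗ g x)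
  Deg-+ {b = b} s (step f′ c d p) (const r) = step f′ (c ⊕ s ⊗ b) d λ x →
    trans (cong₂ (λ u v → u ⊕ s ⊗ v) (p x) (r x))
      (solve 5 (λ x f c s b → x :* f :+ c :+ s :* b := x :* f :+ (c :+ s :* b)) refl x (f′ x) c s b)
  Deg-+ s (step f′ c d p) (step g′ c′ d′ p′) = step (λ x → f′ x ⊕ s ⊗ g′ x) (c ⊕ s ⊗ c′) (Deg-+ s d d′) λ x →
    trans (cong₂ (λ u v → u ⊕ s ⊗ v) (p x) (p′ x))
      (solve 6 (λ x f c s g c′ → x :* f :+ c :+ s :* (x :* g :+ c′) := x :* (f :+ s :* g) :+ (c :+ s :* c′)) refl
        x (f′ x) c s (g′ x) c′)

  -- Synthetic division: if f x = x h(x) + c, then f x - f r = (x - r) h(x) + r (h(x) - h(r)), and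
  -- the last difference factors by induction. The quotient h + r g inherits its leading coefficient
  -- from h.
  Deg-factor : ∀ {n a f} → Deg (suc n) a f → ∀ r →
    ∃ λ g → Deg n a g × (∀ x → f x ⊝ f r ≡ (x ⊝ r) ⊗ g x)
  Deg-factor {zero} {a} {f} (step h c (const k) p) r = h , const k , λ x →
    trans (cong₂ _⊝_ (p x) (p r)) (trans
      (cong₂ (λ u v → (x ⊗ u ⊕ c) ⊝ (r ⊗ v ⊕ c)) (k x) (k r)) (trans
      (solve 4 (λ x r c a → (x :* a :+ c) :- (r :* a :+ c) := (x :- r) :* a) refl x r c a)
      (cong ((x ⊝ r) ⊗_) (sym (k x)))))
  Deg-factor {suc n} {a} {f} (step h c d p) r with g , dg , pg ← Deg-factor d r =
    (λ x → h x ⊕ r ⊗ g x) , Deg-+ r d dg , λ x → begin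
      f x ⊝ f r                                        ≡⟨ cong₂ _⊝_ (p x) (p r) ⟩
      (x ⊗ h x ⊕ c) ⊝ (r ⊗ h r ⊕ c)                    ≡⟨ split x r c (h x) (h r) ⟩
      (x ⊝ r) ⊗ h x ⊕ r ⊗ (h x ⊝ h r)                  ≡⟨ cong (λ z → (x ⊝ r) ⊗ h x ⊕ r ⊗ z) (pg x) ⟩
      (x ⊝ r) ⊗ h x ⊕ r ⊗ ((x ⊝ r) ⊗ g x)              ≡⟨ collect (x ⊝ r) r (h x) (g x) ⟩
      (x ⊝ r) ⊗ (h x ⊕ r ⊗ g x)                        ∎
    where
    open ≡-Reasoning
    split : ∀ x r c u v → (x ⊗ u ⊕ c) ⊝ (r ⊗ v ⊕ c) ≡ (x ⊝ r) ⊗ u ⊕ r ⊗ (u ⊝ v)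
    split x r c u v = solve 5 (λ x r c u v →
      (x :* u :+ c) :- (r :* v :+ c) := (x :- r) :* u :+ r :* (u :- v)) refl x r c u v
    collect : ∀ d r u v → d ⊗ u ⊕ r ⊗ (d ⊗ v) ≡ d ⊗ (u ⊕ r ⊗ v)
    collect d r u v = solve 4 (λ d r u v → d :* u :+ r :* (d :* v) := d :* (u :+ r :* v)) refl d r u v

  root : (Fin q → Fin q) → Fin q → Bool
  root f x = ⌊ f x ≟F 𝟘 ⌋

  count-no-roots : ∀ {f} → (∀ x → f x ≢ 𝟘) → count (root f) ≡ 0
  count-no-roots {f} none = ∑-zero no-root
    where
    no-root : ∀ x → 𝟙 (root f x) ≡ 0
    no-root x with f x ≟F 𝟘
    ... | yes fx≡0 = contradiction fx≡0 (none x)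
    ... | no _ = refl

  count-roots-⊗ : ∀ {f g r} → (∀ x → f x ≡ 𝟘 → x ≡ r ⊎ g x ≡ 𝟘) → count (root f) ≤ suc (count (root g))
  count-roots-⊗ {f} {g} {r} split = begin
    count (root f)                                   ≤⟨ ∑-mono pointwise ⟩
    sum (λ x → δ r x + 𝟙 (root g x))                 ≡⟨ ∑-distrib-+ (δ r) (𝟙 ∘ root g) ⟩
    sum (δ r) + count (root g)                       ≡⟨ cong (_+ count (root g)) (∑-δ1 r) ⟩
    suc (count (root g))                             ∎
    where
    open ≤-Reasoning
    at-r : ∀ {x} → x ≡ r → 1 ≤ δ r x + 𝟙 (root g x)
    at-r refl = ≤-trans (≤-reflexive (sym (δ-refl r))) (m≤m+n _ _)
    at-g : ∀ {x} → g x ≡ 𝟘 → 1 ≤ δ r x + 𝟙 (root g x)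
    at-g {x} gx≡0 = ≤-trans (≤-reflexive (cong 𝟙 (sym (true-⌊⌋ (g x ≟F 𝟘) gx≡0)))) (m≤n+m _ (δ r x))
    pointwise : ∀ x → 𝟙 (root f x) ≤ δ r x + 𝟙 (root g x)
    pointwise x with f x ≟F 𝟘
    ... | no _ = z≤n
    ... | yes fx≡0 = [ at-r , at-g ]′ (split x fx≡0)

  -- Splitting off one root r leaves a quotient with the same leading coefficient, and every root
  -- other than r is a root of that quotient.
  count-roots : ∀ {n a f} → a ≢ 𝟘 → Deg n a f → count (root f) ≤ n
  count-roots {zero} a≢0 (const k) = ≤-reflexive (count-no-roots λ x fx≡0 → a≢0 (trans (sym (k x)) fx≡0))
  count-roots {suc n} {a} {f} a≢0 d with Finₚ.any? (λ x → f x ≟F 𝟘)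
  ... | no none = ≤-trans (≤-reflexive (count-no-roots λ x fx≡0 → none (x , fx≡0))) z≤n
  ... | yes (r , fr≡0) =
    let g , dg , pg = Deg-factor d r in
    ≤-trans (count-roots-⊗ {g = g} λ x fx≡0 → map₁ ⊝≡𝟘⇒≡ (no-zero-divisors
      (trans (sym (pg x)) (trans (cong₂ _⊝_ fx≡0 fr≡0) (CommutativeRing.-‿inverseʳ ring 𝟘)))))
      (s≤s (count-roots a≢0 dg))

  Deg-power : ∀ n → Deg n 𝟏 (_↑ n)
  Deg-power zero    = const λ _ → refl
  Deg-power (suc n) = step (_↑ n) 𝟘 (Deg-power n) λ x → sym (⊕𝟘 _)

  count-power : ∀ n y → .{{NonZero n}} → count (λ x → ⌊ x ↑ n ≟F y ⌋) ≤ n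
  count-power (suc n) y = ≤-trans (count-mono {P = λ x → ⌊ x ↑ suc n ≟F y ⌋} {root f} P⇒root) (count-roots 𝟏≢𝟘 deg)
    where
    f : Fin q → Fin q
    f x = x ↑ suc n ⊝ y
    deg : Deg (suc n) 𝟏 f
    deg = step (_↑ n) (⊖ y) (Deg-power n) λ x → refl
    P⇒root : ∀ x → ⌊ x ↑ suc n ≟F y ⌋ ≡ true → root f x ≡ true
    P⇒root x h = true-⌊⌋ (f x ≟F 𝟘) (trans (cong (_⊝ y) (⌊⌋-true (x ↑ suc n ≟F y) h)) (CommutativeRing.-‿inverseʳ ring y))

  _⁻¹ : Fin q → Fin q
  x ⁻¹ with x ≟F 𝟘
  ... | yes _  = 𝟘
  ... | no x≢0 = proj₁ (inverse x x≢0)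

  ⁻¹-inverseʳ : ∀ {x} → x ≢ 𝟘 → x ⊗ x ⁻¹ ≡ 𝟏
  ⁻¹-inverseʳ {x} x≢0 with x ≟F 𝟘
  ... | yes x≡0 = contradiction x≡0 x≢0
  ... | no x≢0′ = proj₂ (inverse x x≢0′)

  -- This is where the 2 in q ≡ 1 (mod 2 e) enters: the exponent that defines the colours is even,
  -- so the colour of a difference does not depend on the orientation of the edge.
  ⊖-↑-even : ∀ x h → (⊖ x) ↑ (2 * h) ≡ x ↑ (2 * h)
  ⊖-↑-even x h = trans (sym (^-assocʳ (⊖ x) 2 h)) (trans (cong (_↑ h)
    (solve 1 (λ x → (:- x) :* ((:- x) :* con 1ℤ) := x :* (x :* con 1ℤ)) refl x)) (^-assocʳ x 2 h))

  module Cyclotomy (e h : ℕ) .{{_ : NonZero e}} .{{_ : NonZero h}} (eh : e * h ≡ count nonzero) where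

    private
      μ : Fin q → Bool
      μ y = ⌊ y ↑ e ≟F 𝟏 ⌋

      μ≤e : count μ ≤ e
      μ≤e = count-power e 𝟏

      module M = Enumeration (enumerate μ)

      power∈μ : ∀ {x} → x ≢ 𝟘 → μ (x ↑ h) ≡ true
      power∈μ {x} x≢0 = true-⌊⌋ (_ ≟F _) (trans (^-assocʳ x h e)
        (trans (cong (x ↑_) (trans (*-comm h e) eh)) (fermat x≢0)))

      someColour : Fin e
      someColour = fromℕ< {0} (>-nonZero⁻¹ e)

    -- The coset of x modulo the h-th roots of unity, encoded by x ↑ h. That power is an e-th root
    -- of unity, so its rank among those roots, of which there are at most e, names the coset. At 𝟘
    -- the value is a placeholder.
    colour : Fin q → Fin e
    colour x with x ≟F 𝟘
    ... | yes _  = someColour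
    ... | no x≢0 = Fin.inject≤ (proj₁ (M.rank (x ↑ h) (power∈μ x≢0))) μ≤e

    colour-↑ : ∀ {x y} → x ≢ 𝟘 → y ≢ 𝟘 → colour x ≡ colour y → x ↑ h ≡ y ↑ h
    colour-↑ {x} {y} x≢0 y≢0 eq with x ≟F 𝟘 | y ≟F 𝟘
    ... | yes x≡0 | _ = contradiction x≡0 x≢0
    ... | no _ | yes y≡0 = contradiction y≡0 y≢0
    ... | no _ | no _ = trans (sym (proj₂ (M.rank (x ↑ h) _)))
      (trans (cong M.nth (Finₚ.inject≤-injective μ≤e μ≤e _ _ eq)) (proj₂ (M.rank (y ↑ h) _)))

    ↑-colour : ∀ {x y} → x ≢ 𝟘 → y ≢ 𝟘 → x ↑ h ≡ y ↑ h → colour x ≡ colour y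
    ↑-colour {x} {y} x≢0 y≢0 eq with x ≟F 𝟘 | y ≟F 𝟘
    ... | yes x≡0 | _ = contradiction x≡0 x≢0
    ... | no _ | yes y≡0 = contradiction y≡0 y≢0
    ... | no _ | no _ = cong (λ i → Fin.inject≤ i μ≤e) (M.nth-inj
      (trans (proj₂ (M.rank (x ↑ h) _)) (trans eq (sym (proj₂ (M.rank (y ↑ h) _))))))

    sameColour : Fin q → Fin q → Fin q → Bool
    sameColour a b x = (not ⌊ x ≟F a ⌋ ∧ not ⌊ x ≟F b ⌋) ∧ ⌊ colour (a ⊝ x) Fin.≟ colour (b ⊝ x) ⌋

    -- For a ≢ b the map x ↦ (a - x) / (b - x) is injective.
    count-sameColour : ∀ {a b} → a ≢ b → count (sameColour a b) ≤ h
    count-sameColour {a} {b} a≢b = ≤-trans (count-injection f to inj) (count-power h 𝟏)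
      where
      f : Fin q → Fin q
      f x = (a ⊝ x) ⊗ (b ⊝ x) ⁻¹
      a-x : ∀ x → sameColour a b x ≡ true → a ⊝ x ≢ 𝟘
      a-x x p = ⊝-≢𝟘 (not-⌊⌋ (x ≟F a) (proj₁ (∧-true _ _ (proj₁ (∧-true _ _ p)))) ∘ sym)
      b-x : ∀ x → sameColour a b x ≡ true → b ⊝ x ≢ 𝟘
      b-x x p = ⊝-≢𝟘 (not-⌊⌋ (x ≟F b) (proj₂ (∧-true (not ⌊ x ≟F a ⌋) _ (proj₁ (∧-true _ _ p)))) ∘ sym)
      same-↑ : ∀ x → sameColour a b x ≡ true → (a ⊝ x) ↑ h ≡ (b ⊝ x) ↑ h
      same-↑ x p = colour-↑ (a-x x p) (b-x x p)
        (⌊⌋-true (_ Fin.≟ _) (proj₂ (∧-true (not ⌊ x ≟F a ⌋ ∧ not ⌊ x ≟F b ⌋) _ p)))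
      to : ∀ x → sameColour a b x ≡ true → ⌊ f x ↑ h ≟F 𝟏 ⌋ ≡ true
      to x p = true-⌊⌋ (f x ↑ h ≟F 𝟏) (begin
        ((a ⊝ x) ⊗ (b ⊝ x) ⁻¹) ↑ h           ≡⟨ ^-distrib-* (a ⊝ x) _ h ⟩
        (a ⊝ x) ↑ h ⊗ ((b ⊝ x) ⁻¹) ↑ h       ≡⟨ cong (_⊗ ((b ⊝ x) ⁻¹) ↑ h) (same-↑ x p) ⟩
        (b ⊝ x) ↑ h ⊗ ((b ⊝ x) ⁻¹) ↑ h       ≡⟨ sym (^-distrib-* (b ⊝ x) _ h) ⟩
        ((b ⊝ x) ⊗ (b ⊝ x) ⁻¹) ↑ h           ≡⟨ cong (_↑ h) (⁻¹-inverseʳ (b-x x p)) ⟩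
        𝟏 ↑ h                                ≡⟨ 𝟏↑ h ⟩
        𝟏                                    ∎)
        where open ≡-Reasoning
      clear : ∀ x → b ⊝ x ≢ 𝟘 → f x ⊗ (b ⊝ x) ≡ a ⊝ x
      clear x b-x≢0 = begin
        (a ⊝ x) ⊗ (b ⊝ x) ⁻¹ ⊗ (b ⊝ x)       ≡⟨ CommutativeRing.*-assoc ring _ _ _ ⟩
        (a ⊝ x) ⊗ ((b ⊝ x) ⁻¹ ⊗ (b ⊝ x))     ≡⟨ cong ((a ⊝ x) ⊗_) (trans (⊗-commutative _ _) (⁻¹-inverseʳ b-x≢0)) ⟩
        (a ⊝ x) ⊗ 𝟏                          ≡⟨ ⊗𝟏 _ ⟩
        a ⊝ x                                ∎
        where open ≡-Reasoning
      -- Injectivity of f with denominators cleared: if f x = f y, substituting a - x = f x (b - x)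
      -- and a - y = f x (b - y) makes the right side vanish, and a ≢ b then forces x = y.
      cross : ∀ x y → (a ⊝ b) ⊗ (x ⊝ y) ≡ (a ⊝ x) ⊗ (b ⊝ y) ⊝ (a ⊝ y) ⊗ (b ⊝ x)
      cross x y = solve 4 (λ a b x y →
        (a :- b) :* (x :- y) := (a :- x) :* (b :- y) :- (a :- y) :* (b :- x)) refl a b x y
      swap : ∀ f u v → f ⊗ u ⊗ v ⊝ f ⊗ v ⊗ u ≡ 𝟘
      swap f u v = solve 3 (λ f u v → f :* u :* v :- f :* v :* u := con 0ℤ) refl f u v
      inj : ∀ x y → sameColour a b x ≡ true → sameColour a b y ≡ true → f x ≡ f y → x ≡ y
      inj x y px py fx≡fy = ⊝≡𝟘⇒≡ ([ (λ ab → contradiction (⊝≡𝟘⇒≡ ab) a≢b) , (λ z → z) ]′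
        (no-zero-divisors (trans (cross x y) (trans
          (cong₂ (λ u v → u ⊗ (b ⊝ y) ⊝ v ⊗ (b ⊝ x)) (sym (clear x (b-x x px)))
            (trans (sym (clear y (b-x y py))) (cong (_⊗ (b ⊝ y)) (sym fx≡fy))))
          (swap (f x) (b ⊝ x) (b ⊝ y))))))

-- Primes congruent to 1 modulo m

prime-divisor : ∀ {n} → 1 < n → ∃ λ p → Prime p × p ℕ.∣ n
prime-divisor {n} 1<n with factorise n {{>-nonZero (<-trans (s≤s z≤n) 1<n)}}
... | record { factors = [] ; isFactorisation = eq } = contradiction eq λ { refl → <-irrefl refl 1<n }
... | record { factors = p ∷ ps ; isFactorisation = eq ; factorsPrime = pr ∷ _ } = p , pr , subst (p ℕ.∣_) (sym eq) (ℕ.m∣m*n (List.product ps))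

prime∤! : ∀ {p} → Prime p → ∀ j → j < p → ¬ p ℕ.∣ j !
prime∤! pr zero j<p p∣ = <⇒≱ (nonTrivial⇒n>1 _ {{prime⇒nonTrivial pr}}) (ℕ.∣⇒≤ p∣)
prime∤! pr (suc j) j<p p∣ with euclidsLemma (suc j) (j !) pr p∣
... | inj₁ p∣j = <⇒≱ j<p (ℕ.∣⇒≤ p∣j)
... | inj₂ p∣j! = prime∤! pr j (<-trans (n<1+n j) j<p) p∣j!

∣! : ∀ {p} j → 1 ≤ p → p ≤ j → p ℕ.∣ j !
∣! {suc p} j _ p≤j = ℕ.∣-trans (ℕ.m∣m*n (p !)) (ℕ.m≤n⇒m!∣n! p≤j)

∣+ʳ⇒∣ˡ : ∀ {d a b} → d ℕ.∣ a + b → d ℕ.∣ b → d ℕ.∣ a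
∣+ʳ⇒∣ˡ {d} {a} {b} d∣a+b = ℕ.∣m+n∣m⇒∣n (subst (d ℕ.∣_) (+-comm a b) d∣a+b)

-- The sum 1 + x + ⋯ + x ^ (l - 1). For x = N ^ t and m = t l it is the cofactor (N ^ m - 1) / (N ^
-- t - 1), obtained without division.
geometric : ℕ → ℕ → ℕ
geometric x zero    = 0
geometric x (suc l) = 1 + x * geometric x l

geometric-* : ∀ x l → geometric (suc x) l * x + 1 ≡ suc x ^ l
geometric-* x zero    = refl
geometric-* x (suc l) = trans
  (solve 2 (λ x g → (con 1 :+ (con 1 :+ x) :* g) :* x :+ con 1 := (con 1 :+ x) :* (g :* x :+ con 1)) refl x (geometric (suc x) l))
  (cong (suc x *_) (geometric-* x l))
  where open ℕSolver

-- Evaluation at N of f 0 + f 1 X + ⋯ + f (m - 1) X ^ (m - 1); for m-periodic f this is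
-- the evaluation of an element of the group ring ℤ[ℤ/m] in ℤ / (N ^ m - 1).
module Evaluation (K : ℕ) where

  N : ℕ
  N = suc K

  eval : (ℕ → ℤ) → ℕ → ℤ
  eval f zero    = 0ℤ
  eval f (suc m) = f 0 ℤ.+ + N ℤ.* eval (f ∘ suc) m

  eval-cong : ∀ {f g} → (∀ y → f y ≡ g y) → ∀ m → eval f m ≡ eval g m
  eval-cong f≗g zero    = refl
  eval-cong f≗g (suc m) = cong₂ (λ a b → a ℤ.+ + N ℤ.* b) (f≗g 0) (eval-cong (f≗g ∘ suc) m)

  eval-- : ∀ f g m → eval (λ y → f y ℤ.- g y) m ≡ eval f m ℤ.- eval g m
  eval-- f g zero    = refl
  eval-- f g (suc m) = trans (cong (λ z → (f 0 ℤ.- g 0) ℤ.+ + N ℤ.* z) (eval-- (f ∘ suc) (g ∘ suc) m))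
    (solve 5 (λ a b n u v → (a :- b) :+ n :* (u :- v) := (a :+ n :* u) :- (b :+ n :* v)) refl
      (f 0) (g 0) (+ N) (eval (f ∘ suc) m) (eval (g ∘ suc) m))
    where open ℤSolver

  eval-last : ∀ f m → eval f (suc m) ≡ eval f m ℤ.+ + (N ^ m) ℤ.* f m
  eval-last f zero    = solve 2 (λ a n → a :+ n :* con 0ℤ := con 0ℤ :+ con 1ℤ :* a) refl (f 0) (+ N)
    where open ℤSolver
  eval-last f (suc m) = trans (cong (λ z → f 0 ℤ.+ + N ℤ.* z) (eval-last (f ∘ suc) m)) (trans
    (solve 5 (λ a n u p b → a :+ n :* (u :+ p :* b) := (a :+ n :* u) :+ (n :* p) :* b) refl
      (f 0) (+ N) (eval (f ∘ suc) m) (+ (N ^ m)) (f (suc m)))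
    (cong (λ z → (f 0 ℤ.+ + N ℤ.* eval (f ∘ suc) m) ℤ.+ z ℤ.* f (suc m)) (sym (ℤ.pos-* N (N ^ m)))))
    where open ℤSolver

  -- Since K = N - 1, this is the geometric series bound c (N ^ m - 1) / (N - 1) for a value whose
  -- digits have size at most c.
  eval-bound : ∀ f c → (∀ y → ∣ f y ∣ ≤ c) → ∀ m → ∣ eval f m ∣ * K + c ≤ c * N ^ m
  eval-bound f c f≤c zero    = ≤-reflexive (sym (*-identityʳ c))
  eval-bound f c f≤c (suc m) = begin
    ∣ f 0 ℤ.+ + N ℤ.* eval g m ∣ * K + c        ≤⟨ +-monoˡ-≤ c (*-monoˡ-≤ K (ℤ.∣i+j∣≤∣i∣+∣j∣ (f 0) _)) ⟩
    (∣ f 0 ∣ + ∣ + N ℤ.* eval g m ∣) * K + c    ≡⟨ cong (λ z → (∣ f 0 ∣ + z) * K + c) (ℤ.abs-* (+ N) (eval g m)) ⟩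
    (∣ f 0 ∣ + N * ∣ eval g m ∣) * K + c        ≤⟨ +-monoˡ-≤ c (*-monoˡ-≤ K (+-monoˡ-≤ _ (f≤c 0))) ⟩
    (c + N * ∣ eval g m ∣) * K + c              ≡⟨ solve 3 (λ c e K → (c :+ (con 1 :+ K) :* e) :* K :+ c := (con 1 :+ K) :* (e :* K :+ c)) refl c ∣ eval g m ∣ K ⟩
    N * (∣ eval g m ∣ * K + c)                  ≤⟨ *-monoʳ-≤ N (eval-bound g c (f≤c ∘ suc) m) ⟩
    N * (c * N ^ m)                             ≡⟨ solve 3 (λ n c p → n :* (c :* p) := c :* (n :* p)) refl N c (N ^ m) ⟩
    c * (N * N ^ m)                             ∎
    where
    open ≤-Reasoning
    open ℕSolver
    g = f ∘ suc

  module Periodic (m : ℕ) where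

    M : ℕ
    M = N ^ m ∸ 1

    private
      1≤N^ : ∀ j → 1 ≤ N ^ j
      1≤N^ j = m^n>0 N j

    1≤M : 1 ≤ K → 1 ≤ m → 1 ≤ M
    1≤M 1≤K 1≤m = m<n⇒0<n∸m (≤-trans (s≤s 1≤K) (≤-trans (≤-reflexive (sym (^-identityʳ N))) (^-monoʳ-≤ N 1≤m)))

    +M : + M ≡ + (N ^ m) ℤ.- 1ℤ
    +M = trans (sym (ℤ.⊖-≥ (1≤N^ m))) (sym (ℤ.[+m]-[+n]≡m⊖n (N ^ m) 1))

    Period : (ℕ → ℤ) → Set
    Period f = ∀ y → f (y + m) ≡ f y

    shift : ℕ → (ℕ → ℤ) → ℕ → ℤ
    shift t f y = f (y + t)

    shift-period : ∀ {f} t → Period f → Period (shift t f)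
    shift-period {f} t per y = trans (cong f (solve 3 (λ y m t → y :+ m :+ t := y :+ t :+ m) refl y m t)) (per (y + t))
      where open ℕSolver

    -- `shift t` is multiplication by X ^ (-t) modulo X ^ m - 1. Shifting by one drops the lowest
    -- digit and, by periodicity, appends the same digit at position m, which changes the value by a
    -- multiple of N ^ m - 1.
    eval-shift : ∀ {f} → Period f → ∀ t → + M ∣ℤ (+ (N ^ t) ℤ.* eval (shift t f) m ℤ.- eval f m)
    eval-shift {f} per zero = divides 0ℤ (trans
      (cong (λ z → + 1 ℤ.* z ℤ.- eval f m) (eval-cong (λ y → cong f (+-identityʳ y)) m))
      (solve 1 (λ z → con 1ℤ :* z :- z := con 0ℤ) refl (eval f m)))
      where open ℤSolver
    eval-shift {f} per (suc t) = subst (+ M ∣ℤ_) (sym eq)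
      (ℤ∣.∣m∣n⇒∣m+n (eval-shift per t) (divides (+ (N ^ t) ℤ.* g 0) refl))
      where
      open ≡-Reasoning
      open ℤSolver
      g : ℕ → ℤ
      g = shift t f
      N*eval : + N ℤ.* eval (g ∘ suc) m ≡ eval g m ℤ.+ g 0 ℤ.* + M
      N*eval = begin
        + N ℤ.* eval (g ∘ suc) m                        ≡⟨ solve 2 (λ a b → b := (a :+ b) :- a) refl (g 0) (+ N ℤ.* eval (g ∘ suc) m) ⟩
        eval g (suc m) ℤ.- g 0                          ≡⟨ cong (ℤ._- g 0) (eval-last g m) ⟩
        eval g m ℤ.+ + (N ^ m) ℤ.* g m ℤ.- g 0          ≡⟨ cong (λ z → eval g m ℤ.+ + (N ^ m) ℤ.* z ℤ.- g 0) (shift-period {f} t per 0) ⟩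
        eval g m ℤ.+ + (N ^ m) ℤ.* g 0 ℤ.- g 0          ≡⟨ solve 3 (λ e p a → e :+ p :* a :- a := e :+ a :* (p :- con 1ℤ)) refl (eval g m) (+ (N ^ m)) (g 0) ⟩
        eval g m ℤ.+ g 0 ℤ.* (+ (N ^ m) ℤ.- 1ℤ)         ≡⟨ cong (λ z → eval g m ℤ.+ g 0 ℤ.* z) (sym +M) ⟩
        eval g m ℤ.+ g 0 ℤ.* + M                        ∎
      eq : + (N ^ suc t) ℤ.* eval (shift (suc t) f) m ℤ.- eval f m ≡
           (+ (N ^ t) ℤ.* eval g m ℤ.- eval f m) ℤ.+ + (N ^ t) ℤ.* g 0 ℤ.* + M
      eq = begin
        + (N ^ suc t) ℤ.* eval (shift (suc t) f) m ℤ.- eval f m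
          ≡⟨ cong₂ (λ u v → u ℤ.* v ℤ.- eval f m) (ℤ.pos-* N (N ^ t)) (eval-cong (λ y → cong f (+-suc y t)) m) ⟩
        + N ℤ.* + (N ^ t) ℤ.* eval (g ∘ suc) m ℤ.- eval f m
          ≡⟨ solve 4 (λ n p e F → n :* p :* e :- F := p :* (n :* e) :- F) refl (+ N) (+ (N ^ t)) (eval (g ∘ suc) m) (eval f m) ⟩
        + (N ^ t) ℤ.* (+ N ℤ.* eval (g ∘ suc) m) ℤ.- eval f m
          ≡⟨ cong (λ z → + (N ^ t) ℤ.* z ℤ.- eval f m) N*eval ⟩
        + (N ^ t) ℤ.* (eval g m ℤ.+ g 0 ℤ.* + M) ℤ.- eval f m
          ≡⟨ solve 5 (λ p e a M F → p :* (e :+ a :* M) :- F := (p :* e :- F) :+ p :* a :* M) refl (+ (N ^ t)) (eval g m) (g 0) (+ M) (eval f m) ⟩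
        (+ (N ^ t) ℤ.* eval g m ℤ.- eval f m) ℤ.+ + (N ^ t) ℤ.* g 0 ℤ.* + M ∎

    -- Multiplication by X ^ (-s) - 1, which equals X ^ t - 1 modulo X ^ m - 1 when s + t = m.
    difference : ℕ → (ℕ → ℤ) → ℕ → ℤ
    difference s f y = f (y + s) ℤ.- f y

    eval-difference : ∀ {f} → Period f → ∀ s t → s + t ≡ m →
      + M ∣ℤ (eval (difference s f) m ℤ.- (+ (N ^ t) ℤ.- 1ℤ) ℤ.* eval f m)
    eval-difference {f} per s t s+t≡m = subst (+ M ∣ℤ_) (sym eq)
      (ℤ∣.∣m∣n⇒∣m-n (ℤ∣.∣n⇒∣m*n (+ (N ^ t)) (eval-shift per s)) (divides (eval (shift s f) m) refl))
      where
      open ≡-Reasoning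
      open ℤSolver
      G = eval (shift s f) m
      F = eval f m
      N^tN^s : + (N ^ t) ℤ.* + (N ^ s) ≡ + M ℤ.+ 1ℤ
      N^tN^s = begin
        + (N ^ t) ℤ.* + (N ^ s)     ≡⟨ sym (ℤ.pos-* (N ^ t) (N ^ s)) ⟩
        + (N ^ t * N ^ s)           ≡⟨ cong +_ (trans (sym (^-distribˡ-+-* N t s)) (cong (N ^_) (trans (+-comm t s) s+t≡m))) ⟩
        + (N ^ m)                   ≡⟨ solve 1 (λ p → p := p :- con 1ℤ :+ con 1ℤ) refl (+ (N ^ m)) ⟩
        + (N ^ m) ℤ.- 1ℤ ℤ.+ 1ℤ     ≡⟨ cong (ℤ._+ 1ℤ) (sym +M) ⟩
        + M ℤ.+ 1ℤ                  ∎
      eq : eval (difference s f) m ℤ.- (+ (N ^ t) ℤ.- 1ℤ) ℤ.* F ≡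
           + (N ^ t) ℤ.* (+ (N ^ s) ℤ.* G ℤ.- F) ℤ.- G ℤ.* + M
      eq = begin
        eval (difference s f) m ℤ.- (+ (N ^ t) ℤ.- 1ℤ) ℤ.* F
          ≡⟨ cong (λ z → z ℤ.- (+ (N ^ t) ℤ.- 1ℤ) ℤ.* F) (eval-- (shift s f) f m) ⟩
        G ℤ.- F ℤ.- (+ (N ^ t) ℤ.- 1ℤ) ℤ.* F
          ≡⟨ solve 4 (λ G F p M → G :- F :- (p :- con 1ℤ) :* F := (M :+ con 1ℤ) :* G :- p :* F :- G :* M) refl G F (+ (N ^ t)) (+ M) ⟩
        (+ M ℤ.+ 1ℤ) ℤ.* G ℤ.- + (N ^ t) ℤ.* F ℤ.- G ℤ.* + M
          ≡⟨ cong (λ z → z ℤ.* G ℤ.- + (N ^ t) ℤ.* F ℤ.- G ℤ.* + M) (sym N^tN^s) ⟩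
        + (N ^ t) ℤ.* + (N ^ s) ℤ.* G ℤ.- + (N ^ t) ℤ.* F ℤ.- G ℤ.* + M
          ≡⟨ solve 5 (λ p r G F M → p :* r :* G :- p :* F :- G :* M := p :* (r :* G :- F) :- G :* M) refl (+ (N ^ t)) (+ (N ^ s)) G F (+ M) ⟩
        + (N ^ t) ℤ.* (+ (N ^ s) ℤ.* G ℤ.- F) ℤ.- G ℤ.* + M ∎

    -- A nonzero multiple of N ^ m - 1 is too large to have all its base-N digits of size less than N - 1.
    eval-nonzero : ∀ f c → (∀ y → ∣ f y ∣ ≤ c) → c < K → 1 ≤ m → f 0 ≢ 0ℤ → ¬ (M ℕ.∣ ∣ eval f m ∣)
    eval-nonzero f c f≤c c<K 1≤m f0≢0 M∣ with ∣ eval f m ∣ in eq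
    ... | zero = f0≢0 (first-digit m 1≤m (ℤ.∣i∣≡0⇒i≡0 eq))
      where
      first-digit : ∀ m → 1 ≤ m → eval f m ≡ 0ℤ → f 0 ≡ 0ℤ
      first-digit (suc m) _ e≡0 = ℤ.∣i∣≡0⇒i≡0 (small (ℕ.divides ∣ eval (f ∘ suc) m ∣ (begin
          ∣ f 0 ∣                                 ≡⟨ cong ∣_∣ (ℤSolver.solve 2 (λ a b → a ℤSolver.:= (a ℤSolver.:+ b) ℤSolver.:- b) refl (f 0) (+ N ℤ.* eval (f ∘ suc) m)) ⟩
          ∣ eval f (suc m) ℤ.- + N ℤ.* eval (f ∘ suc) m ∣ ≡⟨ cong (λ z → ∣ z ℤ.- + N ℤ.* eval (f ∘ suc) m ∣) e≡0 ⟩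
          ∣ 0ℤ ℤ.- + N ℤ.* eval (f ∘ suc) m ∣     ≡⟨ cong ∣_∣ (ℤ.+-identityˡ (ℤ.- (+ N ℤ.* eval (f ∘ suc) m))) ⟩
          ∣ ℤ.- (+ N ℤ.* eval (f ∘ suc) m) ∣      ≡⟨ ℤ.∣-i∣≡∣i∣ (+ N ℤ.* eval (f ∘ suc) m) ⟩
          ∣ + N ℤ.* eval (f ∘ suc) m ∣            ≡⟨ trans (ℤ.abs-* (+ N) (eval (f ∘ suc) m)) (*-comm N _) ⟩
          ∣ eval (f ∘ suc) m ∣ * N                ∎)) (≤-<-trans (f≤c 0) (<-trans c<K (n<1+n K))))
        where
        open ≡-Reasoning
        small : ∀ {a} → N ℕ.∣ a → a < N → a ≡ 0
        small {zero}  _ _  = refl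
        small {suc a} d lt = contradiction (ℕ.∣⇒≤ d) (<⇒≱ lt)
    ... | suc e = <⇒≱ c<K (*-cancelˡ-≤ M {{M≢0}} (+-cancelʳ-≤ c _ _ (begin
        M * K + c                   ≤⟨ +-monoˡ-≤ c (*-monoˡ-≤ K (ℕ.∣⇒≤ M∣)) ⟩
        suc e * K + c               ≡⟨ cong (λ z → z * K + c) (sym eq) ⟩
        ∣ eval f m ∣ * K + c        ≤⟨ eval-bound f c f≤c m ⟩
        c * N ^ m                   ≡⟨ cong (c *_) (sym (m∸n+n≡m (1≤N^ m))) ⟩
        c * (M + 1)                 ≡⟨ ℕSolver.solve 2 (λ c M → c ℕSolver.:* (M ℕSolver.:+ ℕSolver.con 1) ℕSolver.:= M ℕSolver.:* c ℕSolver.:+ c) refl c M ⟩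
        M * c + c                   ∎)))
      where
      open ≤-Reasoning
      M≢0 : NonZero M
      M≢0 = >-nonZero (1≤M (≤-trans (s≤s z≤n) c<K) 1≤m)

    -- Applying difference (m - t) for t = m / l, over the primes l ∣ m with l ≤ j, to the unit of ℤ[ℤ/m];
    -- gcd collects the cofactors of N ^ t - 1 in N ^ m - 1.
    record Stage (j : ℕ) : Set where
      field
        element  : ℕ → ℤ
        period   : Period element
        bounded  : ∀ y → ∣ element y ∣ ≤ 2 ^ j
        -- Nonzero coefficients sit only at residues whose order in ℤ/m divides j !. This invariant
        -- keeps the coefficient at 0 nonzero when the next prime is treated.
        support  : ∀ y → element y ≢ 0ℤ → m ℕ.∣ y * j !
        nonzero₀ : element 0 ≢ 0ℤ
        gcd      : ℕ
        gcd∣M    : gcd ℕ.∣ M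
        gcd∣     : ∀ l t → Prime l → l ≤ j → t * l ≡ m → gcd ℕ.∣ geometric (N ^ t) l
        M∣       : M ℕ.∣ gcd * ∣ eval element m ∣

    stage₀ : Stage 0
    stage₀ = record
      { element = unit
      ; period = unit-period
      ; bounded = unit-bounded
      ; support = unit-support
      ; nonzero₀ = unit-0
      ; gcd = M
      ; gcd∣M = ℕ.∣-refl
      ; gcd∣ = λ { zero t pr _ _ → ⊥-elim (≢-nonZero⁻¹ 0 {{prime⇒nonZero pr}} refl) }
      ; M∣ = ℕ.m∣m*n _ }
      where
      unit : ℕ → ℤ
      unit y = if ⌊ m ℕ.∣? y ⌋ then 1ℤ else 0ℤ
      unit-period : Period unit
      unit-period y with m ℕ.∣? y | m ℕ.∣? (y + m)
      ... | yes _ | yes _ = refl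
      ... | no _  | no _ = refl
      ... | yes p | no ¬p = contradiction (ℕ.∣m∣n⇒∣m+n p ℕ.∣-refl) ¬p
      ... | no ¬p | yes p = contradiction (∣+ʳ⇒∣ˡ p ℕ.∣-refl) ¬p
      unit-bounded : ∀ y → ∣ unit y ∣ ≤ 1
      unit-bounded y with m ℕ.∣? y
      ... | yes _ = ≤-refl
      ... | no _  = z≤n
      unit-support : ∀ y → unit y ≢ 0ℤ → m ℕ.∣ y * 1
      unit-support y u≢0 with m ℕ.∣? y
      ... | yes p = ℕ.∣m⇒∣m*n 1 p
      ... | no _  = contradiction refl u≢0
      unit-0 : unit 0 ≢ 0ℤ
      unit-0 with m ℕ.∣? 0
      ... | yes _ = λ ()
      ... | no ¬p = contradiction (m ℕ.∣0) ¬p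

    skipStage : ∀ {j} → Stage j → (Prime (suc j) → ¬ suc j ℕ.∣ m) → Stage (suc j)
    skipStage {j} S skip = record
      { element = element
      ; period = period
      ; bounded = λ y → ≤-trans (bounded y) (m≤m+n (2 ^ j) _)
      ; support = λ y f≢0 → ℕ.∣-trans (support y f≢0) (ℕ.*-monoʳ-∣ y (ℕ.n∣m*n (suc j)))
      ; nonzero₀ = nonzero₀
      ; gcd = gcd
      ; gcd∣M = gcd∣M
      ; gcd∣ = gcd∣′
      ; M∣ = M∣ }
      where
      open Stage S
      gcd∣′ : ∀ l t → Prime l → l ≤ suc j → t * l ≡ m → gcd ℕ.∣ geometric (N ^ t) l
      gcd∣′ l t pr l≤ eq with m≤n⇒m<n∨m≡n l≤
      ... | inj₁ l<   = gcd∣ l t pr (s≤s⁻¹ l<) eq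
      ... | inj₂ refl = contradiction (ℕ.divides t (sym eq)) (skip pr)

    nextStage : ∀ {j} → 1 ≤ m → Stage j → Stage (suc j)
    nextStage {j} 1≤m S with prime? (suc j) | suc j ℕ.∣? m
    ... | yes pr | yes (ℕ.divides t m≡) = record
      { element = difference s f
      ; period = λ y → cong₂ ℤ._-_ (shift-period {f} s period y) (period y)
      ; bounded = λ y → ≤-trans (ℤ.∣i-j∣≤∣i∣+∣j∣ (f (y + s)) (f y)) (≤-trans (+-mono-≤ (bounded (y + s)) (bounded y))
          (≤-reflexive (cong (λ z → 2 ^ j + z) (sym (+-identityʳ (2 ^ j))))))
      ; support = support′
      ; nonzero₀ = nonzero′
      ; gcd = GCD.gcd gcd g
      ; gcd∣M = ℕ.∣-trans (GCD.gcd[m,n]∣m gcd g) gcd∣M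
      ; gcd∣ = gcd∣′
      ; M∣ = M∣′ }
      where
      open Stage S renaming (element to f)
      l = suc j
      g = geometric (N ^ t) l
      s = m ∸ t
      t≤m : t ≤ m
      t≤m = subst (t ≤_) (sym m≡) (m≤m*n t l)
      s+t≡m : s + t ≡ m
      s+t≡m = m∸n+n≡m t≤m
      1≤t : 1 ≤ t
      1≤t = n≢0⇒n>0 λ t≡0 → m<n⇒n≢0 1≤m (trans m≡ (cong (_* l) t≡0))
      s! : m ℕ.∣ s * (l !)
      s! = ∣+ʳ⇒∣ˡ (subst (m ℕ.∣_) (trans (cong (_* l !) (sym s+t≡m)) (*-distribʳ-+ (l !) s t)) (ℕ.m∣m*n (l !)))
        (subst (m ℕ.∣_) (trans (cong (_* j !) m≡) (*-assoc t l (j !))) (ℕ.m∣m*n (j !)))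
      support′ : ∀ y → difference s f y ≢ 0ℤ → m ℕ.∣ y * (l !)
      support′ y d≢0 with f y ℤ.≟ 0ℤ
      ... | no fy≢0 = ℕ.∣-trans (support y fy≢0) (ℕ.*-monoʳ-∣ y (ℕ.n∣m*n l))
      ... | yes fy≡0 with f (y + s) ℤ.≟ 0ℤ
      ...   | yes fs≡0 = contradiction (cong₂ ℤ._-_ fs≡0 fy≡0) d≢0
      ...   | no fs≢0 = ∣+ʳ⇒∣ˡ (subst (m ℕ.∣_) (*-distribʳ-+ (l !) y s)
                (ℕ.∣-trans (support (y + s) fs≢0) (ℕ.*-monoʳ-∣ (y + s) (ℕ.n∣m*n l)))) s!
      -- The residue s ≡ -t has order l in ℤ/m, and the prime l = j + 1 does not divide j !. So f
      -- vanishes at s and f s cannot cancel f 0.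
      nonzero′ : difference s f 0 ≢ 0ℤ
      nonzero′ d≡0 = prime∤! pr j (n<1+n j) (ℕ.*-cancelˡ-∣ t {{>-nonZero 1≤t}} (subst (ℕ._∣ t * j !) m≡ m∣t*j!))
        where
        fs≢0 : f s ≢ 0ℤ
        fs≢0 = nonzero₀ ∘ trans (sym (ℤ.i-j≡0⇒i≡j (f s) (f 0) d≡0))
        m∣t*j! : m ℕ.∣ t * j !
        m∣t*j! = ℕ.∣m+n∣m⇒∣n (subst (m ℕ.∣_) (trans (cong (_* j !) (sym s+t≡m)) (*-distribʳ-+ (j !) s t)) (ℕ.m∣m*n (j !))) (support s fs≢0)
      gcd∣′ : ∀ l′ t′ → Prime l′ → l′ ≤ suc j → t′ * l′ ≡ m → GCD.gcd gcd g ℕ.∣ geometric (N ^ t′) l′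
      gcd∣′ l′ t′ pr′ l′≤ eq′ with m≤n⇒m<n∨m≡n l′≤
      ... | inj₁ l′<l = ℕ.∣-trans (GCD.gcd[m,n]∣m gcd g) (gcd∣ l′ t′ pr′ (s≤s⁻¹ l′<l) eq′)
      ... | inj₂ refl rewrite *-cancelʳ-≡ t′ t (suc j) (trans eq′ m≡) = GCD.gcd[m,n]∣n gcd g
      A : ℕ
      A = N ^ t ∸ 1
      gA≡M : g * A ≡ M
      gA≡M = trans (sym (m+n∸n≡m (g * A) 1)) (cong (_∸ 1) (trans
        (subst (λ x → geometric x l * A + 1 ≡ x ^ l) (trans (+-comm 1 A) (m∸n+n≡m (1≤N^ t))) (geometric-* A l))
        (trans (^-*-assoc N t l) (cong (N ^_) (sym m≡)))))
      E = ∣ eval f m ∣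
      AE : ∣ (+ (N ^ t) ℤ.- 1ℤ) ℤ.* eval f m ∣ ≡ A * E
      AE = trans (ℤ.abs-* (+ (N ^ t) ℤ.- 1ℤ) (eval f m)) (cong (λ z → ∣ z ∣ * E)
        (trans (ℤ.[+m]-[+n]≡m⊖n (N ^ t) 1) (ℤ.⊖-≥ (1≤N^ t))))
      -- M divides gcd E by the previous stage, and M = g A divides g A E. Hence M divides both A E
      -- gcd and A E g, and therefore A E times the new gcd.
      M∣gcd*AE : M ℕ.∣ GCD.gcd gcd g * (A * E)
      M∣gcd*AE = subst (M ℕ.∣_) (trans (sym (GCD.c*gcd[m,n]≡gcd[cm,cn] (A * E) gcd g)) (*-comm (A * E) _))
        (GCD.gcd-greatest
          (subst (M ℕ.∣_) (solve 3 (λ d e a → d :* e :* a := a :* e :* d) refl gcd E A) (ℕ.∣m⇒∣m*n A M∣))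
          (subst (M ℕ.∣_) (trans (cong (_* E) (sym gA≡M)) (solve 3 (λ g a e → g :* a :* e := a :* e :* g) refl g A E)) (ℕ.m∣m*n E)))
        where open ℕSolver
      M∣′ : M ℕ.∣ GCD.gcd gcd g * ∣ eval (difference s f) m ∣
      M∣′ = subst (M ℕ.∣_) (ℤ.abs-* (+ d) (eval (difference s f) m)) (∣⇒∣ᵤ {+ M} (ℤ∣.∣m+n∣n⇒∣m
        {+ M} {+ d ℤ.* eval (difference s f) m} {ℤ.- (+ d ℤ.* ((+ (N ^ t) ℤ.- 1ℤ) ℤ.* eval f m))}
        (subst (+ M ∣ℤ_) (solve 3 (λ d x y → d :* (x :- y) := d :* x :+ :- (d :* y)) refl (+ d) (eval (difference s f) m) ((+ (N ^ t) ℤ.- 1ℤ) ℤ.* eval f m))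
          (ℤ∣.∣n⇒∣m*n (+ d) (eval-difference period s t s+t≡m)))
        (ℤ∣.∣m⇒∣-m {+ M} (∣ᵤ⇒∣ {+ M} (subst (M ℕ.∣_) (sym (trans (ℤ.abs-* (+ d) ((+ (N ^ t) ℤ.- 1ℤ) ℤ.* eval f m)) (cong (d *_) AE))) M∣gcd*AE)))))
        where
        open ℤSolver
        d = GCD.gcd gcd g
    ... | yes _  | no ¬d = skipStage S λ _ → ¬d
    ... | no ¬pr | _     = skipStage S λ pr → contradiction pr ¬pr

    stage : 1 ≤ m → ∀ j → Stage j
    stage 1≤m zero    = stage₀
    stage 1≤m (suc j) = nextStage 1≤m (stage 1≤m j)

module _ (q : ℕ) (q-prime : Prime q) where
  open Residues q q-prime
  open FieldTheory q q-prime

  𝟘↑ : ∀ {n} → 1 ≤ n → 𝟘 ↑ n ≡ 𝟘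
  𝟘↑ {suc n} _ = 𝟘⊗ _

  ↑-multiple : ∀ {x} k n → x ↑ n ≡ 𝟏 → x ↑ (k * n) ≡ 𝟏
  ↑-multiple {x} k n xⁿ = trans (cong (x ↑_) (*-comm k n)) (trans (sym (^-assocʳ x n k)) (trans (cong (_↑ k) xⁿ) (𝟏↑ k)))

  ↑-difference : ∀ {x d} m n u v → x ↑ m ≡ 𝟏 → x ↑ n ≡ 𝟏 → d + v * n ≡ u * m → x ↑ d ≡ 𝟏
  ↑-difference {x} {d} m n u v xᵐ xⁿ eq = begin
    x ↑ d                   ≡⟨ sym (⊗𝟏 _) ⟩
    x ↑ d ⊗ 𝟏               ≡⟨ cong (x ↑ d ⊗_) (sym (↑-multiple v n xⁿ)) ⟩
    x ↑ d ⊗ x ↑ (v * n)     ≡⟨ sym (^-homo-* x d (v * n)) ⟩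
    x ↑ (d + v * n)         ≡⟨ cong (x ↑_) eq ⟩
    x ↑ (u * m)             ≡⟨ ↑-multiple u m xᵐ ⟩
    𝟏                       ∎
    where open ≡-Reasoning

  ↑-gcd : ∀ {x} m n → x ↑ m ≡ 𝟏 → x ↑ n ≡ 𝟏 → x ↑ GCD.gcd m n ≡ 𝟏
  ↑-gcd m n xᵐ xⁿ with GCD.Bézout.identity (GCD.gcd-GCD m n)
  ... | GCD.Bézout.+- u v eq = ↑-difference m n u v xᵐ xⁿ eq
  ... | GCD.Bézout.-+ u v eq = ↑-difference n m v u xⁿ xᵐ eq

  []-geometric : ∀ x l → [ + x ] ≡ 𝟏 → [ + geometric x l ] ≡ [ + l ]
  []-geometric x zero    x≡1 = refl
  []-geometric x (suc l) x≡1 = begin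
    [ + (1 + x * geometric x l) ]                   ≡⟨ []-+ (+ 1) (+ (x * geometric x l)) ⟩
    𝟏 ⊕ [ + (x * geometric x l) ]                   ≡⟨ cong (λ z → 𝟏 ⊕ [ z ]) (ℤ.pos-* x (geometric x l)) ⟩
    𝟏 ⊕ [ + x ℤ.* + geometric x l ]                 ≡⟨ cong (𝟏 ⊕_) ([]-* (+ x) (+ geometric x l)) ⟩
    𝟏 ⊕ [ + x ] ⊗ [ + geometric x l ]               ≡⟨ cong₂ (λ u v → 𝟏 ⊕ u ⊗ v) x≡1 ([]-geometric x l x≡1) ⟩
    𝟏 ⊕ 𝟏 ⊗ [ + l ]                                 ≡⟨ cong (𝟏 ⊕_) (𝟏⊗ _) ⟩
    𝟏 ⊕ [ + l ]                                     ≡⟨ sym ([]-+ (+ 1) (+ l)) ⟩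
    [ + suc l ]                                     ∎
    where open ≡-Reasoning

  -- Let d be the gcd of m and q - 1, and m = c d. From N ^ m ≡ 1 and Fermat, N ^ d ≡ 1. If c > 1,
  -- take a prime l dividing c and t = m / l, a multiple of d: then N ^ t ≡ 1, so
  -- `geometric (N ^ t) l` ≡ l and q divides l, hence m, hence N, which is invertible modulo q. So d
  -- = m.
  order-divides : ∀ N m → 1 ≤ m → m ℕ.∣ N → q ℕ.∣ N ^ m ∸ 1 → .{{NonZero N}} →
    (∀ l t → Prime l → l ≤ m → t * l ≡ m → q ℕ.∣ geometric (N ^ t) l) →
    ¬ q ℕ.∣ N × m ℕ.∣ count nonzero
  order-divides N m 1≤m m∣N q∣M q∣geometric = q∤N , subst (ℕ._∣ count nonzero) (d≡m c refl) (GCD.gcd[m,n]∣n m (count nonzero))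
    where
    ν = [ + N ]
    νᵐ : ν ↑ m ≡ 𝟏
    νᵐ = begin
      ν ↑ m                        ≡⟨ sym ([]-^ N m) ⟩
      [ + (N ^ m) ]                ≡⟨ cong (λ z → [ + z ]) (sym (m∸n+n≡m (m^n>0 N m))) ⟩
      [ + (N ^ m ∸ 1 + 1) ]        ≡⟨ []-+ (+ (N ^ m ∸ 1)) (+ 1) ⟩
      [ + (N ^ m ∸ 1) ] ⊕ 𝟏        ≡⟨ cong (_⊕ 𝟏) (∣⇒[]≡𝟘 q∣M) ⟩
      𝟘 ⊕ 𝟏                        ≡⟨ 𝟘⊕ 𝟏 ⟩
      𝟏                            ∎
      where open ≡-Reasoning
    ν≢0 : ν ≢ 𝟘
    ν≢0 ν≡0 = 𝟏≢𝟘 (trans (sym νᵐ) (trans (cong (_↑ m) ν≡0) (𝟘↑ 1≤m)))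
    q∤N : ¬ q ℕ.∣ N
    q∤N = ν≢0 ∘ ∣⇒[]≡𝟘
    d = GCD.gcd m (count nonzero)
    ν↑d : ν ↑ d ≡ 𝟏
    ν↑d = ↑-gcd m (count nonzero) νᵐ (fermat ν≢0)
    c : ℕ
    c = ℕ.quotient (GCD.gcd[m,n]∣m m (count nonzero))
    m≡c*d : m ≡ c * d
    m≡c*d = ℕ._∣_.equality (GCD.gcd[m,n]∣m m (count nonzero))
    d≡m : ∀ c′ → c ≡ c′ → d ≡ m
    d≡m zero c≡0 = contradiction (subst (1 ≤_) (trans m≡c*d (cong (_* d) c≡0)) 1≤m) λ ()
    d≡m (suc zero) c≡1 = sym (trans m≡c*d (trans (cong (_* d) c≡1) (+-identityʳ d)))
    d≡m (suc (suc c″)) c≡ with prime-divisor {suc (suc c″)} (s≤s (s≤s z≤n))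
    ... | l , pr , ℕ.divides b c≡bl = contradiction (ℕ.∣-trans q∣l (ℕ.∣-trans (ℕ.divides t (sym tl≡m)) m∣N)) q∤N
      where
      t = b * d
      tl≡m : t * l ≡ m
      tl≡m = trans (solve 3 (λ b d l → b :* d :* l := b :* l :* d) refl b d l)
        (trans (cong (_* d) (sym (trans c≡ c≡bl))) (sym m≡c*d))
        where open ℕSolver
      νᵗ : [ + (N ^ t) ] ≡ 𝟏
      νᵗ = trans ([]-^ N t) (trans (cong (ν ↑_) (*-comm b d)) (trans (sym (^-assocʳ ν d b)) (trans (cong (_↑ b) ν↑d) (𝟏↑ b))))
      q∣l : q ℕ.∣ l
      q∣l = []≡𝟘⇒∣ (trans (sym ([]-geometric (N ^ t) l νᵗ)) (∣⇒[]≡𝟘 (q∣geometric l t pr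
        (ℕ.∣⇒≤ {{>-nonZero 1≤m}} (ℕ.divides t (sym tl≡m))) tl≡m)))

primes≡1 : ∀ m B → 1 ≤ m → ∃ λ q → Σ (Prime q) λ pr → B < q × m ℕ.∣ count (FieldTheory.nonzero q pr)
primes≡1 m B 1≤m = conclude (prime-divisor 1<D)
  where
  c = 2 ^ m
  -- N = K + 1 is a multiple of B !, which excludes every prime q ≤ B because q does not divide N.
  -- The factor 2 + c makes N - 1 exceed c = 2 ^ m, the bound on the coefficients of the last stage.
  K = m * B ! * (2 + c) ∸ 1
  1≤mB! : 1 ≤ m * B !
  1≤mB! = *-mono-≤ 1≤m (1≤n! B)
  2+c≤ : 2 + c ≤ m * B ! * (2 + c)
  2+c≤ = m≤n*m (2 + c) (m * B !) {{>-nonZero 1≤mB!}}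
  c<K : c < K
  c<K = ∸-monoˡ-≤ 1 2+c≤
  open Evaluation K
  N≡ : N ≡ m * B ! * (2 + c)
  N≡ = trans (+-comm 1 K) (m∸n+n≡m (≤-trans (s≤s z≤n) 2+c≤))
  m∣N : m ℕ.∣ N
  m∣N = subst (m ℕ.∣_) (trans (sym (*-assoc m (B !) (2 + c))) (sym N≡)) (ℕ.m∣m*n _)
  B!∣N : B ! ℕ.∣ N
  B!∣N = subst (B ! ℕ.∣_) (sym N≡) (ℕ.∣m⇒∣m*n (2 + c) (ℕ.n∣m*n m))
  open Periodic m
  open Stage (stage 1≤m m) renaming (gcd to D)
  1<D : 1 < D
  1<D with D in eq
  ... | zero = contradiction (ℕ.0∣⇒≡0 (subst (λ d → d ℕ.∣ M) eq gcd∣M)) (m<n⇒n≢0 (1≤M (≤-trans (s≤s z≤n) c<K) 1≤m))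
  ... | suc zero = contradiction (subst (M ℕ.∣_) (+-identityʳ _) (subst (λ d → M ℕ.∣ d * ∣ eval element m ∣) eq M∣))
                     (eval-nonzero element c bounded c<K 1≤m nonzero₀)
  ... | suc (suc _) = s≤s (s≤s z≤n)
  conclude : (∃ λ q → Prime q × q ℕ.∣ D) → ∃ λ q → Σ (Prime q) λ pr → B < q × m ℕ.∣ count (FieldTheory.nonzero q pr)
  conclude (q , pr , q∣D) = q , pr , ≰⇒> (λ q≤B → proj₁ result (ℕ.∣-trans (∣! B (>-nonZero⁻¹ q {{prime⇒nonZero pr}}) q≤B) B!∣N)) , proj₂ result
    where
    result = order-divides q pr N m 1≤m m∣N (ℕ.∣-trans q∣D gcd∣M)
      λ l t prl l≤m eq → ℕ.∣-trans q∣D (gcd∣ l t prl l≤m eq)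

-- Embedding cliques with prescribed colours

abstract
  limit : ℕ → ℕ → ℕ
  limit e D = 12 * e * e * D

  limit-def : ∀ e D → limit e D ≡ 12 * e * e * D
  limit-def e D = refl

-- D records that every candidate set has at least q / D elements. The first summand makes the
-- places that are bad for one of the n later vertices fewer than the candidates for the current
-- vertex. The second allows the remaining sets to shrink by a factor 2 e.
threshold : ℕ → ℕ → ℕ → ℕ
threshold e zero    D = 0
threshold e (suc n) D = D * (n * limit e D) + threshold e n (D * (2 * e))

-- A second-moment argument: on average over x, every colour class at x meets a large set A in about
-- a fraction 1/e of its elements, because two points see a third one in the same colour about q/e times.
module Embedding (q e h : ℕ) (colour : Fin q → Fin q → Fin e) .{{_ : NonZero e}} (eh≤q : e * h ≤ q)
  (agree : ∀ {a b} → a ≢ b →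
    count (λ x → (not ⌊ x Fin.≟ a ⌋ ∧ not ⌊ x Fin.≟ b ⌋) ∧ ⌊ colour x a Fin.≟ colour x b ⌋) ≤ h) where

  adjacent : Fin e → Fin q → Fin q → Bool
  adjacent k x a = not ⌊ x Fin.≟ a ⌋ ∧ ⌊ colour x a Fin.≟ k ⌋

  private
    w : Fin e → Fin q → Fin q → ℕ
    w k x a = 𝟙 (adjacent k x a)

    same : Fin q → Fin q → Fin q → Bool
    same a b x = (not ⌊ x Fin.≟ a ⌋ ∧ not ⌊ x Fin.≟ b ⌋) ∧ ⌊ colour x a Fin.≟ colour x b ⌋

  restrict : (Fin q → Bool) → Fin e → Fin q → Fin q → Bool
  restrict A k x a = A a ∧ adjacent k x a

  degree : (Fin q → Bool) → Fin e → Fin q → ℕ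
  degree A k x = count (restrict A k x)

  private
    degree-∑ : ∀ A k x → degree A k x ≡ sum (λ a → 𝟙 (A a) * w k x a)
    degree-∑ A k x = sum-cong-≗ (λ a → 𝟙-∧ (A a) (adjacent k x a))

    ∑w : ∀ x a → 1 ≤ sum (λ k → w k x a) + δ x a
    ∑w x a with x Fin.≟ a
    ... | yes _ = m≤n+m 1 _
    ... | no _  = ≤-trans (≤-reflexive (sym (∑-δ1 (colour x a)))) (m≤m+n _ 0)

    -- The colour classes at x partition all points other than x, so A can lose only x itself.
    ∑degree : ∀ A x → count A ≤ sum (λ k → degree A k x) + 1
    ∑degree A x = begin
      sum (λ a → 𝟙 (A a))
        ≤⟨ ∑-mono (λ a → ≤-trans (≤-reflexive (sym (*-identityʳ _))) (*-monoʳ-≤ (𝟙 (A a)) (∑w x a))) ⟩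
      sum (λ a → 𝟙 (A a) * (sum (λ k → w k x a) + δ x a))
        ≤⟨ ∑-mono (λ a → ≤-trans (≤-reflexive (*-distribˡ-+ (𝟙 (A a)) _ _)) (+-monoʳ-≤ _ (≤-trans (*-monoˡ-≤ (δ x a) (𝟙≤1 (A a))) (≤-reflexive (+-identityʳ _))))) ⟩
      sum (λ a → 𝟙 (A a) * sum (λ k → w k x a) + δ x a)
        ≡⟨ ∑-distrib-+ (λ a → 𝟙 (A a) * sum (λ k → w k x a)) (δ x) ⟩
      sum (λ a → 𝟙 (A a) * sum (λ k → w k x a)) + sum (δ x)
        ≡⟨ cong₂ _+_ (trans (sum-cong-≗ (λ a → *-distribˡ-sum (𝟙 (A a)) (λ k → w k x a))) (∑-comm (λ a k → 𝟙 (A a) * w k x a))) (∑-δ1 x) ⟩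
      sum (λ k → sum (λ a → 𝟙 (A a) * w k x a)) + 1
        ≡⟨ cong (_+ 1) (sum-cong-≗ (λ k → sym (degree-∑ A k x))) ⟩
      sum (λ k → degree A k x) + 1 ∎
      where open ≤-Reasoning

    ∑ww : ∀ a b x → sum (λ k → w k x a * w k x b) ≡ 𝟙 (same a b x)
    ∑ww a b x with x Fin.≟ a | x Fin.≟ b
    ... | yes _ | _     = ∑-zero {e} λ _ → refl
    ... | no _  | yes _ = ∑-zero {e} λ k → *-zeroʳ (δ (colour x a) k)
    ... | no _  | no _  = trans (∑-δ (colour x a) (δ (colour x b))) (δ-sym (colour x b) (colour x a))

    agree-all : ∀ a b → count (same a b) ≤ h + δ a b * q
    agree-all a b with a Fin.≟ b
    ... | yes _  = ≤-trans (count≤ (same a b)) (≤-trans (≤-reflexive (sym (+-identityʳ q))) (m≤n+m _ h))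
    ... | no a≢b = ≤-trans (agree a≢b) (m≤m+n h _)

    -- Counts triples (a, b, x) with a and b in A and of the same colour at x. A pair a ≢ b
    -- contributes at most h by `agree`, a pair a = b at most q.
    ∑degree² : ∀ A → sum (λ x → sum (λ k → degree A k x * degree A k x)) ≤ count A * (count A * h + q)
    ∑degree² A = begin
      sum (λ x → sum (λ k → degree A k x * degree A k x))
        ≡⟨ sum-cong-≗ (λ x → trans (sum-cong-≗ (square x)) (trans (∑-comm (λ k a → sum (λ b → F a b * (w k x a * w k x b))))
             (sum-cong-≗ (λ a → trans (∑-comm (λ k b → F a b * (w k x a * w k x b))) (sum-cong-≗ (λ b → inner x a b)))))) ⟩
      sum (λ x → sum (λ a → sum (λ b → F a b * 𝟙 (same a b x))))
        ≡⟨ trans (∑-comm (λ x a → sum (λ b → F a b * 𝟙 (same a b x)))) (sum-cong-≗ (λ a →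
             trans (∑-comm (λ x b → F a b * 𝟙 (same a b x))) (sum-cong-≗ (λ b → sym (*-distribˡ-sum (F a b) (𝟙 ∘ same a b)))))) ⟩
      sum (λ a → sum (λ b → F a b * count (same a b)))
        ≤⟨ ∑-mono (λ a → ∑-mono (λ b → *-monoʳ-≤ (F a b) (agree-all a b))) ⟩
      sum (λ a → sum (λ b → F a b * (h + δ a b * q)))
        ≤⟨ ∑-mono row ⟩
      sum (λ a → 𝟙 (A a) * (count A * h + q))
        ≡⟨ sym (*-distribʳ-sum (count A * h + q) (𝟙 ∘ A)) ⟩
      count A * (count A * h + q) ∎
      where
      open ≤-Reasoning
      F : Fin q → Fin q → ℕ
      F a b = 𝟙 (A a) * 𝟙 (A b)
      square : ∀ x k → degree A k x * degree A k x ≡ sum (λ a → sum (λ b → F a b * (w k x a * w k x b)))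
      square x k = trans (cong₂ _*_ (degree-∑ A k x) (degree-∑ A k x)) (trans (∑∑-* (λ a → 𝟙 (A a) * w k x a) (λ a → 𝟙 (A a) * w k x a))
        (sum-cong-≗ λ a → sum-cong-≗ λ b → solve 4 (λ s t u v → (s :* t) :* (u :* v) := (s :* u) :* (t :* v)) refl
          (𝟙 (A a)) (w k x a) (𝟙 (A b)) (w k x b)))
        where open ℕSolver
      inner : ∀ x a b → sum (λ k → F a b * (w k x a * w k x b)) ≡ F a b * 𝟙 (same a b x)
      inner x a b = trans (sym (*-distribˡ-sum (F a b) (λ k → w k x a * w k x b))) (cong (F a b *_) (∑ww a b x))
      row : ∀ a → sum (λ b → F a b * (h + δ a b * q)) ≤ 𝟙 (A a) * (count A * h + q)
      row a = begin
        sum (λ b → F a b * (h + δ a b * q))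
          ≤⟨ ∑-mono (λ b → ≤-trans (≤-reflexive (expand (𝟙 (A a)) (𝟙 (A b)) h (δ a b) q))
               (*-monoʳ-≤ (𝟙 (A a)) (+-monoʳ-≤ (𝟙 (A b) * h) (≤-trans (*-monoˡ-≤ (δ a b * q) (𝟙≤1 (A b))) (≤-reflexive (+-identityʳ _)))))) ⟩
        sum (λ b → 𝟙 (A a) * (𝟙 (A b) * h + δ a b * q))
          ≡⟨ sym (*-distribˡ-sum (𝟙 (A a)) (λ b → 𝟙 (A b) * h + δ a b * q)) ⟩
        𝟙 (A a) * sum (λ b → 𝟙 (A b) * h + δ a b * q)
          ≡⟨ cong (𝟙 (A a) *_) (trans (∑-distrib-+ (λ b → 𝟙 (A b) * h) (λ b → δ a b * q))
               (cong₂ _+_ (sym (*-distribʳ-sum h (𝟙 ∘ A))) (∑-δ a (λ _ → q)))) ⟩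
        𝟙 (A a) * (count A * h + q) ∎
        where
        expand : ∀ s t h d q → s * t * (h + d * q) ≡ s * (t * h + t * (d * q))
        expand = solve 5 (λ s t h d q → s :* t :* (h :+ d :* q) := s :* (t :* h :+ t :* (d :* q))) refl
          where open ℕSolver

  bad : (Fin q → Bool) → Fin e → Fin q → Bool
  bad A k x = ⌊ 2 * e * degree A k x ≤? count A ⌋

  private
    -- (2 e d - A) (2 e d - 3 A) ≥ 0 when 2 e d ≤ A, and (2 e d - 2 A)² ≥ 0 always.
    deviation : ∀ d A → 8 * e * A * d + A * A * 𝟙 ⌊ 2 * e * d ≤? A ⌋ ≤ 4 * e * e * (d * d) + 4 * (A * A)
    deviation d A with 2 * e * d ≤? A
    ... | yes z≤A = subst₂ _≤_ (eq₁ e d A) (eq₂ e d A) (lower (2 * e * d) A z≤A)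
      where
      open ℕSolver
      lower : ∀ z A → z ≤ A → 4 * A * z + A * A ≤ z * z + 4 * (A * A)
      lower z A z≤A rewrite sym (m∸n+n≡m z≤A) = ≤-trans (m≤m+n _ (3 * (y * y) + 2 * (y * z))) (≤-reflexive (sym (id z y)))
        where
        y = A ∸ z
        id : ∀ z y → z * z + 4 * ((y + z) * (y + z)) ≡ 4 * (y + z) * z + (y + z) * (y + z) + (3 * (y * y) + 2 * (y * z))
        id = solve 2 (λ z y → z :* z :+ con 4 :* ((y :+ z) :* (y :+ z)) := con 4 :* (y :+ z) :* z :+ (y :+ z) :* (y :+ z) :+ (con 3 :* (y :* y) :+ con 2 :* (y :* z))) refl
      eq₁ : ∀ e d A → 4 * A * (2 * e * d) + A * A ≡ 8 * e * A * d + A * A * 1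
      eq₁ = solve 3 (λ e d A → con 4 :* A :* (con 2 :* e :* d) :+ A :* A := con 8 :* e :* A :* d :+ A :* A :* con 1) refl
      eq₂ : ∀ e d A → 2 * e * d * (2 * e * d) + 4 * (A * A) ≡ 4 * e * e * (d * d) + 4 * (A * A)
      eq₂ = solve 3 (λ e d A → con 2 :* e :* d :* (con 2 :* e :* d) :+ con 4 :* (A :* A) := con 4 :* e :* e :* (d :* d) :+ con 4 :* (A :* A)) refl
    ... | no _ = subst₂ _≤_ (eq₁ e d A) (eq₂ e d A) (*-monoʳ-≤ 4 (amgm (e * d) A))
      where
      open ℕSolver
      ordered : ∀ x y → x ≤ y → 2 * (x * y) ≤ x * x + y * y
      ordered x y x≤y rewrite sym (m∸n+n≡m x≤y) = ≤-trans (m≤m+n _ ((y ∸ x) * (y ∸ x))) (≤-reflexive (sym (id x (y ∸ x))))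
        where
        id : ∀ x z → x * x + (z + x) * (z + x) ≡ 2 * (x * (z + x)) + z * z
        id = solve 2 (λ x z → x :* x :+ (z :+ x) :* (z :+ x) := con 2 :* (x :* (z :+ x)) :+ z :* z) refl
      amgm : ∀ x y → 2 * (x * y) ≤ x * x + y * y
      amgm x y with ≤-total x y
      ... | inj₁ x≤y = ordered x y x≤y
      ... | inj₂ y≤x = subst₂ _≤_ (cong (2 *_) (*-comm y x)) (+-comm (y * y) (x * x)) (ordered y x y≤x)
      eq₁ : ∀ e d A → 4 * (2 * (e * d * A)) ≡ 8 * e * A * d + A * A * 0
      eq₁ = solve 3 (λ e d A → con 4 :* (con 2 :* (e :* d :* A)) := con 8 :* e :* A :* d :+ A :* A :* con 0) refl
      eq₂ : ∀ e d A → 4 * (e * d * (e * d) + A * A) ≡ 4 * e * e * (d * d) + 4 * (A * A)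
      eq₂ = solve 3 (λ e d A → con 4 :* (e :* d :* (e :* d) :+ A :* A) := con 4 :* e :* e :* (d :* d) :+ con 4 :* (A :* A)) refl

    totalBad : (Fin q → Bool) → ℕ
    totalBad A = sum (λ x → sum (λ k → 𝟙 (bad A k x)))

    ∑∑-linear : ∀ (f g : Fin q → Fin e → ℕ) s t →
      sum (λ x → sum (λ k → s * f x k + t * g x k)) ≡ s * sum (λ x → sum (f x)) + t * sum (λ x → sum (g x))
    ∑∑-linear f g s t = trans (sum-cong-≗ λ x → trans (∑-distrib-+ (λ k → s * f x k) (λ k → t * g x k))
        (cong₂ _+_ (sym (*-distribˡ-sum s (f x))) (sym (*-distribˡ-sum t (g x)))))
      (trans (∑-distrib-+ (λ x → s * sum (f x)) (λ x → t * sum (g x)))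
        (cong₂ _+_ (sym (*-distribˡ-sum s (λ x → sum (f x)))) (sym (*-distribˡ-sum t (λ x → sum (g x))))))

    -- The main terms cancel: 8 e q α² from the first moment against 4 e² α² h ≤ 4 e q α² and a
    -- further 4 e q α². Of the remaining 12 e² q α, a share 4 comes from the pairs a = b in the
    -- second moment and a share 8 from the point lost at each x in the first.
    moment-arithmetic : ∀ e α h q β S₁ S₂ → e * h ≤ q → 1 ≤ e → q * α ≤ S₁ + q → S₂ ≤ α * (α * h + q) →
      8 * e * α * S₁ + α * α * β ≤ 4 * e * e * S₂ + 4 * (α * α) * (q * e) → α * (α * β) ≤ α * (12 * e * e * q)
    moment-arithmetic e α h q β S₁ S₂ eh≤q 1≤e first second pointwise = +-cancelˡ-≤ (8 * e * α * (q * α)) (α * (α * β)) (α * (12 * e * e * q)) (begin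
      8 * e * α * (q * α) + α * (α * β)
        ≤⟨ +-monoˡ-≤ (α * (α * β)) (*-monoʳ-≤ (8 * e * α) first) ⟩
      8 * e * α * (S₁ + q) + α * (α * β)
        ≡⟨ solve 5 (λ s S q α β → s :* (S :+ q) :+ α :* (α :* β) := s :* S :+ α :* α :* β :+ s :* q) refl (8 * e * α) S₁ q α β ⟩
      8 * e * α * S₁ + α * α * β + 8 * e * α * q
        ≤⟨ +-monoˡ-≤ (8 * e * α * q) pointwise ⟩
      4 * e * e * S₂ + 4 * (α * α) * (q * e) + 8 * e * α * q
        ≤⟨ +-mono-≤ (+-monoˡ-≤ (4 * (α * α) * (q * e)) (*-monoʳ-≤ (4 * e * e) second)) (≤-trans (≤-reflexive (sym (*-identityʳ (8 * e * α * q)))) (*-monoʳ-≤ (8 * e * α * q) 1≤e)) ⟩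
      4 * e * e * (α * (α * h + q)) + 4 * (α * α) * (q * e) + 8 * e * α * q * e
        ≡⟨ eq₁ e α h q ⟩
      4 * e * α * α * (e * h) + (12 * e * e * α * q + 4 * (α * α) * (q * e))
        ≤⟨ +-monoˡ-≤ (12 * e * e * α * q + 4 * (α * α) * (q * e)) (*-monoʳ-≤ (4 * e * α * α) eh≤q) ⟩
      4 * e * α * α * q + (12 * e * e * α * q + 4 * (α * α) * (q * e))
        ≡⟨ eq₂ e α q ⟩
      8 * e * α * (q * α) + α * (12 * e * e * q) ∎)
      where
      open ≤-Reasoning
      open ℕSolver
      eq₁ : ∀ e α h q → 4 * e * e * (α * (α * h + q)) + 4 * (α * α) * (q * e) + 8 * e * α * q * e ≡
        4 * e * α * α * (e * h) + (12 * e * e * α * q + 4 * (α * α) * (q * e))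
      eq₁ = solve 4 (λ e α h q → con 4 :* e :* e :* (α :* (α :* h :+ q)) :+ con 4 :* (α :* α) :* (q :* e) :+ con 8 :* e :* α :* q :* e :=
        con 4 :* e :* α :* α :* (e :* h) :+ (con 12 :* e :* e :* α :* q :+ con 4 :* (α :* α) :* (q :* e))) refl
      eq₂ : ∀ e α q → 4 * e * α * α * q + (12 * e * e * α * q + 4 * (α * α) * (q * e)) ≡ 8 * e * α * (q * α) + α * (12 * e * e * q)
      eq₂ = solve 3 (λ e α q → con 4 :* e :* α :* α :* q :+ (con 12 :* e :* e :* α :* q :+ con 4 :* (α :* α) :* (q :* e)) :=
        con 8 :* e :* α :* (q :* α) :+ α :* (con 12 :* e :* e :* q)) refl

    variance : ∀ A → count A * (count A * totalBad A) ≤ count A * (12 * e * e * q)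
    variance A = moment-arithmetic e α h q (totalBad A) S₁ S₂ eh≤q (>-nonZero⁻¹ e) first (∑degree² A) pointwise
      where
      open ≤-Reasoning
      α = count A
      S₁ = sum (λ x → sum (λ k → degree A k x))
      S₂ = sum (λ x → sum (λ k → degree A k x * degree A k x))
      total : sum {q} (λ _ → sum {e} (λ _ → 1)) ≡ q * e
      total = trans (∑-const q _) (cong (q *_) (trans (∑-const e 1) (*-identityʳ e)))
      first : q * α ≤ S₁ + q
      first = begin
        q * α                                           ≡⟨ sym (∑-const q α) ⟩
        sum {q} (λ _ → α)                               ≤⟨ ∑-mono (∑degree A) ⟩
        sum (λ x → sum (λ k → degree A k x) + 1)        ≡⟨ ∑-distrib-+ (λ x → sum (λ k → degree A k x)) (λ _ → 1) ⟩
        S₁ + sum {q} (λ _ → 1)                          ≡⟨ cong (λ z → S₁ + z) (trans (∑-const q 1) (*-identityʳ q)) ⟩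
        S₁ + q                                          ∎
      pointwise : 8 * e * α * S₁ + α * α * totalBad A ≤ 4 * e * e * S₂ + 4 * (α * α) * (q * e)
      pointwise = begin
        8 * e * α * S₁ + α * α * totalBad A
          ≡⟨ sym (∑∑-linear (λ x k → degree A k x) (λ x k → 𝟙 (bad A k x)) (8 * e * α) (α * α)) ⟩
        sum (λ x → sum (λ k → 8 * e * α * degree A k x + α * α * 𝟙 (bad A k x)))
          ≤⟨ ∑-mono (λ x → ∑-mono λ k → ≤-trans (deviation (degree A k x) α)
               (≤-reflexive (cong (λ z → 4 * e * e * (degree A k x * degree A k x) + z) (sym (*-identityʳ (4 * (α * α))))))) ⟩
        sum (λ x → sum (λ k → 4 * e * e * (degree A k x * degree A k x) + 4 * (α * α) * 1))
          ≡⟨ ∑∑-linear (λ x k → degree A k x * degree A k x) (λ _ _ → 1) (4 * e * e) (4 * (α * α)) ⟩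
        4 * e * e * S₂ + 4 * (α * α) * sum {q} (λ _ → sum {e} (λ _ → 1))
          ≡⟨ cong (λ z → 4 * e * e * S₂ + 4 * (α * α) * z) total ⟩
        4 * e * e * S₂ + 4 * (α * α) * (q * e) ∎

    nonempty : ∀ {D α} → 0 < q → q ≤ D * α → 0 < α
    nonempty {D} {zero}  0<q q≤ = contradiction (≤-trans q≤ (≤-reflexive (*-zeroʳ D))) (<⇒≱ 0<q)
    nonempty {D} {suc α} 0<q q≤ = s≤s z≤n

  -- The total over all colours already satisfies the bound: with α = `count A`, `variance` limits α
  -- times that total to 12 e² q, which is at most 12 e² D α.
  count-bad : ∀ A D → 0 < q → q ≤ D * count A → ∀ k → count (bad A k) ≤ limit e D
  count-bad A D 0<q q≤ k = ≤-trans (∑-mono λ x → ∑-≥ (λ k → 𝟙 (bad A k x)) k)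
    (subst (totalBad A ≤_) (sym (limit-def e D)) (*-cancelˡ-≤ (count A) {{α≢0}} (begin
      count A * totalBad A          ≤⟨ *-cancelˡ-≤ (count A) {{α≢0}} (variance A) ⟩
      12 * e * e * q                ≤⟨ *-monoʳ-≤ (12 * e * e) q≤ ⟩
      12 * e * e * (D * count A)    ≡⟨ solve 3 (λ s D α → s :* (D :* α) := α :* (s :* D)) refl (12 * e * e) D (count A) ⟩
      count A * (12 * e * e * D)    ∎)))
    where
    open ≤-Reasoning
    open ℕSolver
    α≢0 : NonZero (count A)
    α≢0 = >-nonZero (nonempty {D} 0<q q≤)

  -- Union bound: the n sets have at most `n * limit e D` bad places together, fewer than the
  -- elements of A₀. A place that is not bad for A j sees more than a fraction 1 / (2 e) of it in
  -- the required colour.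
  pick : ∀ {n} D (A₀ : Fin q → Bool) (A : Fin n → Fin q → Bool) (k : Fin n → Fin e) →
    D * (n * limit e D) < q → q ≤ D * count A₀ → (∀ j → q ≤ D * count (A j)) →
    ∃ λ x → A₀ x ≡ true × ∀ j → q ≤ D * (2 * e) * count (restrict (A j) (k j) x)
  pick {n} D A₀ A k big q≤₀ q≤ =
    let x , few = ∑-<⇒∃ bads (𝟙 ∘ A₀) few-bad
        x∈A₀ , none = 𝟙-> (A₀ x) (bads x) few
    in x , x∈A₀ , λ j → good j x (≤-trans (∑-≥ (λ j → 𝟙 (bad (A j) (k j) x)) j) none)
    where
    open ≤-Reasoning
    bads : Fin q → ℕ
    bads x = sum (λ j → 𝟙 (bad (A j) (k j) x))
    few-bad : sum bads < count A₀
    few-bad = begin-strict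
      sum bads                                ≡⟨ ∑-comm (λ x j → 𝟙 (bad (A j) (k j) x)) ⟩
      sum (λ j → count (bad (A j) (k j)))     ≤⟨ ∑-mono (λ j → count-bad (A j) D (≤-trans (s≤s z≤n) big) (q≤ j) (k j)) ⟩
      sum {n} (λ _ → limit e D)                 ≡⟨ ∑-const n (limit e D) ⟩
      n * limit e D                             <⟨ *-cancelˡ-< D (n * limit e D) (count A₀) (<-≤-trans big q≤₀) ⟩
      count A₀                                ∎
    𝟙-> : ∀ b c → c < 𝟙 b → b ≡ true × c ≤ 0
    𝟙-> true  c lt = refl , s≤s⁻¹ lt
    good : ∀ j x → 𝟙 (bad (A j) (k j) x) ≤ 0 → q ≤ D * (2 * e) * count (restrict (A j) (k j) x)
    good j x b≤0 with 2 * e * degree (A j) (k j) x ≤? count (A j)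
    ... | no ≰ = ≤-trans (q≤ j) (≤-trans (*-monoʳ-≤ D (<⇒≤ (≰⇒> ≰))) (≤-reflexive (sym (*-assoc D (2 * e) (degree (A j) (k j) x)))))
    good j x () | yes _

  -- Greedy embedding: A j holds the places still allowed for vertex j by the vertices already
  -- placed. Placing one more vertex intersects each remaining set with the prescribed colour class
  -- at that place.
  embed : ∀ n D (A : Fin n → Fin q → Bool) (k : Fin n → Fin n → Fin e) →
    threshold e n D < q → (∀ j → q ≤ D * count (A j)) →
    ∃ λ (x : Fin n → Fin q) → (∀ j → A j (x j) ≡ true) × (∀ i j → i Fin.< j → adjacent (k i j) (x i) (x j) ≡ true)
  embed zero    D A k _ _ = (λ ()) , (λ ()) , (λ ())
  embed (suc n) D A k big q≤ =
    let x₀ , x₀∈A , large = pick D (A zero) (A ∘ suc) (k zero ∘ suc) (≤-<-trans (m≤m+n _ _) big) (q≤ zero) (q≤ ∘ suc)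
        x , x∈A , edges = embed n (D * (2 * e)) (λ j → restrict (A (suc j)) (k zero (suc j)) x₀) (λ i j → k (suc i) (suc j))
          (≤-<-trans (m≤n+m _ _) big) large
    in (λ { zero → x₀ ; (suc j) → x j })
     , (λ { zero → x₀∈A ; (suc j) → proj₁ (∧-true _ _ (x∈A j)) })
     , λ { zero (suc j) _ → proj₂ (∧-true (A (suc j) (x j)) _ (x∈A j))
         ; (suc i) (suc j) (s≤s i<j) → edges i j i<j }

  adjacent⇒ : ∀ {k x a} → adjacent k x a ≡ true → x ≢ a × colour x a ≡ k
  adjacent⇒ {k} {x} {a} adj =
    let x≢a , same-colour = ∧-true (not ⌊ x Fin.≟ a ⌋) ⌊ colour x a Fin.≟ k ⌋ adj
    in not-⌊⌋ (x Fin.≟ a) x≢a , ⌊⌋-true (colour x a Fin.≟ k) same-colour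

  abstract
    embed-all : ∀ n (k : Fin n → Fin n → Fin e) → threshold e n 1 < q →
      ∃ λ (x : Fin n → Fin q) → ∀ i j → i Fin.< j → x i ≢ x j × colour (x i) (x j) ≡ k i j
    embed-all n k big =
      let x , _ , edges = embed n 1 (λ _ _ → true) k big λ _ → ≤-reflexive (sym
            (trans (+-identityʳ _) (trans (∑-const q 1) (*-identityʳ q))))
      in x , λ i j i<j → adjacent⇒ (edges i j i<j)

-- Maximum average degree

fraction-≤ : ∀ {a b c d} .{{_ : NonZero b}} .{{_ : NonZero d}} → a * d ≤ c * b → + a / b ℚ.≤ + c / d
fraction-≤ {a} {suc b} {c} {suc d} ad≤cb = ℚ.toℚᵘ-cancel-≤
  (ℚᵘ.≤-respˡ-≃ (ℚᵘ.≃-sym (ℚ.toℚᵘ-fromℚᵘ (mkℚᵘ (+ a) b)))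
    (ℚᵘ.≤-respʳ-≃ (ℚᵘ.≃-sym (ℚ.toℚᵘ-fromℚᵘ (mkℚᵘ (+ c) d)))
      (*≤* (subst₂ ℤ._≤_ (ℤ.pos-* a (suc d)) (ℤ.pos-* c (suc b)) (ℤ.+≤+ ad≤cb)))))

fraction-≡ : ∀ {a b c d} .{{_ : NonZero b}} .{{_ : NonZero d}} → a * d ≡ c * b → + a / b ≡ + c / d
fraction-≡ {a} {suc b} {c} {suc d} ad≡cb = ℚ.fromℚᵘ-cong {mkℚᵘ (+ a) b} {mkℚᵘ (+ c) d}
  (*≡* (trans (sym (ℤ.pos-* a (suc d))) (trans (cong +_ ad≡cb) (ℤ.pos-* c (suc b)))))

fraction-+ : ∀ a b d .{{_ : NonZero d}} → + a / d ℚ.+ + b / d ≡ + (a + b) / d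
fraction-+ a b (suc d) = ℚ.toℚᵘ-injective (ℚᵘ.≃-trans (ℚ.toℚᵘ-homo-+ (+ a / suc d) (+ b / suc d))
  (ℚᵘ.≃-trans (ℚᵘ.+-cong (ℚ.toℚᵘ-fromℚᵘ (mkℚᵘ (+ a) d)) (ℚ.toℚᵘ-fromℚᵘ (mkℚᵘ (+ b) d)))
    (ℚᵘ.≃-trans sum≃ (ℚᵘ.≃-sym (ℚ.toℚᵘ-fromℚᵘ (mkℚᵘ (+ (a + b)) d))))))
  where
  D = suc d
  numerator : + a ℤ.* + D ℤ.+ + b ℤ.* + D ≡ + (a * D + b * D)
  numerator = cong₂ ℤ._+_ (sym (ℤ.pos-* a D)) (sym (ℤ.pos-* b D))
  sum≃ : mkℚᵘ (+ a) d ℚᵘ.+ mkℚᵘ (+ b) d ℚᵘ.≃ mkℚᵘ (+ (a + b)) d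
  sum≃ = *≡* (trans (cong (ℤ._* + D) numerator) (trans (sym (ℤ.pos-* (a * D + b * D) D))
    (trans (cong +_ (solve 3 (λ a b D → (a :* D :+ b :* D) :* D := (a :+ b) :* (D :* D)) refl a b D)) (ℤ.pos-* (a + b) (D * D)))))
    where open ℕSolver

sumℚ-mono : ∀ {k} {f g : Fin k → ℚ} → (∀ a → f a ℚ.≤ g a) → sumℚ f ℚ.≤ sumℚ g
sumℚ-mono {k} {f} {g} f≤g = over (allFin k)
  where
  over : ∀ as → foldr (λ a s → f a ℚ.+ s) 0ℚ as ℚ.≤ foldr (λ a s → g a ℚ.+ s) 0ℚ as
  over []       = ℚ.≤-refl
  over (a ∷ as) = ℚ.+-mono-≤ (f≤g a) (over as)

List-sum : ∀ {n} (f : Fin n → ℕ) → List.sum (map f (allFin n)) ≡ sum f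
List-sum {n} f = trans (cong List.sum (map-tabulate (λ i → i) f)) (sum-tabulate f)
  where
  sum-tabulate : ∀ {n} (f : Fin n → ℕ) → List.sum (tabulate f) ≡ sum f
  sum-tabulate {zero}  f = refl
  sum-tabulate {suc n} f = cong (λ z → f zero + z) (sum-tabulate (f ∘ suc))

sumℚ-fraction : ∀ {k} d .{{_ : NonZero d}} (f : Fin k → ℕ) → sumℚ (λ a → + f a / d) ≡ + sum f / d
sumℚ-fraction {k} d f = trans (over (allFin k)) (cong (λ s → + s / d) (List-sum f))
  where
  over : ∀ as → foldr (λ a s → + f a / d ℚ.+ s) 0ℚ as ≡ + List.sum (map f as) / d
  over []       = fraction-≡ {0} {1} {0} {d} refl
  over (a ∷ as) = trans (cong (+ f a / d ℚ.+_) (over as)) (fraction-+ (f a) (List.sum (map f as)) d)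

module _ {n : ℕ} where

  edge : Graph n → Fin n → Fin n → ℕ
  edge G i j = 𝟙 (ltᵇ i j ∧ G i j)

  countEdges-∑ : (G : Graph n) → countEdges G ≡ sum (λ i → sum (λ j → edge G i j))
  countEdges-∑ G = trans (List-sum {n} _) (sum-cong-≗ λ i → trans (List-sum {n} _) (sum-cong-≗ λ j → if-𝟙 (ltᵇ i j ∧ G i j)))
    where
    if-𝟙 : ∀ b → (if b then 1 else 0) ≡ 𝟙 b
    if-𝟙 true  = refl
    if-𝟙 false = refl

  edge-< : (G : Graph n) → ∀ {i j} → i Fin.< j → edge G i j ≡ 𝟙 (G i j)
  edge-< G {i} {j} i<j = cong (λ b → 𝟙 (b ∧ G i j)) (true-⌊⌋ (toℕ i <? toℕ j) i<j)

  edge-≮ : (G : Graph n) → ∀ {i j} → ¬ i Fin.< j → edge G i j ≡ 0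
  edge-≮ G {i} {j} i≮j with toℕ i <? toℕ j
  ... | yes i<j = contradiction i<j i≮j
  ... | no _    = refl

  edge-mono : (G H : Graph n) → (∀ i j → i Fin.< j → G i j ≡ true → H i j ≡ true) → ∀ i j → edge G i j ≤ edge H i j
  edge-mono G H G⇒H i j with toℕ i <? toℕ j
  ... | no _ = z≤n
  ... | yes i<j with G i j in eq
  ...   | false = z≤n
  ...   | true rewrite G⇒H i j i<j eq = ≤-refl

  countEdges-mono : (G H : Graph n) → (∀ i j → i Fin.< j → G i j ≡ true → H i j ≡ true) → countEdges G ≤ countEdges H
  countEdges-mono G H G⇒H = subst₂ _≤_ (sym (countEdges-∑ G)) (sym (countEdges-∑ H))
    (∑-mono λ i → ∑-mono λ j → edge-mono G H G⇒H i j)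

  countEdges-parts : ∀ {k} (c : Decomposition n k) → sum (λ a → countEdges (part c a)) ≡ countEdges {n} (λ _ _ → true)
  countEdges-parts {k} c = begin
    sum (λ a → countEdges (part c a))                        ≡⟨ sum-cong-≗ (λ a → countEdges-∑ (part c a)) ⟩
    sum (λ a → sum (λ i → sum (λ j → edge (part c a) i j)))  ≡⟨ ∑-comm (λ a i → sum (λ j → edge (part c a) i j)) ⟩
    sum (λ i → sum (λ a → sum (λ j → edge (part c a) i j)))  ≡⟨ sum-cong-≗ (λ i → ∑-comm (λ a j → edge (part c a) i j)) ⟩
    sum (λ i → sum (λ j → sum (λ a → edge (part c a) i j)))  ≡⟨ sum-cong-≗ (λ i → sum-cong-≗ λ j → at i j) ⟩
    sum (λ i → sum (λ j → edge (λ _ _ → true) i j))          ≡⟨ sym (countEdges-∑ (λ _ _ → true)) ⟩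
    countEdges {n} (λ _ _ → true)                            ∎
    where
    open ≡-Reasoning
    at : ∀ i j → sum (λ a → edge (part c a) i j) ≡ edge (λ _ _ → true) i j
    at i j with ltᵇ i j
    ... | false = ∑-zero {k} λ _ → refl
    ... | true  = ∑-δ1 (c i j)

  clique : (Fin n → Bool) → Graph n
  clique P i j = P i ∧ P j

  -- Ordered pairs from P split into i < j, j < i and i = j. The form avoids subtraction and
  -- halving.
  countEdges-clique : (P : Fin n → Bool) → 2 * countEdges (clique P) + count P ≡ count P * count P
  countEdges-clique P = sym (begin
    count P * count P                                                       ≡⟨ ∑∑-* (𝟙 ∘ P) (𝟙 ∘ P) ⟩
    sum (λ i → sum (λ j → 𝟙 (P i) * 𝟙 (P j)))                               ≡⟨ sum-cong-≗ (λ i → sum-cong-≗ λ j → split i j) ⟩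
    sum (λ i → sum (λ j → up i j + down i j + diagonal i j))                ≡⟨ sum-cong-≗ (λ i → trans (∑-distrib-+ (λ j → up i j + down i j) (diagonal i)) (cong (_+ sum (diagonal i)) (∑-distrib-+ (up i) (down i)))) ⟩
    sum (λ i → sum (up i) + sum (down i) + sum (diagonal i))                ≡⟨ trans (∑-distrib-+ (λ i → sum (up i) + sum (down i)) (λ i → sum (diagonal i))) (cong (_+ sum (λ i → sum (diagonal i))) (∑-distrib-+ (λ i → sum (up i)) (λ i → sum (down i)))) ⟩
    sum (λ i → sum (up i)) + sum (λ i → sum (down i)) + sum (λ i → sum (diagonal i))
      ≡⟨ cong₂ (λ u v → sum (λ i → sum (up i)) + u + v) (∑-comm down) (sum-cong-≗ λ i → ∑-δ i (λ _ → 𝟙 (P i))) ⟩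
    sum (λ i → sum (up i)) + sum (λ i → sum (up i)) + count P               ≡⟨ cong (λ s → s + s + count P) (sym (countEdges-∑ (clique P))) ⟩
    countEdges (clique P) + countEdges (clique P) + count P                 ≡⟨ cong (λ z → countEdges (clique P) + z + count P) (sym (+-identityʳ _)) ⟩
    2 * countEdges (clique P) + count P                                     ∎)
    where
    open ≡-Reasoning
    up down diagonal : Fin n → Fin n → ℕ
    up i j = edge (clique P) i j
    down i j = up j i
    diagonal i j = δ i j * 𝟙 (P i)
    split : ∀ i j → 𝟙 (P i) * 𝟙 (P j) ≡ up i j + down i j + diagonal i j
    split i j with Finₚ.<-cmp i j
    ... | tri< i<j i≢j j≮i = begin
      𝟙 (P i) * 𝟙 (P j)                    ≡⟨ sym (𝟙-∧ (P i) (P j)) ⟩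
      𝟙 (clique P i j)                     ≡⟨ trans (sym (+-identityʳ _)) (sym (+-identityʳ _)) ⟩
      𝟙 (clique P i j) + 0 + 0             ≡⟨ sym (cong₂ _+_ (cong₂ _+_ (edge-< (clique P) i<j) (edge-≮ (clique P) j≮i)) (cong (_* 𝟙 (P i)) (δ-≢ i≢j))) ⟩
      up i j + down i j + diagonal i j     ∎
    ... | tri> i≮j i≢j j<i = begin
      𝟙 (P i) * 𝟙 (P j)                    ≡⟨ trans (*-comm (𝟙 (P i)) (𝟙 (P j))) (sym (𝟙-∧ (P j) (P i))) ⟩
      𝟙 (clique P j i)                     ≡⟨ sym (+-identityʳ _) ⟩
      0 + 𝟙 (clique P j i) + 0             ≡⟨ sym (cong₂ _+_ (cong₂ _+_ (edge-≮ (clique P) i≮j) (edge-< (clique P) j<i)) (cong (_* 𝟙 (P i)) (δ-≢ i≢j))) ⟩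
      up i j + down i j + diagonal i j     ∎
    ... | tri≈ i≮i refl _ = begin
      𝟙 (P i) * 𝟙 (P i)                    ≡⟨ 𝟙-idem (P i) ⟩
      0 + 0 + 1 * 𝟙 (P i)                  ≡⟨ sym (cong₂ _+_ (cong₂ _+_ (edge-≮ (clique P) i≮i) (edge-≮ (clique P) i≮i)) (cong (_* 𝟙 (P i)) (δ-refl i))) ⟩
      up i i + down i i + diagonal i i     ∎
      where
      𝟙-idem : ∀ b → 𝟙 b * 𝟙 b ≡ 1 * 𝟙 b
      𝟙-idem true  = refl
      𝟙-idem false = refl

∣∣-count : ∀ {n} (T : Subset n) → Subset.∣ T ∣ ≡ count (Vec.lookup T)
∣∣-count []          = refl
∣∣-count (true ∷ T)  = cong suc (∣∣-count T)
∣∣-count (false ∷ T) = ∣∣-count T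

∈⇒lookup : ∀ {n} {i : Fin n} {T} → i ∈ T → Vec.lookup T i ≡ true
∈⇒lookup = Vec.[]=⇒lookup

lookup⇒∈ : ∀ {n} {i : Fin n} {T} → Vec.lookup T i ≡ true → i ∈ T
lookup⇒∈ {i = i} {T} = Vec.lookup⇒[]= i T

2*nC2 : ∀ n → 2 * (n C 2) + n ≡ n * n
2*nC2 zero    = refl
2*nC2 (suc n) = begin
  2 * (suc n C 2) + suc n              ≡⟨ cong (λ z → 2 * z + suc n) (trans (sym (nCk+nC[k+1]≡[n+1]C[k+1] n 1)) (cong (_+ n C 2) (nC1≡n n))) ⟩
  2 * (n + n C 2) + suc n              ≡⟨ solve 2 (λ n c → con 2 :* (n :+ c) :+ (con 1 :+ n) := con 2 :* c :+ n :+ (con 2 :* n :+ con 1)) refl n (n C 2) ⟩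
  2 * (n C 2) + n + (2 * n + 1)        ≡⟨ cong (_+ (2 * n + 1)) (2*nC2 n) ⟩
  n * n + (2 * n + 1)                  ≡⟨ solve 1 (λ n → n :* n :+ (con 2 :* n :+ con 1) := (con 1 :+ n) :* (con 1 :+ n)) refl n ⟩
  suc n * suc n                        ∎
  where
  open ≡-Reasoning
  open ℕSolver

C2-unique : ∀ {e n} → 2 * e + n ≡ n * n → e ≡ n C 2
C2-unique {e} {n} eq = *-cancelˡ-≡ e (n C 2) 2 (+-cancelʳ-≡ n _ _ (trans eq (sym (2*nC2 n))))

countEdges-complete : ∀ n → countEdges {n} (λ _ _ → true) ≡ n C 2
countEdges-complete n = C2-unique (subst (λ t → 2 * countEdges {n} (λ _ _ → true) + t ≡ t * t)
  (trans (∑-const n 1) (*-identityʳ n)) (countEdges-clique {n} (λ _ → true)))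

-- A product with odd sum is largest for consecutive factors; for a ≤ s the deficit is y (y + 1)
-- with y = s - a.
consecutive-product : ∀ a b s → a + b ≡ s + suc s → a * b ≤ s * suc s
consecutive-product a b s a+b≡ = [ small a b a+b≡ , (λ s<a → subst (_≤ s * suc s) (*-comm b a)
    (small b a (trans (+-comm b a) a+b≡) (b≤s s<a))) ]′ (≤-<-connex a s)
  where
  open ℕSolver
  b≤s : s < a → b ≤ s
  b≤s s<a = +-cancelʳ-≤ (suc s) b s (≤-trans (+-monoʳ-≤ b s<a) (≤-reflexive (trans (+-comm b a) a+b≡)))
  id₁ : ∀ a y → (y + a) + suc (y + a) ≡ a + (a + 2 * y + 1)
  id₁ = solve 2 (λ a y → (y :+ a) :+ (con 1 :+ (y :+ a)) := a :+ (a :+ con 2 :* y :+ con 1)) refl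
  id₂ : ∀ a y → (y + a) * suc (y + a) ≡ a * (a + 2 * y + 1) + (y * y + y)
  id₂ = solve 2 (λ a y → (y :+ a) :* (con 1 :+ (y :+ a)) := a :* (a :+ con 2 :* y :+ con 1) :+ (y :* y :+ y)) refl
  small : ∀ a b → a + b ≡ s + suc s → a ≤ s → a * b ≤ s * suc s
  small a b a+b≡ a≤s = ≤-trans (≤-reflexive (cong (a *_) b≡))
    (≤-trans (m≤m+n _ (y * y + y)) (≤-reflexive (trans (sym (id₂ a y)) (cong (λ z → z * suc z) y+a≡s))))
    where
    y = s ∸ a
    y+a≡s : y + a ≡ s
    y+a≡s = m∸n+n≡m a≤s
    b≡ : b ≡ a + 2 * y + 1
    b≡ = +-cancelˡ-≡ a _ _ (trans a+b≡ (trans (cong (λ z → z + suc z) (sym y+a≡s)) (id₁ a y)))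

-- The line through the points (s (s+1) / 2, s) and ((s+1) (s+2) / 2, s+1) lies above every (E, 2E/h).
density-arithmetic : ∀ s h E G → 1 ≤ h → E ≤ G → 2 * E + h ≤ h * h →
  2 * E * (2 * suc s) ≤ (suc s * s + 2 * G) * h
density-arithmetic s (suc h) E G _ E≤G 2E+h≤ = [ sparse , dense ]′ (≤-<-connex (2 * suc s) (suc h))
  where
  open ≤-Reasoning
  open ℕSolver
  -- With this many vertices, 2 E over the vertex number is already at most 2 G / (2 (s + 1)).
  sparse : 2 * suc s ≤ suc h → 2 * E * (2 * suc s) ≤ (suc s * s + 2 * G) * suc h
  sparse le = *-mono-≤ (≤-trans (*-monoʳ-≤ 2 E≤G) (m≤n+m (2 * G) (suc s * s))) le
  2E≤ : 2 * E ≤ suc h * h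
  2E≤ = +-cancelʳ-≤ (suc h) _ _ (≤-trans 2E+h≤ (≤-reflexive (solve 1 (λ h → (con 1 :+ h) :* (con 1 :+ h) := (con 1 :+ h) :* h :+ (con 1 :+ h)) refl h)))
  -- Split 2 (s + 1) = z + (h + 1). The z part uses 2 E ≤ (h + 1) h and the other part E ≤ G. As h +
  -- z = 2 s + 1, the product h z is at most s (s + 1).
  dense : suc h < 2 * suc s → 2 * E * (2 * suc s) ≤ (suc s * s + 2 * G) * suc h
  dense lt = begin
    2 * E * (2 * suc s)                         ≡⟨ cong (2 * E *_) (sym z+h≡) ⟩
    2 * E * (z + suc h)                         ≡⟨ *-distribˡ-+ (2 * E) z (suc h) ⟩
    2 * E * z + 2 * E * suc h                   ≤⟨ +-mono-≤ (*-monoˡ-≤ z 2E≤) (*-monoˡ-≤ (suc h) (*-monoʳ-≤ 2 E≤G)) ⟩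
    suc h * h * z + 2 * G * suc h               ≡⟨ cong (_+ 2 * G * suc h) (*-assoc (suc h) h z) ⟩
    suc h * (h * z) + 2 * G * suc h             ≤⟨ +-monoˡ-≤ _ (*-monoʳ-≤ (suc h) (consecutive-product h z s h+z≡)) ⟩
    suc h * (s * suc s) + 2 * G * suc h         ≡⟨ solve 3 (λ h s G → h :* (s :* (con 1 :+ s)) :+ con 2 :* G :* h := ((con 1 :+ s) :* s :+ con 2 :* G) :* h) refl (suc h) s G ⟩
    (suc s * s + 2 * G) * suc h                 ∎
    where
    z = 2 * suc s ∸ suc h
    z+h≡ : z + suc h ≡ 2 * suc s
    z+h≡ = m∸n+n≡m (<⇒≤ lt)
    h+z≡ : h + z ≡ s + suc s
    h+z≡ = suc-injective (trans (solve 2 (λ h z → con 1 :+ (h :+ z) := z :+ (con 1 :+ h)) refl h z)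
      (trans z+h≡ (solve 1 (λ s → con 2 :* (con 1 :+ s) := con 1 :+ (s :+ (con 1 :+ s))) refl s)))

-- The two cliques are the two points through which the line was drawn, so equality holds.
clique-arithmetic : ∀ s t E → t ≡ suc s ⊎ t ≡ suc (suc s) → 2 * E + t ≡ t * t →
  (suc s * s + 2 * E) * t ≤ 2 * E * (2 * suc s)
clique-arithmetic s t E t≡ 2E+t≡ = ≤-reflexive ([ small , large ]′ t≡)
  where
  open ℕSolver
  small : t ≡ suc s → (suc s * s + 2 * E) * t ≡ 2 * E * (2 * suc s)
  small refl rewrite +-cancelʳ-≡ (suc s) (2 * E) (suc s * s)
      (trans 2E+t≡ (solve 1 (λ s → (con 1 :+ s) :* (con 1 :+ s) := (con 1 :+ s) :* s :+ (con 1 :+ s)) refl s)) =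
    solve 1 (λ s → ((con 1 :+ s) :* s :+ (con 1 :+ s) :* s) :* (con 1 :+ s) := (con 1 :+ s) :* s :* (con 2 :* (con 1 :+ s))) refl s
  large : t ≡ suc (suc s) → (suc s * s + 2 * E) * t ≡ 2 * E * (2 * suc s)
  large refl rewrite +-cancelʳ-≡ (suc (suc s)) (2 * E) (suc (suc s) * suc s)
      (trans 2E+t≡ (solve 1 (λ s → (con 2 :+ s) :* (con 2 :+ s) := (con 2 :+ s) :* (con 1 :+ s) :+ (con 2 :+ s)) refl s)) =
    solve 1 (λ s → ((con 1 :+ s) :* s :+ (con 2 :+ s) :* (con 1 :+ s)) :* (con 2 :+ s) := (con 2 :+ s) :* (con 1 :+ s) :* (con 2 :* (con 1 :+ s))) refl s

-- Value at countEdges G of the line of density-arithmetic, for p = s + 1.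
tangent : ∀ {n} → ℕ → Graph n → ℚ
tangent s G = + (suc s * s + 2 * countEdges G) / (2 * suc s)

density-≤-tangent : ∀ {n} s {G : Graph n} (H : Subgraph G) → density H ℚ.≤ tangent s G
density-≤-tangent {n} s {G} H = bound Subset.∣ V ∣ nonempty simple
  where
  open Subgraph H
  simple : 2 * countEdges E + Subset.∣ V ∣ ≤ Subset.∣ V ∣ * Subset.∣ V ∣
  simple rewrite ∣∣-count V = ≤-trans
    (+-monoˡ-≤ (count (Vec.lookup V)) (*-monoʳ-≤ 2 (countEdges-mono E (clique (Vec.lookup V)) λ i j i<j Eij →
      let _ , i∈V , j∈V = sub i j i<j Eij in cong₂ _∧_ (∈⇒lookup i∈V) (∈⇒lookup j∈V))))
    (≤-reflexive (countEdges-clique (Vec.lookup V)))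
  bound : ∀ h → 1 ≤ h → 2 * countEdges E + h ≤ h * h → ratio (2 * countEdges E) h ℚ.≤ tangent s G
  bound (suc h) 1≤h le = fraction-≤ {2 * countEdges E} {suc h} {suc s * s + 2 * countEdges G} {2 * suc s}
    (density-arithmetic s (suc h) (countEdges E) (countEdges G) 1≤h
      (countEdges-mono E G λ i j i<j Eij → proj₁ (sub i j i<j Eij)) le)

-- Linearity in the number of edges makes the sum of the bounds independent of c, so all
-- decompositions with the same n and k share it.
sumℚ-tangent : ∀ {n k} s (c : Decomposition n k) →
  sumℚ (λ a → tangent s (part c a)) ≡ + (k * (suc s * s) + 2 * (n C 2)) / (2 * suc s)
sumℚ-tangent {n} {k} s c = trans (sumℚ-fraction (2 * suc s) (λ a → suc s * s + 2 * countEdges (part c a)))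
  (cong (λ z → + z / (2 * suc s)) (begin
    sum (λ a → suc s * s + 2 * countEdges (part c a))              ≡⟨ ∑-distrib-+ (λ _ → suc s * s) (λ a → 2 * countEdges (part c a)) ⟩
    sum {k} (λ _ → suc s * s) + sum (λ a → 2 * countEdges (part c a))  ≡⟨ cong₂ _+_ (∑-const k (suc s * s)) (sym (*-distribˡ-sum 2 (λ a → countEdges (part c a)))) ⟩
    k * (suc s * s) + 2 * sum (λ a → countEdges (part c a))        ≡⟨ cong (λ z → k * (suc s * s) + 2 * z) (trans (countEdges-parts c) (countEdges-complete n)) ⟩
    k * (suc s * s) + 2 * (n C 2)                                  ∎))
  where open ≡-Reasoning

module _ {n k : ℕ} (c : Decomposition n k) (a : Fin k) (T : Subset n)
  (block : ∀ i j → i Fin.< j → c i j ≡ a → i ∈ T × j ∈ T) (block⁻ : ∀ i j → i Fin.< j → i ∈ T × j ∈ T → c i j ≡ a) where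

  private
    P : Fin n → Bool
    P = Vec.lookup T

    clique⇒part : ∀ i j → i Fin.< j → clique P i j ≡ true → part c a i j ≡ true
    clique⇒part i j i<j Pij = let Pi , Pj = ∧-true (P i) (P j) Pij in
      true-⌊⌋ (c i j Fin.≟ a) (block⁻ i j i<j (lookup⇒∈ Pi , lookup⇒∈ Pj))

    part⇒clique : ∀ i j → i Fin.< j → part c a i j ≡ true → clique P i j ≡ true
    part⇒clique i j i<j e = let i∈T , j∈T = block i j i<j (⌊⌋-true (c i j Fin.≟ a) e) in
      cong₂ _∧_ (∈⇒lookup i∈T) (∈⇒lookup j∈T)

    countEdges-≡ : countEdges (part c a) ≡ countEdges (clique P)
    countEdges-≡ = ≤-antisym (countEdges-mono (part c a) (clique P) part⇒clique)
                             (countEdges-mono (clique P) (part c a) clique⇒part)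

    doubled : 2 * countEdges (clique P) + Subset.∣ T ∣ ≡ Subset.∣ T ∣ * Subset.∣ T ∣
    doubled rewrite ∣∣-count T = countEdges-clique P

  countEdges-part : countEdges (part c a) ≡ Subset.∣ T ∣ C 2
  countEdges-part = trans countEdges-≡ (C2-unique doubled)

  tangent-≤-density : ∀ s → Subset.∣ T ∣ ≡ suc s ⊎ Subset.∣ T ∣ ≡ suc (suc s) →
    Σ (Subgraph (part c a)) λ H → tangent s (part c a) ℚ.≤ density H
  tangent-≤-density s size = H , bound Subset.∣ T ∣ 1≤T (clique-arithmetic s Subset.∣ T ∣ (countEdges (clique P)) size doubled)
    where
    1≤T : 1 ≤ Subset.∣ T ∣
    1≤T = [ (λ eq → ≤-trans (s≤s z≤n) (≤-reflexive (sym eq))) , (λ eq → ≤-trans (s≤s z≤n) (≤-reflexive (sym eq))) ]′ size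
    H : Subgraph (part c a)
    H = record
      { V = T ; E = clique P ; nonempty = 1≤T
      ; sub = λ i j i<j Pij → clique⇒part i j i<j Pij ,
          lookup⇒∈ (proj₁ (∧-true (P i) (P j) Pij)) , lookup⇒∈ (proj₂ (∧-true (P i) (P j) Pij)) }
    bound : ∀ t → 1 ≤ t → (suc s * s + 2 * countEdges (clique P)) * t ≤ 2 * countEdges (clique P) * (2 * suc s) →
      tangent s (part c a) ℚ.≤ ratio (2 * countEdges (clique P)) t
    bound (suc t) _ le = subst (λ z → + (suc s * s + 2 * z) / (2 * suc s) ℚ.≤ + (2 * countEdges (clique P)) / suc t)
      (sym countEdges-≡) (fraction-≤ {suc s * s + 2 * countEdges (clique P)} {2 * suc s} {2 * countEdges (clique P)} {suc t} le)

-- Each q a is the density of some subgraph, hence at most its tangent value. Each m a is at least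
-- the density of its own clique, which reaches the tangent value. The two sums of tangent values
-- agree.
cliqueParts⇒attainsM : ∀ {n k} s (c : Decomposition n k) → CliqueParts (suc s) c → AttainsM c
cliqueParts⇒attainsM {n} {k} s c cliques m m-mad c′ q q-mad = begin
  sumℚ q                                   ≤⟨ sumℚ-mono (λ a → upper a) ⟩
  sumℚ (λ a → tangent s (part c′ a))       ≡⟨ trans (sumℚ-tangent s c′) (sym (sumℚ-tangent s c)) ⟩
  sumℚ (λ a → tangent s (part c a))        ≤⟨ sumℚ-mono (λ a → lower a) ⟩
  sumℚ m                                   ∎
  where
  open ℚ.≤-Reasoning
  upper : ∀ a → q a ℚ.≤ tangent s (part c′ a)
  upper a = let (H , eq) , _ = q-mad a in subst (ℚ._≤ tangent s (part c′ a)) eq (density-≤-tangent s H)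
  lower : ∀ a → tangent s (part c a) ℚ.≤ m a
  lower a = let T , size , iff = cliques a
                H , le = tangent-≤-density c a T (λ i j i<j → Equivalence.to (iff i j i<j)) (λ i j i<j → Equivalence.from (iff i j i<j)) s size
            in ℚ.≤-trans le (proj₂ (m-mad a) H)

-- Cyclotomic designs

-- Offsets of consecutive segments of lengths f 0, f 1, ..., so that `prefix f j + i` numbers place
-- i of segment j. It is used at two levels: for the cliques of the family, and for the edges of one
-- clique grouped by larger endpoint.
prefix : (ℕ → ℕ) → ℕ → ℕ
prefix f zero    = 0
prefix f (suc n) = prefix f n + f n

prefix-mono : ∀ f {m n} → m ≤ n → prefix f m ≤ prefix f n
prefix-mono f {n = zero}  z≤n = z≤n
prefix-mono f {m} {suc n} m≤1+n with m≤n⇒m<n∨m≡n m≤1+n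
... | inj₁ m<1+n = ≤-trans (prefix-mono f (s≤s⁻¹ m<1+n)) (m≤m+n _ _)
... | inj₂ refl  = ≤-refl

prefix-< : ∀ f {j n i} → j < n → i < f j → prefix f j + i < prefix f n
prefix-< f {j} j<n i<fj = <-≤-trans (+-monoʳ-< (prefix f j) i<fj) (prefix-mono f j<n)

prefix-decode : ∀ f n {s} → s < prefix f n → ∃ λ j → ∃ λ i → j < n × i < f j × s ≡ prefix f j + i
prefix-decode f (suc n) {s} s< with s <? prefix f n
... | yes lt with j , i , j<n , i<fj , eq ← prefix-decode f n lt = j , i , m<n⇒m<1+n j<n , i<fj , eq
... | no ≮ = n , s ∸ prefix f n , n<1+n n ,
  +-cancelˡ-< (prefix f n) _ _ (≤-<-trans (≤-reflexive (m+[n∸m]≡n (≮⇒≥ ≮))) s<) , sym (m+[n∸m]≡n (≮⇒≥ ≮))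

prefix-unique : ∀ f {j j′ i i′} → i < f j → i′ < f j′ → prefix f j + i ≡ prefix f j′ + i′ → j ≡ j′ × i ≡ i′
prefix-unique f {j} {j′} {i} {i′} i< i′< eq with <-cmp j j′
... | tri< j<j′ _ _ = contradiction eq (<⇒≢ (<-≤-trans (prefix-< f j<j′ i<) (m≤m+n _ i′)))
... | tri> _ _ j′<j = contradiction (sym eq) (<⇒≢ (<-≤-trans (prefix-< f j′<j i′<) (m≤m+n _ i)))
... | tri≈ _ refl _ = refl , +-cancelˡ-≡ (prefix f j) i i′ eq

prefix-∑ : ∀ f n → sum {n} (λ i → f (toℕ i)) ≡ prefix f n
prefix-∑ f zero    = refl
prefix-∑ f (suc n) = trans (cong (λ z → f 0 + z) (prefix-∑ (f ∘ suc) n)) (sym (prefix-suc f n))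
  where
  prefix-suc : ∀ f n → prefix f (suc n) ≡ f 0 + prefix (f ∘ suc) n
  prefix-suc f zero    = sym (+-identityʳ (f 0))
  prefix-suc f (suc n) = trans (cong (_+ f (suc n)) (prefix-suc f n)) (+-assoc (f 0) _ _)

triangle : ℕ → ℕ
triangle = prefix (λ j → j)

triangle≡C2 : ∀ n → triangle n ≡ n C 2
triangle≡C2 n = C2-unique (doubled n)
  where
  open ℕSolver
  doubled : ∀ n → 2 * triangle n + n ≡ n * n
  doubled zero    = refl
  doubled (suc n) = trans (solve 2 (λ t n → con 2 :* (t :+ n) :+ (con 1 :+ n) := con 2 :* t :+ n :+ (con 2 :* n :+ con 1)) refl (triangle n) n)
    (trans (cong (_+ (2 * n + 1)) (doubled n)) (solve 1 (λ n → n :* n :+ (con 2 :* n :+ con 1) := (con 1 :+ n) :* (con 1 :+ n)) refl n))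

-- A pairwise balanced design of index one: any two points lie in exactly one block. Treating pairs
-- symmetrically suits the cyclotomic construction, where the ordering of `Fin q` means nothing.
record LinearSpace (n k : ℕ) : Set where
  field
    block  : Fin k → Subset n
    cover  : ∀ {u v} → u ≢ v → ∃ λ a → u ∈ block a × v ∈ block a
    unique : ∀ {a b u v} → u ≢ v → u ∈ block a → v ∈ block a → u ∈ block b → v ∈ block b → a ≡ b

module _ {n k : ℕ} (L : LinearSpace n k) (a₀ : Fin k) where
  open LinearSpace L

  decomposition : Decomposition n k
  decomposition u v with u Fin.≟ v
  ... | yes _  = a₀
  ... | no u≢v = proj₁ (cover u≢v)

  private
    to : ∀ {a} i j → i Fin.< j → decomposition i j ≡ a → i ∈ block a × j ∈ block a
    to i j i<j eq with i Fin.≟ j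
    ... | yes i≡j = contradiction i≡j (Finₚ.<⇒≢ i<j)
    ... | no i≢j  = subst (λ a → i ∈ block a × j ∈ block a) eq (proj₂ (cover i≢j))

    from : ∀ {a} i j → i Fin.< j → i ∈ block a × j ∈ block a → decomposition i j ≡ a
    from i j i<j (i∈ , j∈) with i Fin.≟ j
    ... | yes i≡j = contradiction i≡j (Finₚ.<⇒≢ i<j)
    ... | no i≢j  = let _ , i∈′ , j∈′ = cover i≢j in unique i≢j i∈′ j∈′ i∈ j∈

  cliqueParts : ∀ p → (∀ a → Subset.∣ block a ∣ ≡ p ⊎ Subset.∣ block a ∣ ≡ suc p) → CliqueParts p decomposition
  cliqueParts p sizes a = block a , sizes a , λ i j i<j → mk⇔ (to i j i<j) (from i j i<j)

  block-sizes : sum (λ a → Subset.∣ block a ∣ C 2) ≡ n C 2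
  block-sizes = trans (sum-cong-≗ λ a → sym (countEdges-part decomposition a (block a) to from))
    (trans (countEdges-parts decomposition) (countEdges-complete n))

module CyclotomicDesign (q : ℕ) (q-prime : Prime q) (2<q : 2 < q) (e h : ℕ) .{{_ : NonZero e}} .{{_ : NonZero h}}
  (q-1 : e * (2 * h) ≡ count (FieldTheory.nonzero q q-prime)) (T : ℕ) (w : ℕ → ℕ)
  (e≡ : e ≡ prefix (triangle ∘ w) T) (large : ∀ {τ} → τ < T → threshold e (w τ) 1 < q) where

  open Residues q q-prime
  open FieldTheory q q-prime
  open FSolver using (solve; _:=_; _:+_; _:*_; _:-_; :-_; con)

  private
    H : ℕ
    H = 2 * h

    instance
      H≢0 : NonZero H
      H≢0 = m*n≢0 2 h

  open Cyclotomy e H q-1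

  private
    edgeColour : Fin q → Fin q → Fin e
    edgeColour x a = colour (a ⊝ x)

    eH≤q : e * H ≤ q
    eH≤q = ≤-trans (≤-reflexive q-1) (≤-trans (n≤1+n _) (≤-reflexive count-nonzero))

  open Embedding q e H edgeColour eH≤q count-sameColour

  private
    pairs : ℕ → ℕ
    pairs = triangle ∘ w

    -- Number of the edge i < j of clique τ among all e edges of the family; `triangle j` pairs have
    -- a larger endpoint below j. These numbers are the prescribed colours.
    index : ℕ → ℕ → ℕ → ℕ
    index τ i j = prefix pairs τ + (triangle j + i)

    index< : ∀ {τ i j} → τ < T → i < j → j < w τ → index τ i j < e
    index< {τ} {i} {j} τ<T i<j j<w = subst (index τ i j <_) (sym e≡) (prefix-< pairs {τ} {T} {triangle j + i} τ<T (prefix-< (λ j → j) {j} {w τ} {i} j<w i<j))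

    index-unique : ∀ {τ i j τ′ i′ j′} → i < j → j < w τ → i′ < j′ → j′ < w τ′ → index τ i j ≡ index τ′ i′ j′ →
      τ ≡ τ′ × i ≡ i′ × j ≡ j′
    index-unique {τ} {i} {j} {τ′} {i′} {j′} i<j j<w i′<j′ j′<w eq =
      let τ≡ , eq′ = prefix-unique pairs {τ} {τ′} {triangle j + i} {triangle j′ + i′}
            (prefix-< (λ j → j) {j} {w τ} {i} j<w i<j) (prefix-< (λ j → j) {j′} {w τ′} {i′} j′<w i′<j′) eq
          j≡ , i≡ = prefix-unique (λ j → j) {j} {j′} {i} {i′} i<j i′<j′ eq′
      in τ≡ , i≡ , j≡

    required : (τ : Fin T) → Fin (w (toℕ τ)) → Fin (w (toℕ τ)) → Fin e
    required τ i j with toℕ i <? toℕ j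
    ... | yes i<j = fromℕ< (index< (Finₚ.toℕ<n τ) i<j (Finₚ.toℕ<n j))
    ... | no _    = fromℕ< {0} (>-nonZero⁻¹ e)

    required-index : ∀ τ {i j} → i Fin.< j → toℕ (required τ i j) ≡ index (toℕ τ) (toℕ i) (toℕ j)
    required-index τ {i} {j} i<j with toℕ i <? toℕ j
    ... | yes _ = Finₚ.toℕ-fromℕ< _
    ... | no ≮ = contradiction i<j ≮

    abstract
      embedding : (τ : Fin T) → ∃ λ (x : Fin (w (toℕ τ)) → Fin q) →
        ∀ i j → i Fin.< j → x i ≢ x j × colour (x j ⊝ x i) ≡ required τ i j
      embedding τ = embed-all (w (toℕ τ)) (required τ) (large (Finₚ.toℕ<n τ))

    point : (τ : Fin T) → Fin (w (toℕ τ)) → Fin q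
    point τ = proj₁ (embedding τ)

    point-≢ : ∀ τ {i j} → i Fin.< j → point τ i ≢ point τ j
    point-≢ τ {i} {j} i<j = proj₁ (proj₂ (embedding τ) i j i<j)

    gap : (τ : Fin T) → Fin (w (toℕ τ)) → Fin (w (toℕ τ)) → Fin q
    gap τ i j = point τ j ⊝ point τ i

    gap-≢𝟘 : ∀ τ {i j} → i Fin.< j → gap τ i j ≢ 𝟘
    gap-≢𝟘 τ i<j = ⊝-≢𝟘 (point-≢ τ i<j ∘ sym)

    colour-gap : ∀ τ {i j} → i Fin.< j → toℕ (colour (gap τ i j)) ≡ index (toℕ τ) (toℕ i) (toℕ j)
    colour-gap τ {i} {j} i<j = trans (cong toℕ (proj₂ (proj₂ (embedding τ) i j i<j))) (required-index τ i<j)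

    point-injective : ∀ τ {i j} → point τ i ≡ point τ j → i ≡ j
    point-injective τ {i} {j} eq with Finₚ.<-cmp i j
    ... | tri< i<j _ _ = contradiction eq (point-≢ τ i<j)
    ... | tri≈ _ i≡j _ = i≡j
    ... | tri> _ _ j<i = contradiction (sym eq) (point-≢ τ j<i)

    -- One element of each pair {s, -s} of H-th roots of unity.
    half : Fin q → Bool
    half s = ⌊ s ↑ H ≟F 𝟏 ⌋ ∧ ⌊ toℕ s <? toℕ (⊖ s) ⌋

    module Half = Enumeration (enumerate half)

    root-≢𝟘 : ∀ {s} → s ↑ H ≡ 𝟏 → s ≢ 𝟘
    root-≢𝟘 sᴴ≡1 s≡0 = 𝟏≢𝟘 (trans (sym sᴴ≡1) (trans (cong (_↑ H) s≡0) (𝟘↑ q q-prime {H} (>-nonZero⁻¹ H))))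

  S : ℕ
  S = count half

  private
    scalar : Fin S → Fin q
    scalar = Half.nth

    scalar-root : ∀ s → scalar s ↑ H ≡ 𝟏
    scalar-root s = ⌊⌋-true (_ ≟F _) (proj₁ (∧-true _ _ (Half.nth-P s)))

    scalar-half : ∀ s → toℕ (scalar s) < toℕ (⊖ scalar s)
    scalar-half s = ⌊⌋-true (_ <? _) (proj₂ (∧-true ⌊ scalar s ↑ H ≟F 𝟏 ⌋ _ (Half.nth-P s)))

    image : (τ : Fin T) → Fin S → Fin q → Fin (w (toℕ τ)) → Fin q
    image τ s t i = scalar s ⊗ point τ i ⊕ t

    ⊕-cancelʳ : ∀ {x y z} → x ⊕ z ≡ y ⊕ z → x ≡ y
    ⊕-cancelʳ {x} {y} {z} eq = trans (expand x z) (trans (cong (_⊝ z) eq) (sym (expand y z)))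
      where
      expand : ∀ x z → x ≡ x ⊕ z ⊝ z
      expand x z = solve 2 (λ x z → x := x :+ z :- z) refl x z

    image-injective : ∀ τ s t {i j} → image τ s t i ≡ image τ s t j → i ≡ j
    image-injective τ s t eq = point-injective τ (⊗-cancelˡ (root-≢𝟘 (scalar-root s)) (⊕-cancelʳ eq))

    image-difference : ∀ s x y t → (s ⊗ y ⊕ t) ⊝ (s ⊗ x ⊕ t) ≡ s ⊗ (y ⊝ x)
    image-difference s x y t = solve 4 (λ s x y t → (s :* y :+ t) :- (s :* x :+ t) := s :* (y :- x)) refl s x y t

    Ordered : Fin q → Fin q → Fin T → Fin S → Fin q → Set
    Ordered u v τ s t = ∃ λ i → ∃ λ j → i Fin.< j × image τ s t i ≡ u × image τ s t j ≡ v

    ordered-gap : ∀ {u v τ s t} ((i , j , _) : Ordered u v τ s t) → v ⊝ u ≡ scalar s ⊗ gap τ i j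
    ordered-gap {τ = τ} {s} {t} (i , j , _ , refl , refl) = image-difference (scalar s) (point τ i) (point τ j) t

    colour-⊗ : ∀ {s x} → s ↑ H ≡ 𝟏 → x ≢ 𝟘 → colour (s ⊗ x) ≡ colour x
    colour-⊗ {s} {x} sᴴ≡1 x≢0 = ↑-colour (⊗-≢𝟘 (root-≢𝟘 sᴴ≡1) x≢0) x≢0
      (trans (^-distrib-* s x H) (trans (cong (_⊗ x ↑ H) sᴴ≡1) (𝟏⊗ (x ↑ H))))

    -- Translation leaves v - u unchanged and the root of unity s keeps its coset, so v - u alone
    -- reveals which edge of which clique it comes from.
    ordered-colour : ∀ {u v τ s t} ((i , j , _) : Ordered u v τ s t) →
      toℕ (colour (v ⊝ u)) ≡ index (toℕ τ) (toℕ i) (toℕ j)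
    ordered-colour {τ = τ} {s} o@(i , j , i<j , _) = trans (cong (toℕ ∘ colour) (ordered-gap o))
      (trans (cong toℕ (colour-⊗ (scalar-root s) (gap-≢𝟘 τ i<j))) (colour-gap τ i<j))

    ⊖-≢𝟘 : ∀ {x} → x ≢ 𝟘 → ⊖ x ≢ 𝟘
    ⊖-≢𝟘 {x} x≢0 eq = x≢0 (trans (solve 1 (λ x → x := :- (:- x)) refl x) (trans (cong ⊖_ eq) (solve 0 (:- con 0ℤ := con 0ℤ) refl)))

    ⊖-⊝ : ∀ u v → ⊖ (v ⊝ u) ≡ u ⊝ v
    ⊖-⊝ u v = solve 2 (λ u v → :- (v :- u) := u :- v) refl u v

    ordered-≢ : ∀ {u v τ s t} → Ordered u v τ s t → v ⊝ u ≢ 𝟘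
    ordered-≢ {τ = τ} {s} o@(_ , _ , i<j , _) eq = ⊗-≢𝟘 (root-≢𝟘 (scalar-root s)) (gap-≢𝟘 τ i<j) (trans (sym (ordered-gap o)) eq)

    colour-swap : ∀ {u v} → v ⊝ u ≢ 𝟘 → colour (u ⊝ v) ≡ colour (v ⊝ u)
    colour-swap {u} {v} ne = ↑-colour (subst (_≢ 𝟘) (⊖-⊝ u v) (⊖-≢𝟘 ne)) ne
      (trans (cong (_↑ H) (sym (⊖-⊝ u v))) (⊖-↑-even (v ⊝ u) h))

    Pair : Set
    Pair = Σ (Fin T) λ τ → Fin (w (toℕ τ)) × Fin (w (toℕ τ))

    pair-≡ : ∀ {τ τ′ : Fin T} {i j : Fin (w (toℕ τ))} {i′ j′ : Fin (w (toℕ τ′))} → τ ≡ τ′ →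
      toℕ i ≡ toℕ i′ → toℕ j ≡ toℕ j′ → _≡_ {A = Pair} (τ , i , j) (τ′ , i′ , j′)
    pair-≡ {τ} refl i≡ j≡ = cong₂ (λ i j → τ , i , j) (Finₚ.toℕ-injective i≡) (Finₚ.toℕ-injective j≡)

    same-pair : ∀ {u v u′ v′ τ s t τ′ s′ t′} ((i , j , _) : Ordered u v τ s t) ((i′ , j′ , _) : Ordered u′ v′ τ′ s′ t′) →
      colour (v ⊝ u) ≡ colour (v′ ⊝ u′) → _≡_ {A = Pair} (τ , i , j) (τ′ , i′ , j′)
    same-pair {τ = τ} {τ′ = τ′} o@(i , j , i<j , _) o′@(i′ , j′ , i′<j′ , _) eq =
      let τ≡ , i≡ , j≡ = index-unique {toℕ τ} {toℕ i} {toℕ j} {toℕ τ′} {toℕ i′} {toℕ j′}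
            i<j (Finₚ.toℕ<n j) i′<j′ (Finₚ.toℕ<n j′)
            (trans (sym (ordered-colour o)) (trans (cong toℕ eq) (ordered-colour o′)))
      in pair-≡ (Finₚ.toℕ-injective τ≡) i≡ j≡

    scalar-cancel : ∀ {τ i j s s′} → i Fin.< j → scalar s ⊗ gap τ i j ≡ scalar s′ ⊗ gap τ i j → s ≡ s′
    scalar-cancel {τ} {i} {j} {s} {s′} i<j eq = Half.nth-inj (⊗-cancelˡ (gap-≢𝟘 τ i<j)
      (trans (⊗-commutative (gap τ i j) (scalar s)) (trans eq (⊗-commutative (scalar s′) (gap τ i j)))))

    ⊕-cancelˡ : ∀ {x y z} → z ⊕ x ≡ z ⊕ y → x ≡ y
    ⊕-cancelˡ {x} {y} {z} eq = ⊕-cancelʳ {z = z} (trans (⊕-commutative x z) (trans eq (⊕-commutative z y)))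

    same-scalar : ∀ {u τ s t s′ t′} i → s ≡ s′ → image τ s t i ≡ u → image τ s′ t′ i ≡ u → s ≡ s′ × t ≡ t′
    same-scalar i refl iu iu′ = refl , ⊕-cancelˡ (trans iu (sym iu′))

    -- The equality of dependent triples is a separate argument so that matching on `refl`
    -- identifies τ, i and j at once. Cancelling the common gap then gives s, and the image of
    -- vertex i gives t.
    same-order′ : ∀ {u v τ s t τ′ s′ t′} (o@(i , j , _) : Ordered u v τ s t) (o′@(i′ , j′ , _) : Ordered u v τ′ s′ t′) →
      _≡_ {A = Pair} (τ , i , j) (τ′ , i′ , j′) → τ ≡ τ′ × s ≡ s′ × t ≡ t′
    same-order′ {τ = τ} {s} {t} {τ′} {s′} {t′} o@(i , j , i<j , iu , jv) o′@(i′ , j′ , i′<j′ , iu′ , jv′) refl =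
      refl , same-scalar {τ = τ} i (scalar-cancel {τ} i<j (trans (sym (ordered-gap o)) (ordered-gap o′))) iu iu′

    same-order : ∀ {u v τ s t τ′ s′ t′} → Ordered u v τ s t → Ordered u v τ′ s′ t′ → τ ≡ τ′ × s ≡ s′ × t ≡ t′
    same-order o o′ = same-order′ o o′ (same-pair o o′ refl)

    ⊖-⊗ : ∀ s x → ⊖ (s ⊗ x) ≡ (⊖ s) ⊗ x
    ⊖-⊗ s x = solve 2 (λ s x → :- (s :* x) := (:- s) :* x) refl s x

    ⊖-involutive : ∀ x → ⊖ (⊖ x) ≡ x
    ⊖-involutive x = solve 1 (λ x → :- (:- x) := x) refl x

    opposite-order′ : ∀ {u v τ s t τ′ s′ t′} ((i , j , _) : Ordered u v τ s t) ((i′ , j′ , _) : Ordered v u τ′ s′ t′) →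
      _≡_ {A = Pair} (τ , i , j) (τ′ , i′ , j′) → scalar s′ ≡ ⊖ scalar s
    opposite-order′ {u} {v} {τ} {s} {t} {τ′} {s′} {t′} o@(i , j , i<j , _) o′ refl =
      ⊗-cancelˡ (gap-≢𝟘 τ i<j) (begin
        gap τ i j ⊗ scalar s′            ≡⟨ ⊗-commutative (gap τ i j) (scalar s′) ⟩
        scalar s′ ⊗ gap τ i j            ≡⟨ sym (ordered-gap o′) ⟩
        u ⊝ v                            ≡⟨ sym (⊖-⊝ u v) ⟩
        ⊖ (v ⊝ u)                        ≡⟨ cong ⊖_ (ordered-gap o) ⟩
        ⊖ (scalar s ⊗ gap τ i j)         ≡⟨ ⊖-⊗ (scalar s) (gap τ i j) ⟩
        (⊖ scalar s) ⊗ gap τ i j         ≡⟨ ⊗-commutative (⊖ scalar s) (gap τ i j) ⟩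
        gap τ i j ⊗ ⊖ scalar s           ∎)
      where open ≡-Reasoning

    -- As v - u and u - v have the same colour, both copies would use the same edge, with scalars
    -- negative to each other; `half` contains only one of the two.
    opposite-order : ∀ {u v τ s t τ′ s′ t′} → Ordered u v τ s t → ¬ Ordered v u τ′ s′ t′
    opposite-order {s = s} {s′ = s′} o o′ = <-asym (scalar-half s)
      (subst₂ _<_ (cong toℕ s′≡-s) (cong toℕ (trans (cong ⊖_ s′≡-s) (⊖-involutive (scalar s)))) (scalar-half s′))
      where
      s′≡-s : scalar s′ ≡ ⊖ scalar s
      s′≡-s = opposite-order′ o o′ (same-pair o o′ (sym (colour-swap (ordered-≢ o))))

    Through : Fin q → Fin q → Fin T → Fin S → Fin q → Set
    Through u v τ s t = (∃ λ i → image τ s t i ≡ u) × (∃ λ i → image τ s t i ≡ v)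

    orient : ∀ {u v τ s t} → u ≢ v → Through u v τ s t → Ordered u v τ s t ⊎ Ordered v u τ s t
    orient u≢v ((i , iu) , (j , jv)) with Finₚ.<-cmp i j
    ... | tri< i<j _ _  = inj₁ (i , j , i<j , iu , jv)
    ... | tri> _ _ j<i  = inj₂ (j , i , j<i , jv , iu)
    ... | tri≈ _ refl _ = contradiction (trans (sym iu) jv) u≢v

    through-unique : ∀ {u v τ s t τ′ s′ t′} → u ≢ v → Through u v τ s t → Through u v τ′ s′ t′ → τ ≡ τ′ × s ≡ s′ × t ≡ t′
    through-unique {τ = τ} {τ′ = τ′} u≢v th th′ with orient {τ = τ} u≢v th | orient {τ = τ′} u≢v th′
    ... | inj₁ o | inj₁ o′ = same-order o o′
    ... | inj₂ o | inj₂ o′ = same-order o o′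
    ... | inj₁ o | inj₂ o′ = contradiction o′ (opposite-order o)
    ... | inj₂ o | inj₁ o′ = contradiction o′ (opposite-order o)

    -- From s = -s follows 2 s = 0, and 2 is nonzero modulo q because q > 2.
    ≢⊖ : ∀ {s} → s ≢ 𝟘 → s ≢ ⊖ s
    ≢⊖ {s} s≢0 eq = [ (λ 2≡0 → <⇒≱ 2<q (ℕ.∣⇒≤ ([]≡𝟘⇒∣ 2≡0))) , s≢0 ]′ (no-zero-divisors
      (trans (solve 1 (λ s → con (+ 2) :* s := s :- (:- s)) refl s) (trans (cong (_⊝ ⊖ s) eq) (CommutativeRing.-‿inverseʳ ring (⊖ s)))))

    half-or : ∀ {s} → s ↑ H ≡ 𝟏 → half s ≡ true ⊎ half (⊖ s) ≡ true
    half-or {s} sᴴ≡1 with <-cmp (toℕ s) (toℕ (⊖ s))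
    ... | tri< lt _ _ = inj₁ (cong₂ _∧_ (true-⌊⌋ (_ ≟F _) sᴴ≡1) (true-⌊⌋ (_ <? _) lt))
    ... | tri≈ _ eq _ = contradiction (Finₚ.toℕ-injective eq) (≢⊖ (root-≢𝟘 sᴴ≡1))
    ... | tri> _ _ gt = inj₂ (cong₂ _∧_ (true-⌊⌋ (_ ≟F _) (trans (⊖-↑-even s h) sᴴ≡1))
                                (true-⌊⌋ (_ <? _) (subst (λ z → toℕ (⊖ s) < toℕ z) (sym (⊖-involutive s)) gt)))

    -- There are exactly as many colours as edges in the family, so decoding the colour of d names
    -- an edge whose gap lies in the coset of d. The quotient of two members of a coset is an H-th
    -- root of unity.
    locate : ∀ {d} → d ≢ 𝟘 → ∃ λ τ → ∃ λ i → ∃ λ j → ∃ λ r → r ↑ H ≡ 𝟏 × d ≡ r ⊗ gap τ i j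
    locate {d} d≢0 =
      let τ , r , τ<T , r< , eq = prefix-decode pairs T (subst (toℕ (colour d) <_) e≡ (Finₚ.toℕ<n (colour d)))
          j , i , j<w , i<j , eq′ = prefix-decode (λ j → j) (w τ) r<
      in build τ τ<T j<w i<j (trans eq (cong (λ z → prefix pairs τ + z) eq′))
      where
      divide : ∀ {g} → g ≢ 𝟘 → colour d ≡ colour g → ∃ λ r → r ↑ H ≡ 𝟏 × d ≡ r ⊗ g
      divide {g} g≢0 eq = d ⊗ g ⁻¹ ,
        trans (^-distrib-* d (g ⁻¹) H) (trans (cong (_⊗ (g ⁻¹) ↑ H) (colour-↑ d≢0 g≢0 eq))
          (trans (sym (^-distrib-* g (g ⁻¹) H)) (trans (cong (_↑ H) (⁻¹-inverseʳ g≢0)) (𝟏↑ H)))) ,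
        sym (trans (CommutativeRing.*-assoc ring d (g ⁻¹) g) (trans (cong (d ⊗_) (trans (⊗-commutative (g ⁻¹) g) (⁻¹-inverseʳ g≢0))) (⊗𝟏 d)))
      fill : (τ : Fin T) {i j : Fin (w (toℕ τ))} → i Fin.< j → toℕ (colour d) ≡ index (toℕ τ) (toℕ i) (toℕ j) →
        ∃ λ τ → ∃ λ i → ∃ λ j → ∃ λ r → r ↑ H ≡ 𝟏 × d ≡ r ⊗ gap τ i j
      fill τ {i} {j} i<j eq = τ , i , j , divide (gap-≢𝟘 τ i<j) (Finₚ.toℕ-injective (trans eq (sym (colour-gap τ i<j))))
      build : ∀ τ {i j} → τ < T → j < w τ → i < j → toℕ (colour d) ≡ index τ i j →
        ∃ λ τ → ∃ λ i → ∃ λ j → ∃ λ r → r ↑ H ≡ 𝟏 × d ≡ r ⊗ gap τ i j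
      -- Rewriting the number τ as `toℕ τ′` turns the bounds by `w τ` into bounds for the vertex
      -- type of clique τ′.
      build τ {i} {j} τ<T j<w i<j eq with fromℕ< τ<T in τ-eq | Finₚ.toℕ-fromℕ< τ<T
      ... | τ′ | refl = fill τ′ {fromℕ< (<-trans i<j j<w)} {fromℕ< j<w}
        (subst₂ _<_ (sym (Finₚ.toℕ-fromℕ< (<-trans i<j j<w))) (sym (Finₚ.toℕ-fromℕ< j<w)) i<j)
        (trans eq (cong₂ (index (toℕ τ′)) (sym (Finₚ.toℕ-fromℕ< (<-trans i<j j<w))) (sym (Finₚ.toℕ-fromℕ< j<w))))

    add-difference : ∀ u v → u ⊕ (v ⊝ u) ≡ v
    add-difference u v = solve 2 (λ u v → u :+ (v :- u) := v) refl u v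

    exchange : ∀ a b u → a ⊕ (u ⊝ b) ≡ u ⊕ (a ⊝ b)
    exchange a b u = solve 3 (λ a b u → a :+ (u :- b) := u :+ (a :- b)) refl a b u

    aligned : ∀ {u v} τ i j s → v ⊝ u ≡ scalar s ⊗ gap τ i j → ∃ λ t → Through u v τ s t
    aligned {u} {v} τ i j s d≡ = u ⊝ scalar s ⊗ point τ i ,
      (i , add-difference (scalar s ⊗ point τ i) u) ,
      (j , trans (exchange (scalar s ⊗ point τ j) (scalar s ⊗ point τ i) u) (trans (cong (u ⊕_)
        (trans (sym (⊗-distribˡ-⊝ (scalar s) (point τ j) (point τ i))) (sym d≡))) (add-difference u v)))

    -- If only -r belongs to `half`, the roles of u and v are exchanged, since u - v = (-r) times
    -- the gap.
    through-multiple : ∀ {u v} τ i j r → r ↑ H ≡ 𝟏 → v ⊝ u ≡ r ⊗ gap τ i j → ∃ λ s → ∃ λ t → Through u v τ s t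
    through-multiple {u} {v} τ i j r rᴴ≡1 d≡ with half-or rᴴ≡1
    ... | inj₁ r∈S =
      let s , s≡r = Half.rank r r∈S
          t , through = aligned τ i j s (trans d≡ (cong (_⊗ gap τ i j) (sym s≡r)))
      in s , t , through
    ... | inj₂ -r∈S =
      let s , s≡-r = Half.rank (⊖ r) -r∈S
          t , v-in , u-in = aligned τ i j s (trans (sym (⊖-⊝ u v)) (trans (cong ⊖_ d≡)
            (trans (⊖-⊗ r (gap τ i j)) (cong (_⊗ gap τ i j) (sym s≡-r)))))
      in s , t , u-in , v-in

    through-exists : ∀ {u v} → u ≢ v → ∃ λ τ → ∃ λ s → ∃ λ t → Through u v τ s t
    through-exists {u} {v} u≢v =
      let τ , i , j , r , rᴴ≡1 , d≡ = locate (⊝-≢𝟘 (u≢v ∘ sym))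
      in τ , through-multiple τ i j r rᴴ≡1 d≡

    member : Fin T → Fin S → Fin q → Fin q → Bool
    member τ s t v = ⌊ Finₚ.any? (λ i → image τ s t i ≟F v) ⌋

  blockCount : ℕ
  blockCount = T * (S * q)

  shape : Fin blockCount → Fin T
  shape a = proj₁ (Fin.remQuot {T} (S * q) a)

  private
    parameters : Fin blockCount → Fin T × Fin S × Fin q
    parameters a = shape a , Fin.remQuot {S} q (proj₂ (Fin.remQuot {T} (S * q) a))

    address : Fin T → Fin S → Fin q → Fin blockCount
    address τ s t = Fin.combine τ (Fin.combine s t)

    parameters-address : ∀ τ s t → parameters (address τ s t) ≡ (τ , s , t)
    parameters-address τ s t = trans
      (cong (λ p → proj₁ p , Fin.remQuot {S} q (proj₂ p)) (Finₚ.remQuot-combine {T} τ (Fin.combine s t)))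
      (cong (τ ,_) (Finₚ.remQuot-combine {S} s t))

    address-parameters : ∀ a → let τ , s , t = parameters a in address τ s t ≡ a
    address-parameters a = trans (cong (Fin.combine (shape a)) (Finₚ.combine-remQuot {S} q _)) (Finₚ.combine-remQuot {T} (S * q) a)

    blockOf : Fin T × Fin S × Fin q → Subset q
    blockOf (τ , s , t) = Vec.tabulate (member τ s t)

    ∈⇒image : ∀ {τ s t v} → v ∈ blockOf (τ , s , t) → ∃ λ i → image τ s t i ≡ v
    ∈⇒image {τ} {s} {t} {v} v∈ = ⌊⌋-true (Finₚ.any? _) (trans (sym (Vec.lookup∘tabulate (member τ s t) v)) (∈⇒lookup v∈))

    image⇒∈ : ∀ {τ s t v} → (∃ λ i → image τ s t i ≡ v) → v ∈ blockOf (τ , s , t)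
    image⇒∈ {τ} {s} {t} {v} im = lookup⇒∈ (trans (Vec.lookup∘tabulate (member τ s t) v) (true-⌊⌋ (Finₚ.any? _) im))

  linearSpace : LinearSpace q blockCount
  linearSpace = record
    { block = blockOf ∘ parameters
    ; cover = λ u≢v → let τ , s , t , im-u , im-v = through-exists u≢v in
        address τ s t , subst (λ b → _ ∈ blockOf b) (sym (parameters-address τ s t)) (image⇒∈ {τ} {s} {t} im-u)
                      , subst (λ b → _ ∈ blockOf b) (sym (parameters-address τ s t)) (image⇒∈ {τ} {s} {t} im-v)
    ; unique = λ {a} {b} u≢v ua va ub vb →
        let τ≡ , s≡ , t≡ = through-unique u≢v (∈⇒image {shape a} ua , ∈⇒image {shape a} va) (∈⇒image {shape b} ub , ∈⇒image {shape b} vb)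
        in trans (sym (address-parameters a)) (trans (cong₂ (λ τ st → address τ (proj₁ st) (proj₂ st)) τ≡ (cong₂ _,_ s≡ t≡)) (address-parameters b)) }

  block-size : ∀ a → Subset.∣ LinearSpace.block linearSpace a ∣ ≡ w (toℕ (shape a))
  block-size a = let τ , s , t = parameters a in
    trans (∣∣-count (blockOf (τ , s , t))) (count-image (image τ s t) (image-injective τ s t) _
      (λ i → ∈⇒lookup (image⇒∈ {τ} {s} {t} (i , refl)))
      (λ v v∈ → ∈⇒image {τ} {s} {t} (lookup⇒∈ v∈)))

  someBlock : Fin blockCount
  someBlock = proj₁ (LinearSpace.cover linearSpace {𝟘} {𝟏} (𝟏≢𝟘 ∘ sym))

  -- Obtained by counting the edges of K_q block by block: each of the T shapes occurs S q times,
  -- and together they have e edges. This determines S indirectly.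
  edge-count : S * q * e ≡ q C 2
  edge-count = trans (sym (begin
    sum (λ a → Subset.∣ LinearSpace.block linearSpace a ∣ C 2)             ≡⟨ sum-cong-≗ {blockCount} (λ a → cong (_C 2) (block-size a)) ⟩
    sum {blockCount} (λ a → w (toℕ (shape a)) C 2)                         ≡⟨ ∑-combine {T} {S * q} (λ a → w (toℕ (shape a)) C 2) ⟩
    sum {T} (λ τ → sum {S * q} (λ b → w (toℕ (shape (Fin.combine τ b))) C 2)) ≡⟨ sum-cong-≗ {T} (λ τ → sum-cong-≗ {S * q} λ b → cong (λ st → w (toℕ (proj₁ st)) C 2) (Finₚ.remQuot-combine {T} τ b)) ⟩
    sum {T} (λ τ → sum {S * q} (λ _ → w (toℕ τ) C 2))                      ≡⟨ sum-cong-≗ {T} (λ τ → ∑-const (S * q) (w (toℕ τ) C 2)) ⟩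
    sum {T} (λ τ → S * q * (w (toℕ τ) C 2))                                ≡⟨ sym (*-distribˡ-sum {T} (S * q) (λ τ → w (toℕ τ) C 2)) ⟩
    S * q * sum {T} (λ τ → w (toℕ τ) C 2)                                  ≡⟨ cong (S * q *_) (trans (sum-cong-≗ {T} λ τ → sym (triangle≡C2 (w (toℕ τ)))) (prefix-∑ pairs T)) ⟩
    S * q * prefix pairs T                                                 ≡⟨ cong (S * q *_) (sym e≡) ⟩
    S * q * e                                                              ∎)) (block-sizes linearSpace someBlock)
    where open ≡-Reasoning

-- The rational parameter and the choice of the clique family

toℚ-≤⇒ : ∀ {c u d} .{cop : Coprime u (suc d)} → toℚ c ≤ℚ mkℚ (+ u) d cop → c * suc d ≤ u
toℚ-≤⇒ {c} {u} {d} c≤r with ℚᵘ.≤-respˡ-≃ (ℚ.toℚᵘ-fromℚᵘ (mkℚᵘ (+ c) 0)) (ℚ.toℚᵘ-mono-≤ c≤r)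
... | *≤* le = ℤ.drop‿+≤+ (subst₂ ℤ._≤_ (sym (ℤ.pos-* c (suc d))) (ℤ.*-identityʳ (+ u)) le)

toℚ-≰-negative : ∀ {c n d} .{cop : Coprime (suc n) (suc d)} → ¬ toℚ c ≤ℚ mkℚ -[1+ n ] d cop
toℚ-≰-negative {c} {n} {d} c≤r with ℚᵘ.≤-respˡ-≃ (ℚ.toℚᵘ-fromℚᵘ (mkℚᵘ (+ c) 0)) (ℚ.toℚᵘ-mono-≤ c≤r)
... | *≤* le with subst₂ ℤ._≤_ (sym (ℤ.pos-* c (suc d))) (ℤ.*-identityʳ -[1+ n ]) le
...   | ()

<-toℚ⇒ : ∀ {c u d} .{cop : Coprime u (suc d)} → mkℚ (+ u) d cop <ℚ toℚ c → u < c * suc d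
<-toℚ⇒ {c} {u} {d} r<c with ℚᵘ.<-respʳ-≃ (ℚ.toℚᵘ-fromℚᵘ (mkℚᵘ (+ c) 0)) (ℚ.toℚᵘ-mono-< r<c)
... | *<* lt = ℤ.drop‿+<+ (subst₂ ℤ._<_ (ℤ.*-identityʳ (+ u)) (sym (ℤ.pos-* c (suc d))) lt)

toℚ-* : ∀ {k c u d} .{cop : Coprime u (suc d)} → k * u ≡ c * suc d → toℚ k *ℚ mkℚ (+ u) d cop ≡ toℚ c
toℚ-* {k} {c} {u} {d} {cop} eq = ℚ.toℚᵘ-injective (ℚᵘ.≃-trans (ℚ.toℚᵘ-homo-* (toℚ k) (mkℚ (+ u) d cop))
  (ℚᵘ.≃-trans (ℚᵘ.*-congʳ {mkℚᵘ (+ u) d} (ℚ.toℚᵘ-fromℚᵘ (mkℚᵘ (+ k) 0)))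
    (ℚᵘ.≃-trans (*≡* cross) (ℚᵘ.≃-sym (ℚ.toℚᵘ-fromℚᵘ (mkℚᵘ (+ c) 0))))))
  where
  cross : + k ℤ.* + u ℤ.* + 1 ≡ + c ℤ.* + suc (d + 0)
  cross = trans (ℤ.*-identityʳ (+ k ℤ.* + u)) (trans (sym (ℤ.pos-* k u))
    (trans (cong +_ (trans eq (cong (λ z → c * suc z) (sym (+-identityʳ d))))) (ℤ.pos-* c (suc (d + 0)))))

cliqueSize : ℕ → ℕ → ℕ → ℕ
cliqueSize p b τ = if ⌊ τ <? b ⌋ then suc p else p

cliqueSize-cases : ∀ p b τ → cliqueSize p b τ ≡ p ⊎ cliqueSize p b τ ≡ suc p
cliqueSize-cases p b τ with τ <? b
... | yes _ = inj₂ refl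
... | no _  = inj₁ refl

prefix-cliqueSize : ∀ p b n → prefix (triangle ∘ cliqueSize p b) n ≡ n * triangle p + (b ⊓ n) * p
prefix-cliqueSize p b zero    = sym (cong (_* p) (⊓-zeroʳ b))
prefix-cliqueSize p b (suc n) with n <? b
... | yes n<b = trans (cong (_+ (triangle p + p)) (prefix-cliqueSize p b n)) (trans
  (cong (λ z → n * triangle p + z * p + (triangle p + p)) (m≥n⇒m⊓n≡n (<⇒≤ n<b))) (trans
  (solve 3 (λ n t p → n :* t :+ n :* p :+ (t :+ p) := (con 1 :+ n) :* t :+ (con 1 :+ n) :* p) refl n (triangle p) p)
  (cong (λ z → suc n * triangle p + z * p) (sym (m≥n⇒m⊓n≡n n<b)))))
  where open ℕSolver
... | no n≮b = trans (cong (_+ triangle p) (prefix-cliqueSize p b n)) (trans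
  (cong (λ z → n * triangle p + z * p + triangle p) (m≤n⇒m⊓n≡m (≮⇒≥ n≮b))) (trans
  (solve 4 (λ n t b p → n :* t :+ b :* p :+ t := (con 1 :+ n) :* t :+ b :* p) refl n (triangle p) b p)
  (cong (λ z → suc n * triangle p + z * p) (sym (m≤n⇒m⊓n≡m (≤-trans (≮⇒≥ n≮b) (n≤1+n n)))))))
  where open ℕSolver

decompose-modulo : ∀ s T b e q (q-prime : Prime q) h → 1 ≤ e → e ≡ prefix (triangle ∘ cliqueSize (suc s) b) T →
  2 < q → threshold e (suc s) 1 < q → threshold e (suc (suc s)) 1 < q →
  count (FieldTheory.nonzero q q-prime) ≡ h * (2 * e) →
  ∃ λ m → m * e ≡ q C 2 × Σ (Decomposition q (T * m)) (λ c → CliqueParts (suc s) c × AttainsM c)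
decompose-modulo s T b e q q-prime h 1≤e e≡ 2<q large₁ large₂ eq = D.S * q , D.edge-count , c , cliques , cliqueParts⇒attainsM s c cliques
  where
  p = suc s
  large : ∀ {τ} → τ < T → threshold e (cliqueSize p b τ) 1 < q
  large {τ} _ = [ (λ size → subst (λ z → threshold e z 1 < q) (sym size) large₁)
                , (λ size → subst (λ z → threshold e z 1 < q) (sym size) large₂) ]′ (cliqueSize-cases p b τ)
  h≢0 : h ≢ 0
  h≢0 h≡0 = <⇒≢ (<-trans (s≤s (s≤s z≤n)) 2<q)
    (trans (cong suc (sym (trans eq (cong (_* (2 * e)) h≡0)))) (FieldTheory.count-nonzero q q-prime))
  q-1 : e * (2 * h) ≡ count (FieldTheory.nonzero q q-prime)
  q-1 = trans (solve 2 (λ e h → e :* (con 2 :* h) := h :* (con 2 :* e)) refl e h) (sym eq)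
    where open ℕSolver
  module D = CyclotomicDesign q q-prime 2<q e h {{>-nonZero 1≤e}} {{≢-nonZero h≢0}} q-1 T (cliqueSize p b) e≡ large
  c : Decomposition q D.blockCount
  c = decomposition D.linearSpace D.someBlock
  cliques : CliqueParts p c
  cliques = cliqueParts D.linearSpace D.someBlock p λ a →
    subst (λ z → z ≡ p ⊎ z ≡ suc p) (sym (D.block-size a)) (cliqueSize-cases p b (toℕ (D.shape a)))

decompose : ∀ s T b e → 1 ≤ e → e ≡ prefix (triangle ∘ cliqueSize (suc s) b) T → ∀ N →
  ∃ λ n → N ≤ n × ∃ λ m → m * e ≡ n C 2 ×
    Σ (Decomposition n (T * m)) (λ c → CliqueParts (suc s) c × AttainsM c)
decompose s T b e 1≤e e≡ N =
  -- The bound secures three things at once: n ≥ N, odd characteristic, and room to embed both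
  -- clique sizes.
  let q , q-prime , B<q , 2e∣q-1 = primes≡1 (2 * e) (N + 2 + (t₁ + t₂)) (≤-trans 1≤e (m≤n*m e 2))
  in q , <⇒≤ (≤-<-trans (≤-trans (m≤m+n N 2) (m≤m+n (N + 2) (t₁ + t₂))) B<q) ,
     decompose-modulo s T b e q q-prime (ℕ._∣_.quotient 2e∣q-1) 1≤e e≡
       (≤-<-trans (≤-trans (m≤n+m 2 N) (m≤m+n (N + 2) (t₁ + t₂))) B<q)
       (≤-<-trans (≤-trans (m≤m+n t₁ t₂) (m≤n+m (t₁ + t₂) (N + 2))) B<q)
       (≤-<-trans (≤-trans (m≤n+m t₂ t₁) (m≤n+m (t₁ + t₂) (N + 2))) B<q)
       (ℕ._∣_.equality 2e∣q-1)
  where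
  t₁ = threshold e (suc s) 1
  t₂ = threshold e (suc (suc s)) 1

theorem6p5 : ∀ (r : ℚ) (p : ℕ) → toℚ 3 ≤ℚ r → 3 ≤ p →
    toℚ (p C 2) ≤ℚ r → r <ℚ toℚ (suc p C 2) →
    ∀ (N : ℕ) → ∃[ n ] (N ≤ n × ∃[ k ] (toℚ k *ℚ r ≡ toℚ (n C 2) ×
    Σ (Decomposition n k) (λ c → CliqueParts p c × AttainsM c)))
theorem6p5 (mkℚ -[1+ _ ] _ _) p _ _ lo _ N = contradiction lo (toℚ-≰-negative {p C 2})
theorem6p5 (mkℚ (+ u) d _) (suc s) 3≤r _ lo hi N =
  let n , N≤n , m , edges , c = decompose s T b (p * u) 1≤e e≡ N
  in n , N≤n , T * m , toℚ-* {T * m} {n C 2} (trans (solve 4 (λ p v m u → p :* v :* m :* u := m :* (p :* u) :* v) refl p v m u) (cong (_* v) edges)) , c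
  where
  open ℕSolver
  p = suc s
  v = suc d
  -- For r = u / v, a family of T cliques with average r has T r = p u edges. Each K_(p+1) has p
  -- edges more than K_p, so b = u - v C(p,2) copies of it are required; the factor p in T makes
  -- this an integer.
  T = p * v
  Cv≤u : (p C 2) * v ≤ u
  Cv≤u = toℚ-≤⇒ {p C 2} lo
  b = u ∸ (p C 2) * v
  b+Cv≡u : b + (p C 2) * v ≡ u
  b+Cv≡u = m∸n+n≡m Cv≤u
  b≤T : b ≤ T
  b≤T = +-cancelʳ-≤ ((p C 2) * v) b T (begin
    b + (p C 2) * v            ≡⟨ b+Cv≡u ⟩
    u                          ≤⟨ <⇒≤ (<-toℚ⇒ {suc p C 2} hi) ⟩
    (suc p C 2) * v            ≡⟨ cong (_* v) (trans (sym (nCk+nC[k+1]≡[n+1]C[k+1] p 1)) (cong (_+ p C 2) (nC1≡n p))) ⟩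
    (p + p C 2) * v            ≡⟨ *-distribʳ-+ v p (p C 2) ⟩
    T + (p C 2) * v            ∎)
    where open ≤-Reasoning
  1≤e : 1 ≤ p * u
  1≤e = *-mono-≤ {1} {p} {1} {u} (s≤s z≤n) (≤-trans (s≤s z≤n) (toℚ-≤⇒ {3} 3≤r))
  e≡ : p * u ≡ prefix (triangle ∘ cliqueSize p b) T
  e≡ = sym (begin
    prefix (triangle ∘ cliqueSize p b) T     ≡⟨ prefix-cliqueSize p b T ⟩
    T * triangle p + (b ⊓ T) * p             ≡⟨ cong₂ (λ x y → T * x + y * p) (triangle≡C2 p) (m≤n⇒m⊓n≡m b≤T) ⟩
    T * (p C 2) + b * p                      ≡⟨ solve 4 (λ p v c b → p :* v :* c :+ b :* p := p :* (b :+ c :* v)) refl p v (p C 2) b ⟩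
    p * (b + (p C 2) * v)                    ≡⟨ cong (p *_) b+Cv≡u ⟩
    p * u                                    ∎)
    where open ≡-Reasoning
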